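{- Let $n \ge 1$ and let $w = w_1 \cdots w_n \in \mathfrak{S}_n$ (one-line notation) be a permutation which avoids the pattern $4231$, does not avoid the pattern $3412$, and satisfies $\mathrm{gap}_{3412}(w) > 1$. Then the (modified, signless) Kazhdan--Lusztig basis element $\widetilde{C}_w$ of the type-$A$ Hecke algebra $H_n(q)$ has no parabolic factorization; that is, there is no finite sequence of intervals $\mathcal{A} = ([a_1,b_1],\ldots,[a_m,b_m])$, each contained in $[n]=\{1,\ldots,n\}$, such that $$\widetilde{C}_w = \frac{1}{f_{\mathcal{A}}(q)}\, \widetilde{C}_{s_{[a_1,b_1]}} \cdots \widetilde{C}_{s_{[a_m,b_m]}}.$$
   Context: Permutations and patterns. $\mathfrak{S}_n$ is the symmetric group with standard generators $s_1,\ldots,s_{n-1}$ (adjacent transpositions), length function $\ell$, Bruhat order $\le$, and identity $e$. A word $y_1\cdots y_k$ of distinct letters matches the pattern $u = u_1 \cdots u_k \in \mathfrak{S}_k$ if for all $i,j$ we have $u_i<u_j \iff y_i<y_j$. A permutation $w\in\mathfrak{S}_n$ avoids the pattern $u$ if no subword $w_{i_1}\cdots w_{i_k}$ ($i_1<\cdots<i_k$) matches $u$. For $w$ not avoiding $3412$, $$\mathrm{gap}_{3412}(w) = \min\{ w_{i_1}-w_{i_4} \mid i_1<i_2<i_3<i_4,\ w_{i_1}w_{i_2}w_{i_3}w_{i_4} \text{ matches the pattern } 3412\}.$$ For $1\le a\le b\le n$, the reversal $s_{[a,b]} \in \mathfrak{S}_n$ is the permutation with one-line notation $1\cdots(a-1)\,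 b\,(b-1)\cdots a\,(b+1)\cdots n$. Hecke algebra. $H_n(q)$ is the $\mathbb{Z}[q^{1/2},q^{ -1/2}]$-algebra which is free as a module with natural basis $\{T_w \mid w\in\mathfrak{S}_n\}$, with identity $T_e$ and multiplication determined by $T_{s_i}T_w = T_{s_iw}$ if $s_iw>w$, and $T_{s_i}T_w = (q-1)T_w + qT_{s_iw}$ if $s_iw<w$. The bar involution is the semilinear ring involution with $\overline{q^{1/2}} = q^{ -1/2}$ and $\overline{T_w} = (T_{w^{ -1}})^{ -1}$. The Kazhdan--Lusztig basis $\{C'_w \mid w\in\mathfrak{S}_n\}$ is the unique basis satisfying $\overline{C'_w} = C'_w$ and $$\widetilde{C}_w := q^{\ell(w)/2} C'_w = \sum_{v\le w} P_{v,w}(q)\, T_v,$$ where $P_{v,w}(q)\in\mathbb{Z}[q]$, $P_{w,w}(q)=1$, and $\deg P_{v,w}(q) \le \frac{\ell(w)-\ell(v)-1}{2}$ for $v<w$. The $P_{v,w}(q)$ are the Kazhdan--Lusztig polynomials. In particular $\widetilde{C}_{s_{[a,b]}} = \sum_{u\le s_{[a,b]}} T_u$. Parabolic factorization. Given a sequence of intervals $\mathcal{A} = ([a_1,b_1],\ldots,[a_m,b_m])$ contained in $[n]$, define for $1\le i<j\le m$ $$I_{i,j} = \bigl([a_i,b_i]\cap[a_j,b_j]\bigr) \setminus \bigl([a_{i+1},b_{i+1}]\cup\cdots\cup[a_{j-1},b_{j-1}]\bigr), \qquad f_{\mathcal{A}}(q) = \prod_{i<j} |I_{i,j}|_q!,$$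 where $k_q! = \prod_{i=1}^{k}(1+q+\cdots+q^{i-1})$ and $0_q!=1$. The element $\widetilde{C}_w$ has a parabolic factorization if there is such a sequence $\mathcal{A}$ with $\widetilde{C}_w = \frac{1}{f_{\mathcal{A}}(q)}\widetilde{C}_{s_{[a_1,b_1]}}\cdots\widetilde{C}_{s_{[a_m,b_m]}}$ (equivalently, $f_{\mathcal{A}}(q)\,\widetilde{C}_w = \widetilde{C}_{s_{[a_1,b_1]}}\cdots\widetilde{C}_{s_{[a_m,b_m]}}$). -}

module Defs where

open import Algebra.Bundles.Raw using (RawRing)
open import Algebra.Core using (Op₁; Op₂)
open import Algebra.Definitions using (Involutive)
open import Algebra.Morphism.Structures using (module RingMorphisms)
open import Algebra.Structures using (IsRing)
open import Data.Bool.Base using (if_then_else_)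
open import Data.Fin.Base as Fin using (Fin; toℕ; fromℕ<)
open import Data.Fin.Patterns using (0F; 3F)
import Data.Fin.Permutation as Perm
open Perm using (_⟨$⟩ʳ_; _∘ₚ_; permutation; transpose)
import Data.Fin.Properties as Finₚ
open import Data.Fin.Subset using (Subset; _∩_; _─_; ⋃; ∣_∣)
open import Data.Integer.Base as ℤ using (ℤ; +_; 0ℤ; 1ℤ)
import Data.Integer.Properties as ℤₚ
open import Data.List.Base as List
  using (List; []; _∷_; _++_; allFin; cartesianProduct; concatMap; filter; foldr; length)
open import Data.Nat.Base using (ℕ; zero; suc; _+_; _*_; _∸_; _≤_; _<_)
import Data.Nat.Properties as ℕₚ
open import Data.Product.Base using (_×_; _,_; proj₂; ∃; ∃-syntax)
open import Data.Vec.Base as Vec using (Vec; []; _∷_)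
open import Function.Base using (_∘_)
open import Function.Bundles using (_⇔_)
open import Function.Definitions using (Bijective)
open import Level using (0ℓ)
open import Relation.Binary.PropositionalEquality
  using (_≡_; _≢_; refl; sym; trans; cong)
open import Relation.Nullary using (¬_; Dec; yes; no; does; contradiction; _×-dec_)

-- Permutations of {0, …, n-1}: all positions, values and interval
-- endpoints are shifted down by one from the usual {1, …, n}.
-- The one-line notation of w is w ⟨$⟩ʳ 0, w ⟨$⟩ʳ 1, …

𝔖 : ℕ → Set
𝔖 = Perm.Permutation′

-- _≈ₚ_ is equality of one-line notations.

open Perm public using () renaming (_≈_ to _≈ₚ_; id to e; flip to _⁻¹)

infixr 9 _⊙_

-- (u ⊙ v)(i) = u(v(i)), whereas stdlib's _∘ₚ_ is diagrammatic.

_⊙_ : ∀ {n} → 𝔖 n → 𝔖 n → 𝔖 n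
u ⊙ v = v ∘ₚ u

_≟ₚ_ : ∀ {n} (v w : 𝔖 n) → Dec (v ≈ₚ w)
v ≟ₚ w = Finₚ.all? (λ i → (v ⟨$⟩ʳ i) Finₚ.≟ (w ⟨$⟩ʳ i))

-- The Coxeter length, computed as the number of inversions.

ℓ : ∀ {n} → 𝔖 n → ℕ
ℓ {n} w = length (filter
  (λ (i , j) → (i Finₚ.<? j) ×-dec ((w ⟨$⟩ʳ j) Finₚ.<? (w ⟨$⟩ʳ i)))
  (cartesianProduct (allFin n) (allFin n)))

-- The Bruhat order is generated by v < v t for t a transposition with
-- ℓ(v) < ℓ(v t).

infix 4 _≤ᴮ_ _<ᴮ_

data _≤ᴮ_ {n : ℕ} : 𝔖 n → 𝔖 n → Set where
  done : ∀ {v w} → v ≈ₚ w → v ≤ᴮ w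
  step : ∀ {v w} (i j : Fin n) → ℓ v < ℓ (v ⊙ transpose i j) →
         v ⊙ transpose i j ≤ᴮ w → v ≤ᴮ w

_<ᴮ_ : ∀ {n} → 𝔖 n → 𝔖 n → Set
v <ᴮ w = v ≤ᴮ w × ¬ (v ≈ₚ w)

-- A pattern u ∈ 𝔖 k is given by its one-line notation.

record Occurrence {k n : ℕ} (u : Vec ℕ k) (w : 𝔖 n) : Set where
  field
    pos        : Fin k → Fin n
    increasing : ∀ {a b} → a Fin.< b → pos a Fin.< pos b

  letter : Fin k → Fin n
  letter a = w ⟨$⟩ʳ pos a

  field
    matches : ∀ a b → (Vec.lookup u a < Vec.lookup u b) ⇔ (letter a Fin.< letter b)

Avoids : ∀ {k n} → Vec ℕ k → 𝔖 n → Set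
Avoids u w = ¬ Occurrence u w

4231ₚ 3412ₚ : Vec ℕ 4
4231ₚ = 4 ∷ 2 ∷ 3 ∷ 1 ∷ []
3412ₚ = 3 ∷ 4 ∷ 1 ∷ 2 ∷ []

-- In an occurrence of 3412 the first letter exceeds the last, so the
-- truncated subtraction is exact.

drop₁₄ : ∀ {n} {w : 𝔖 n} → Occurrence 3412ₚ w → ℕ
drop₁₄ o = toℕ (letter 0F) ∸ toℕ (letter 3F)
  where open Occurrence o

-- gap₃₄₁₂(w) = g.

IsGap₃₄₁₂ : ∀ {n} → 𝔖 n → ℕ → Set
IsGap₃₄₁₂ w g = (∃[ o ] drop₁₄ {w = w} o ≡ g) × (∀ o → g ≤ drop₁₄ {w = w} o)

record Interval (n : ℕ) : Set where
  constructor [_,_]⟨_⟩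
  field
    lo hi : Fin n
    lo≤hi : lo Fin.≤ hi

open Interval public

infix 4 _∈ᴵ_ _∈ᴵ?_

_∈ᴵ_ : ∀ {n} → Fin n → Interval n → Set
k ∈ᴵ I = lo I Fin.≤ k × k Fin.≤ hi I

_∈ᴵ?_ : ∀ {n} (k : Fin n) (I : Interval n) → Dec (k ∈ᴵ I)
k ∈ᴵ? I = (lo I Finₚ.≤? k) ×-dec (k Finₚ.≤? hi I)

toSubset : ∀ {n} → Interval n → Subset n
toSubset I = Vec.tabulate (λ k → does (k ∈ᴵ? I))

module _ {n : ℕ} (I : Interval n) where

  private
    a = toℕ (lo I)
    b = toℕ (hi I)

    reflect≤hi : ∀ {k} → a ≤ k → a + b ∸ k ≤ b
    reflect≤hi {k} a≤k = ℕₚ.m≤n+o⇒m∸n≤o (a + b) k (ℕₚ.+-monoˡ-≤ b a≤k)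

    reflect<n : ∀ {k} → a ≤ k → a + b ∸ k < n
    reflect<n a≤k = ℕₚ.≤-<-trans (reflect≤hi a≤k) (Finₚ.toℕ<n (hi I))

    lo≤reflect : ∀ {k} → k ≤ b → a ≤ a + b ∸ k
    lo≤reflect {k} k≤b = ℕₚ.≤-trans (ℕₚ.m≤m+n a (b ∸ k))
      (ℕₚ.≤-reflexive (sym (ℕₚ.+-∸-assoc a k≤b)))

  reflect : Fin n → Fin n
  reflect k with k ∈ᴵ? I
  ... | yes (a≤k , _) = fromℕ< (reflect<n a≤k)
  ... | no _          = k

  private
    reflect-inside : ∀ k → k ∈ᴵ I → toℕ (reflect k) ≡ a + b ∸ toℕ k
    reflect-inside k k∈I with k ∈ᴵ? I
    ... | yes (a≤k , _) = Finₚ.toℕ-fromℕ< (reflect<n a≤k)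
    ... | no k∉I        = contradiction k∈I k∉I

    reflect-outside : ∀ k → ¬ (k ∈ᴵ I) → reflect k ≡ k
    reflect-outside k k∉I with k ∈ᴵ? I
    ... | yes k∈I = contradiction k∈I k∉I
    ... | no _    = refl

    reflect-∈ : ∀ k → k ∈ᴵ I → reflect k ∈ᴵ I
    reflect-∈ k k∈I@(a≤k , k≤b) =
        ℕₚ.≤-trans (lo≤reflect k≤b) (ℕₚ.≤-reflexive (sym eq))
      , ℕₚ.≤-trans (ℕₚ.≤-reflexive eq) (reflect≤hi a≤k)
      where eq = reflect-inside k k∈I

    reflect-involutive : ∀ k → reflect (reflect k) ≡ k
    reflect-involutive k = go (k ∈ᴵ? I)
      where
      go : Dec (k ∈ᴵ I) → reflect (reflect k) ≡ k
      go (no k∉I)  = trans (cong reflect (reflect-outside k k∉I)) (reflect-outside k k∉I)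
      go (yes k∈I) = Finₚ.toℕ-injective
        (trans (reflect-inside (reflect k) (reflect-∈ k k∈I))
        (trans (cong (a + b ∸_) (reflect-inside k k∈I))
        (ℕₚ.m∸[m∸n]≡n (ℕₚ.≤-trans (proj₂ k∈I) (ℕₚ.m≤n+m b a)))))

  -- One-line notation 1 ⋯ (a-1) b (b-1) ⋯ a (b+1) ⋯ n.

  reversal : 𝔖 n
  reversal = permutation reflect reflect reflect-involutive reflect-involutive

-- The ring ℤ[q½ , q-½]: a list of pairs (c , k) stands for the sum of the
-- c q^(k/2); two lists are equal when all their coefficients agree.

Laurent : Set
Laurent = List (ℤ × ℤ)

coeffᴸ : Laurent → ℤ → ℤ
coeffᴸ p k = foldr (λ (c , j) s → if does (j ℤₚ.≟ k) then c ℤ.+ s else s) 0ℤ p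

infix  4 _≈ᴸ_
infixl 7 _*ᴸ_

_≈ᴸ_ : Laurent → Laurent → Set
p ≈ᴸ r = ∀ k → coeffᴸ p k ≡ coeffᴸ r k

_*ᴸ_ : Op₂ Laurent
p *ᴸ r = List.cartesianProductWith (λ (c , j) (d , k) → c ℤ.* d , j ℤ.+ k) p r

-ᴸ_ : Op₁ Laurent
-ᴸ_ = List.map (λ (c , k) → ℤ.- c , k)

q½^_ : ℤ → Laurent
q½^ k = (1ℤ , k) ∷ []

1ᴸ q q-1 : Laurent
1ᴸ  = q½^ 0ℤ
q   = q½^ (+ 2)
q-1 = q ++ -ᴸ 1ᴸ

conj : Op₁ Laurent
conj = List.map (λ (c , k) → c , ℤ.- k)

-- Lists of coefficients of 1, q, q², …

ℤ[q] : Set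
ℤ[q] = List ℤ

coeff : ℤ[q] → ℕ → ℤ
coeff []      _       = 0ℤ
coeff (c ∷ p) zero    = c
coeff (c ∷ p) (suc k) = coeff p k

⟦_⟧ : ℤ[q] → Laurent
⟦ []    ⟧ = []
⟦ c ∷ p ⟧ = (c , 0ℤ) ∷ q *ᴸ ⟦ p ⟧

[_]q [_]q! : ℕ → Laurent
[ k ]q = List.map (λ i → 1ℤ , + (2 * i)) (List.upTo k)

[ zero  ]q! = 1ᴸ
[ suc k ]q! = [ k ]q! *ᴸ [ suc k ]q

-- The free module with basis T_w: a list of pairs (a , w) stands for the
-- sum of the a T_w, so _++_ is addition and [] is zero.

𝓗 : ℕ → Set
𝓗 n = List (Laurent × 𝔖 n)

module _ {n : ℕ} where

  infix  4 _≈_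
  infixr 8 _·_

  coeffᵀ : 𝓗 n → 𝔖 n → Laurent
  coeffᵀ x w = concatMap (λ (a , v) → if does (v ≟ₚ w) then a else []) x

  _≈_ : 𝓗 n → 𝓗 n → Set
  x ≈ y = ∀ w → coeffᵀ x w ≈ᴸ coeffᵀ y w

  T : 𝔖 n → 𝓗 n
  T w = (1ᴸ , w) ∷ []

  _·_ : Laurent → 𝓗 n → 𝓗 n
  a · x = List.map (λ (b , w) → a *ᴸ b , w) x

  -_ : Op₁ (𝓗 n)
  -_ = List.map (λ (a , w) → -ᴸ a , w)

  -- The linear map with T_w ↦ B w.

  extend : (𝔖 n → 𝓗 n) → 𝓗 n → 𝓗 n
  extend B = concatMap (λ (a , w) → a · B w)

  IsBasis : (𝔖 n → 𝓗 n) → Set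
  IsBasis B = Bijective _≈_ _≈_ (extend B)

-- The multiplication of H_n(q) is specified, as is customary, by its
-- values on T_{s_i} T_w; these determine it uniquely.  Here s = (i i+1).

record HeckeAlgebra (n : ℕ) : Set where
  infixl 7 _∙_
  field
    _∙_      : Op₂ (𝓗 n)
    isRing   : IsRing _≈_ _++_ _∙_ -_ [] (T e)
    ·-assocˡ : ∀ a x y → (a · x) ∙ y ≈ a · (x ∙ y)
    ·-assocʳ : ∀ a x y → x ∙ (a · y) ≈ a · (x ∙ y)
    T-up     : ∀ (i j : Fin n) → toℕ j ≡ suc (toℕ i) → let s = transpose i j in
               ∀ w → w <ᴮ s ⊙ w → T s ∙ T w ≈ T (s ⊙ w)
    T-down   : ∀ (i j : Fin n) → toℕ j ≡ suc (toℕ i) → let s = transpose i j in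
               ∀ w → s ⊙ w <ᴮ w → T s ∙ T w ≈ (q-1 · T w) ++ (q · T (s ⊙ w))

  rawRing : RawRing 0ℓ 0ℓ
  rawRing = record
    { Carrier = 𝓗 n ; _≈_ = _≈_ ; _+_ = _++_ ; _*_ = _∙_ ; -_ = -_ ; 0# = [] ; 1# = T e }

module _ {n : ℕ} (H : HeckeAlgebra n) where

  open HeckeAlgebra H

  record BarInvolution : Set where
    open RingMorphisms rawRing rawRing using (IsRingHomomorphism)
    field
      bar              : Op₁ (𝓗 n)
      isRingHom        : IsRingHomomorphism bar
      involutive       : Involutive _≈_ bar
      semilinear       : ∀ a x → bar (a · x) ≈ conj a · bar x
      bar-T-inverseˡ   : ∀ w → bar (T w) ∙ T (w ⁻¹) ≈ T e
      bar-T-inverseʳ   : ∀ w → T (w ⁻¹) ∙ bar (T w) ≈ T e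

  -- q^(ℓ(w)/2) C′_w = Σ_{v≤w} P_{v,w} T_v is stated coefficientwise.  The
  -- bound deg P_{v,w} ≤ (ℓ(w) - ℓ(v) - 1) / 2 reads: if q^k occurs in
  -- P_{v,w}, then 2 k + ℓ(v) < ℓ(w).

  record KazhdanLusztigBasis (B : BarInvolution) : Set where
    open BarInvolution B
    field
      C′        : 𝔖 n → 𝓗 n
      C′-cong   : ∀ {v w} → v ≈ₚ w → C′ v ≈ C′ w
      isBasis   : IsBasis C′
      bar-C′    : ∀ w → bar (C′ w) ≈ C′ w

    C̃ : 𝔖 n → 𝓗 n
    C̃ w = (q½^ (+ ℓ w)) · C′ w

    field
      P          : 𝔖 n → 𝔖 n → ℤ[q]
      C̃-coeff    : ∀ {v w} → v ≤ᴮ w → coeffᵀ (C̃ w) v ≈ᴸ ⟦ P v w ⟧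
      C̃-support  : ∀ {v w} → ¬ (v ≤ᴮ w) → coeffᵀ (C̃ w) v ≈ᴸ []
      P-diagonal : ∀ w → ⟦ P w w ⟧ ≈ᴸ 1ᴸ
      P-degree   : ∀ {v w} → v <ᴮ w → ∀ k → coeff (P v w) k ≢ 0ℤ → 2 * k + ℓ v < ℓ w

module _ {n m : ℕ} (𝓐 : Fin m → Interval n) where

  -- I_{i,j}

  common : Fin m → Fin m → Subset n
  common i j = (toSubset (𝓐 i) ∩ toSubset (𝓐 j))
    ─ ⋃ (List.map (toSubset ∘ 𝓐)
          (filter (λ k → (i Finₚ.<? k) ×-dec (k Finₚ.<? j)) (allFin m)))

  -- f_𝓐(q)

  f-factor : Laurent
  f-factor = foldr _*ᴸ_ 1ᴸ
    (List.map (λ (i , j) → [ ∣ common i j ∣ ]q!)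
      (filter (λ (i , j) → i Finₚ.<? j) (cartesianProduct (allFin m) (allFin m))))

module _ {n : ℕ} {H : HeckeAlgebra n} {B : BarInvolution H}
         (K : KazhdanLusztigBasis H B) where

  open HeckeAlgebra H
  open KazhdanLusztigBasis K

  -- 𝓗 n is torsion-free, so the division by f_𝓐(q) is cleared.

  HasParabolicFactorization : 𝔖 n → Set
  HasParabolicFactorization w = ∃ λ (m : ℕ) → ∃ λ (𝓐 : Fin m → Interval n) →
    f-factor 𝓐 · C̃ w ≈ foldr _∙_ (T e) (List.tabulate (λ i → C̃ (reversal (𝓐 i))))

{-# OPTIONS --safe #-}
module Submission where

-- Under the ring homomorphism T_v ↦ q^ℓ(v), a factorization of C̃_w becomes
-- an identity of polynomials in q, whose two leading coefficients are
-- compared.  The degrees give Σ ℓ(s_J) = ℓ(w) + Σ |I_{i,j}| (|I_{i,j}| - 1) / 2.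
-- Write w = u_1 ⋯ u_m with u_i in the parabolic subgroup of J_i, which is
-- possible because T_w occurs in the product, and follow the path of each
-- letter through the blocks J_i.  The degree identity says that the paths
-- come together ℓ(w) times in all; the paths of an inversion must do so, hence
-- those of a non-inversion never share a block.
--
-- Bar invariance shows that the coefficient of T_v in C̃_w is 0 or 1 if
-- ℓ(v) = ℓ(w) - 1, and 0 unless w covers v.  So the second coefficients give
-- Σ (|J_i| - 1) ≤ #covers(w) + Σ (|I_{i,j}| - 1), the last sum over I_{i,j} ≠ ∅.
-- The covers of w, as edges between positions, form a forest, because a cycle
-- would produce a 4231 or a 3412 of gap 1.  By an Euler characteristic count
-- the graph of the blocks J_i, joined when I_{i,j} ≠ ∅, is then a forest too.
--
-- In a 3412 of w each of the letters 3, 4 is inverted with each of 1, 2, while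
-- 34 and 12 are non-inversions.  Paths that meet like this close a cycle of
-- blocks.

open import Defs
open import Algebra.Morphism.Structures using (module RingMorphisms)
open import Algebra.Structures using (IsRing)
open import Data.Bool.Base using (Bool; true; if_then_else_)
import Data.Bool.Properties as Boolₚ
open import Data.Empty using (⊥; ⊥-elim)
open import Data.Fin.Base as Fin using (Fin; zero; suc; toℕ; fromℕ<)
open import Data.Fin.Patterns using (0F; 1F; 2F; 3F)
open import Data.Fin.Permutation using (_⟨$⟩ʳ_; _⟨$⟩ˡ_; transpose; inverseˡ; inverseʳ)
import Data.Fin.Permutation.Components as PC
import Data.Fin.Properties as Finₚ
open import Data.Fin.Subset using (Subset; inside; outside; _∩_; _─_; ⋃; ∣_∣) renaming
  (_∈_ to _∈ˢ_; _∉_ to _∉ˢ_)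
import Data.Fin.Subset.Properties as Subsetₚ
open import Data.Integer.Base as ℤ using (ℤ; +_; -[1+_]; 0ℤ; 1ℤ) renaming (_+_ to _+ᶻ_)
import Data.Integer.Properties as ℤₚ
open import Data.Integer.Tactic.RingSolver using (solve-∀)
open import Data.List.Base as List
  using (List; []; _∷_; _++_; allFin; cartesianProduct; concatMap; filter; length)
open import Data.List.Membership.Propositional using (_∈_)
open import Data.List.Membership.Propositional.Properties
  using (∈-map⁺; ∈-map⁻; ∈-filter⁺; ∈-filter⁻; ∈-cartesianProduct⁺; ∈-allFin)
import Data.List.Properties as Listₚ
open import Data.List.Relation.Unary.All as All using (All; []; _∷_)
import Data.List.Relation.Unary.All.Properties as Allₚ
open import Data.List.Relation.Unary.AllPairs as AllPairs using (AllPairs; []; _∷_)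
import Data.List.Relation.Unary.AllPairs.Properties as AllPairsₚ
open import Data.List.Relation.Unary.Any using (here; there)
open import Data.Nat using (ℕ; zero; suc; _+_; _*_; _∸_; _≤_; _<_; z≤n; s≤s)
open import Data.Nat.ListAction using () renaming (sum to sumᴸ)
open import Data.Nat.ListAction.Properties using (sum-++)
import Data.Nat.Properties as ℕₚ
import Data.Nat.Tactic.RingSolver as ℕ-Solver
open import Data.Product.Base using (_×_; _,_; proj₁; proj₂; ∃; ∃-syntax; Σ-syntax)
open import Data.Sum.Base using (_⊎_; inj₁; inj₂)
open import Data.Unit.Base using (⊤; tt)
open import Data.Vec.Base as Vec using (Vec; []; _∷_; here; there)
import Data.Vec.Properties as Vecₚ
open import Function.Base using (_∘_; id)
open import Function.Bundles using (mk⇔; Equivalence)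
open import Relation.Binary.Definitions using (tri<; tri≈; tri>)
open import Relation.Binary.PropositionalEquality
  using (_≡_; _≢_; refl; sym; trans; cong; cong₂; subst; subst₂; module ≡-Reasoning)
open import Relation.Nullary
  using (¬_; Dec; yes; no; does; contradiction; _×-dec_; ¬?; _→-dec_)
open import Relation.Nullary.Decidable using (dec-true; dec-false; decidable-stable; from-yes)
open import Relation.Unary using (Decidable; Pred)

open import Algebra.Properties.CommutativeMonoid.Sum ℕₚ.+-0-commutativeMonoid
  using (sum; sum-syntax; sum-cong-≗; sum-permute; sum-replicate-zero; ∑-distrib-+; ∑-comm)

-- Indicators and finite sums

-- The forest property is the equality case of a chain of inequalities. Let `bonds` be n minus the
-- number of classes into which the intervals link the levels. Every sequence of intervals satisfies
-- Σ (|I_{i,j}| - 1) + `bonds` ≤ Σ (|J_i| - 1), and the slack is the cycle rank of the graph of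
-- blocks. On the other hand the two positions of a cover form an inversion, so their paths meet and
-- they lie in one class; as the covers form a forest, their number is at most `bonds`. Together
-- with the second coefficients this closes the chain, and the cycle rank is 0. So no
-- Kazhdan-Lusztig polynomial has to be computed: an upper bound for the second coefficient of C̃_w
-- and a lower bound for those of the reversals suffice. The condition on the gap enters at one
-- place, the acyclicity of the covers. Products are unfolded from the left, so every induction
-- removes the block which the paths traverse last.

𝟙 : ∀ {a} {A : Set a} → Dec A → ℕ
𝟙 d = if does d then 1 else 0

module _ {a} {A : Set a} where

  𝟙-yes : (d : Dec A) → A → 𝟙 d ≡ 1
  𝟙-yes (yes _) _ = refl
  𝟙-yes (no ¬x) x = contradiction x ¬x

  𝟙-no : (d : Dec A) → ¬ A → 𝟙 d ≡ 0
  𝟙-no (yes x) ¬x = contradiction x ¬x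
  𝟙-no (no _)  _  = refl

  𝟙≤1 : (d : Dec A) → 𝟙 d ≤ 1
  𝟙≤1 (yes _) = ℕₚ.≤-refl
  𝟙≤1 (no _)  = z≤n

module _ {a b} {A : Set a} {B : Set b} where

  𝟙-mono : (A → B) → (d : Dec A) (d′ : Dec B) → 𝟙 d ≤ 𝟙 d′
  𝟙-mono f (yes x) d′ = ℕₚ.≤-reflexive (sym (𝟙-yes d′ (f x)))
  𝟙-mono f (no _)  d′ = z≤n

𝟙-cong : ∀ {a b} {A : Set a} {B : Set b} → (A → B) → (B → A) →
         (d : Dec A) (d′ : Dec B) → 𝟙 d ≡ 𝟙 d′
𝟙-cong f g d d′ = ℕₚ.≤-antisym (𝟙-mono f d d′) (𝟙-mono g d′ d)

sum-mono : ∀ {n} {f g : Fin n → ℕ} → (∀ i → f i ≤ g i) → sum f ≤ sum g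
sum-mono {zero}  f≤g = z≤n
sum-mono {suc n} f≤g = ℕₚ.+-mono-≤ (f≤g zero) (sum-mono (f≤g ∘ suc))

sum-pinch : ∀ {n} {f g : Fin n → ℕ} → (∀ i → f i ≤ g i) → sum g ≤ sum f →
            ∀ i → f i ≡ g i
sum-pinch {suc n} {f} {g} f≤g Σg≤Σf zero = ℕₚ.≤-antisym (f≤g zero)
  (ℕₚ.+-cancelʳ-≤ _ _ _ (ℕₚ.≤-trans (ℕₚ.+-monoʳ-≤ (g zero) (sum-mono (f≤g ∘ suc))) Σg≤Σf))
sum-pinch {suc n} {f} {g} f≤g Σg≤Σf (suc i) = sum-pinch (f≤g ∘ suc)
  (ℕₚ.+-cancelˡ-≤ _ _ _ (ℕₚ.≤-trans (ℕₚ.+-monoˡ-≤ _ (f≤g zero)) Σg≤Σf)) i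

sum-zero : ∀ {n} {f : Fin n → ℕ} → (∀ i → f i ≡ 0) → sum f ≡ 0
sum-zero {n} f≡0 = trans (sum-cong-≗ f≡0) (sum-replicate-zero n)

sum-*ˡ : ∀ {n} c (f : Fin n → ℕ) → ∑[ i < n ] (c * f i) ≡ c * sum f
sum-*ˡ {zero}  c f = sym (ℕₚ.*-zeroʳ c)
sum-*ˡ {suc n} c f = trans (cong (_+_ (c * f zero)) (sum-*ˡ c (f ∘ suc)))
  (sym (ℕₚ.*-distribˡ-+ c (f zero) _))

sum-*ʳ : ∀ {n} c (f : Fin n → ℕ) → ∑[ i < n ] (f i * c) ≡ sum f * c
sum-*ʳ c f = trans (sum-cong-≗ (λ i → ℕₚ.*-comm (f i) c))
  (trans (sum-*ˡ c f) (ℕₚ.*-comm c _))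

sum-supported : ∀ {n} (f : Fin n → ℕ) i → (∀ j → j ≢ i → f j ≡ 0) → sum f ≡ f i
sum-supported {suc n} f zero    off =
  trans (cong (_+_ (f zero)) (sum-zero (λ j → off (suc j) λ ()))) (ℕₚ.+-identityʳ _)
sum-supported {suc n} f (suc i) off = cong₂ _+_ (off zero λ ())
  (sum-supported (f ∘ suc) i (λ j j≢i → off (suc j) (j≢i ∘ Finₚ.suc-injective)))

module _ {a} {A : Set a} where

  sumᴸ-filter : ∀ {p} {P : Pred A p} (P? : Decidable P) (h : A → ℕ) xs →
    sumᴸ (List.map h (filter P? xs)) ≡ sumᴸ (List.map (λ x → 𝟙 (P? x) * h x) xs)
  sumᴸ-filter P? h [] = refl
  sumᴸ-filter P? h (x ∷ xs) with P? x
  ... | yes _ = cong₂ _+_ (sym (ℕₚ.*-identityˡ (h x))) (sumᴸ-filter P? h xs)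
  ... | no _  = sumᴸ-filter P? h xs

  length≡sumᴸ : (xs : List A) → length xs ≡ sumᴸ (List.map (λ _ → 1) xs)
  length≡sumᴸ []       = refl
  length≡sumᴸ (_ ∷ xs) = cong suc (length≡sumᴸ xs)

sumᴸ-× : ∀ {a b} {A : Set a} {B : Set b} (h : A × B → ℕ) xs ys →
  sumᴸ (List.map h (cartesianProduct xs ys)) ≡
  sumᴸ (List.map (λ x → sumᴸ (List.map (λ y → h (x , y)) ys)) xs)
sumᴸ-× h [] ys = refl
sumᴸ-× h (x ∷ xs) ys = trans (cong sumᴸ (Listₚ.map-++ h (List.map (x ,_) ys) _))
  (trans (sum-++ (List.map h (List.map (x ,_) ys)) _)
  (cong₂ _+_ (cong sumᴸ (sym (Listₚ.map-∘ ys))) (sumᴸ-× h xs ys)))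

sumᴸ-tabulate : ∀ {a} {A : Set a} {n} (h : A → ℕ) (f : Fin n → A) →
  sumᴸ (List.map h (List.tabulate f)) ≡ ∑[ i < n ] h (f i)
sumᴸ-tabulate {n = zero}  h f = refl
sumᴸ-tabulate {n = suc n} h f = cong (_+_ (h (f zero))) (sumᴸ-tabulate h (f ∘ suc))

sumᴸ-allFin : ∀ n (h : Fin n → ℕ) → sumᴸ (List.map h (allFin n)) ≡ sum h
sumᴸ-allFin n h = sumᴸ-tabulate h id

length-filter-allFin : ∀ {n p} {P : Pred (Fin n) p} (P? : Decidable P) →
  length (filter P? (allFin n)) ≡ ∑[ i < n ] 𝟙 (P? i)
length-filter-allFin {n} P? = trans (length≡sumᴸ (filter P? (allFin n)))
  (trans (sumᴸ-filter P? (λ _ → 1) (allFin n))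
  (trans (sumᴸ-allFin n (λ i → 𝟙 (P? i) * 1)) (sum-cong-≗ (λ i → ℕₚ.*-identityʳ (𝟙 (P? i))))))

sumᴸ-filter-× : ∀ {m n p} {P : Pred (Fin m × Fin n) p} (P? : Decidable P) (h : Fin m × Fin n → ℕ) →
  sumᴸ (List.map h (filter P? (cartesianProduct (allFin m) (allFin n)))) ≡
  ∑[ i < m ] ∑[ j < n ] (𝟙 (P? (i , j)) * h (i , j))
sumᴸ-filter-× {m} {n} P? h =
  trans (sumᴸ-filter P? h (cartesianProduct (allFin m) (allFin n)))
  (trans (sumᴸ-× g (allFin m) (allFin n))
  (trans (sumᴸ-allFin m (λ i → sumᴸ (List.map (λ j → g (i , j)) (allFin n))))
         (sum-cong-≗ (λ i → sumᴸ-allFin n (λ j → g (i , j))))))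
  where
  g : _ → ℕ
  g x = 𝟙 (P? x) * h x

length-filter-× : ∀ {m n p} {P : Pred (Fin m × Fin n) p} (P? : Decidable P) →
  length (filter P? (cartesianProduct (allFin m) (allFin n))) ≡
  ∑[ i < m ] ∑[ j < n ] 𝟙 (P? (i , j))
length-filter-× {m} {n} P? =
  trans (length≡sumᴸ (filter P? (cartesianProduct (allFin m) (allFin n))))
  (trans (sumᴸ-filter-× P? (λ _ → 1))
  (sum-cong-≗ (λ i → sum-cong-≗ (λ j → ℕₚ.*-identityʳ (𝟙 (P? (i , j)))))))

-- Permutations, transpositions and length

module _ {n : ℕ} where

  transpose-fst : ∀ (i j : Fin n) → transpose i j ⟨$⟩ʳ i ≡ j
  transpose-fst i j rewrite dec-true (i Finₚ.≟ i) refl = refl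

  transpose-snd : ∀ (i j : Fin n) → transpose i j ⟨$⟩ʳ j ≡ i
  transpose-snd i j with j Finₚ.≟ i
  ... | yes j≡i = j≡i
  ... | no _ rewrite dec-true (j Finₚ.≟ j) refl = refl

  transpose-off : ∀ {i j k : Fin n} → k ≢ i → k ≢ j → transpose i j ⟨$⟩ʳ k ≡ k
  transpose-off {i} {j} {k} k≢i k≢j
    rewrite dec-false (k Finₚ.≟ i) k≢i | dec-false (k Finₚ.≟ j) k≢j = refl

  transpose-cases : ∀ {ℓ} (i j : Fin n) (P : Fin n → Fin n → Set ℓ) →
    P i j → P j i → (∀ {k} → k ≢ i → k ≢ j → P k k) →
    ∀ k → P k (transpose i j ⟨$⟩ʳ k)
  transpose-cases i j P p q r k with k Finₚ.≟ i
  ... | yes refl = p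
  ... | no k≢i with k Finₚ.≟ j
  ...   | yes refl = q
  ...   | no k≢j   = r k≢i k≢j

  transpose-sym : ∀ (i j : Fin n) → transpose i j ≈ₚ transpose j i
  transpose-sym i j = transpose-cases i j (λ k k′ → k′ ≡ transpose j i ⟨$⟩ʳ k)
    (sym (transpose-snd j i)) (sym (transpose-fst j i))
    (λ k≢i k≢j → sym (transpose-off k≢j k≢i))

  transpose-refl : ∀ (i : Fin n) → transpose i i ≈ₚ e
  transpose-refl i = transpose-cases i i (λ k k′ → k′ ≡ k) refl refl (λ _ _ → refl)

  transpose-involutive : ∀ (i j k : Fin n) → transpose i j ⟨$⟩ʳ (transpose i j ⟨$⟩ʳ k) ≡ k
  transpose-involutive i j k =
    trans (transpose-sym i j (transpose i j ⟨$⟩ʳ k)) (PC.transpose-inverse j i)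

  perm-injective : ∀ (w : 𝔖 n) {a b} → w ⟨$⟩ʳ a ≡ w ⟨$⟩ʳ b → a ≡ b
  perm-injective w eq = trans (sym (inverseˡ w)) (trans (cong (w ⟨$⟩ˡ_) eq) (inverseˡ w))

  ⊙-congˡ : ∀ (u : 𝔖 n) {v w} → v ≈ₚ w → u ⊙ v ≈ₚ u ⊙ w
  ⊙-congˡ u v≈w k = cong (u ⟨$⟩ʳ_) (v≈w k)

  transpose-⊙-involutive : ∀ (i j : Fin n) w → transpose i j ⊙ transpose i j ⊙ w ≈ₚ w
  transpose-⊙-involutive i j w k = transpose-involutive i j (w ⟨$⟩ʳ k)

  ⊙-transpose-involutive : ∀ (i j : Fin n) w → (w ⊙ transpose i j) ⊙ transpose i j ≈ₚ w
  ⊙-transpose-involutive i j w k = cong (w ⟨$⟩ʳ_) (transpose-involutive i j k)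

  -- The Bruhat order is generated by right multiplications, whereas the Hecke relations multiply on
  -- the left; conjugation by `w` passes from one to the other.
  transpose-⊙≈⊙-transpose : ∀ (w : 𝔖 n) i j →
    w ⊙ transpose (w ⟨$⟩ˡ i) (w ⟨$⟩ˡ j) ≈ₚ transpose i j ⊙ w
  transpose-⊙≈⊙-transpose w i j = transpose-cases (w ⟨$⟩ˡ i) (w ⟨$⟩ˡ j)
    (λ k k′ → w ⟨$⟩ʳ k′ ≡ transpose i j ⟨$⟩ʳ (w ⟨$⟩ʳ k))
    (trans (inverseʳ w) (sym (trans (cong (transpose i j ⟨$⟩ʳ_) (inverseʳ w)) (transpose-fst i j))))
    (trans (inverseʳ w) (sym (trans (cong (transpose i j ⟨$⟩ʳ_) (inverseʳ w)) (transpose-snd i j))))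
    (λ {k} k≢ k≢′ → sym (transpose-off
      (λ eq → k≢  (trans (sym (inverseˡ w)) (cong (w ⟨$⟩ˡ_) eq)))
      (λ eq → k≢′ (trans (sym (inverseˡ w)) (cong (w ⟨$⟩ˡ_) eq)))))

  Inversion : 𝔖 n → Fin n → Fin n → Set
  Inversion w a b = a Fin.< b × (w ⟨$⟩ʳ b) Fin.< (w ⟨$⟩ʳ a)

  inversion? : ∀ w a b → Dec (Inversion w a b)
  inversion? w a b = (a Finₚ.<? b) ×-dec ((w ⟨$⟩ʳ b) Finₚ.<? (w ⟨$⟩ʳ a))

  ℓ≡∑∑ : ∀ w → ℓ w ≡ ∑[ a < n ] ∑[ b < n ] 𝟙 (inversion? w a b)
  ℓ≡∑∑ w = length-filter-× (λ (a , b) → inversion? w a b)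

  ∑∑-cong : ∀ {f g : Fin n → Fin n → ℕ} → (∀ a b → f a b ≡ g a b) →
    ∑[ a < n ] ∑[ b < n ] f a b ≡ ∑[ a < n ] ∑[ b < n ] g a b
  ∑∑-cong f≡g = sum-cong-≗ (λ a → sum-cong-≗ (f≡g a))

  ℓ-cong : ∀ {v w : 𝔖 n} → v ≈ₚ w → ℓ v ≡ ℓ w
  ℓ-cong {v} {w} v≈w = trans (ℓ≡∑∑ v) (trans (∑∑-cong (λ a b → 𝟙-cong
    (λ (a<b , lt) → a<b , subst₂ Fin._<_ (v≈w b) (v≈w a) lt)
    (λ (a<b , lt) → a<b , subst₂ Fin._<_ (sym (v≈w b)) (sym (v≈w a)) lt)
    (inversion? v a b) (inversion? w a b))) (sym (ℓ≡∑∑ w)))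

  ∑∑-permute : ∀ (f : Fin n → Fin n → ℕ) (w : 𝔖 n) →
    ∑[ a < n ] ∑[ b < n ] f a b ≡ ∑[ a < n ] ∑[ b < n ] f (w ⟨$⟩ʳ a) (w ⟨$⟩ʳ b)
  ∑∑-permute f w = trans (sum-permute (λ a → sum (f a)) w)
    (sum-cong-≗ (λ a → sum-permute (f (w ⟨$⟩ʳ a)) w))

  ℓ-⁻¹ : ∀ (w : 𝔖 n) → ℓ (w ⁻¹) ≡ ℓ w
  ℓ-⁻¹ w = trans (ℓ≡∑∑ (w ⁻¹)) (trans (∑∑-permute _ w) (trans (∑-comm {n} {n}
      (λ a b → 𝟙 (inversion? (w ⁻¹) (w ⟨$⟩ʳ a) (w ⟨$⟩ʳ b))))
    (trans (∑∑-cong (λ b a → 𝟙-cong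
      (λ (lt , lt′) → subst₂ Fin._<_ (inverseˡ w) (inverseˡ w) lt′ , lt)
      (λ (lt , lt′) → lt′ , subst₂ Fin._<_ (sym (inverseˡ w)) (sym (inverseˡ w)) lt)
      (inversion? (w ⁻¹) (w ⟨$⟩ʳ a) (w ⟨$⟩ʳ b)) (inversion? w b a)))
    (sym (ℓ≡∑∑ w)))))

  Adjacent : Fin n → Fin n → Set
  Adjacent i j = toℕ j ≡ suc (toℕ i)

  adjacent⇒< : ∀ {i j} → Adjacent i j → i Fin.< j
  adjacent⇒< adj = ℕₚ.≤-reflexive (sym adj)

  -- No value lies strictly between `i` and `j`, so exchanging them can disturb the order of no pair
  -- but `i`, `j` itself.
  adjacent-mono : ∀ {i j} → Adjacent i j → ∀ {x y} → x Fin.< y → ¬ (x ≡ i × y ≡ j) →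
    (transpose i j ⟨$⟩ʳ x) Fin.< (transpose i j ⟨$⟩ʳ y)
  adjacent-mono {i} {j} adj {x} {y} =
    transpose-cases i j (λ x x′ → x Fin.< y → ¬ (x ≡ i × y ≡ j) → x′ Fin.< (transpose i j ⟨$⟩ʳ y))
      (transpose-cases i j (λ y y′ → i Fin.< y → ¬ (i ≡ i × y ≡ j) → j Fin.< y′)
        (λ i<i _ → contradiction i<i (ℕₚ.<-irrefl refl))
        (λ _ ≢ → contradiction (refl , refl) ≢)
        (λ {y} y≢i y≢j i<y _ → ℕₚ.≤∧≢⇒< (subst (_≤ toℕ y) (sym adj) i<y)
          (y≢j ∘ sym ∘ Finₚ.toℕ-injective))
        y)
      (transpose-cases i j (λ y y′ → j Fin.< y → ¬ (j ≡ i × y ≡ j) → i Fin.< y′)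
        (λ j<i _ → contradiction (ℕₚ.<-trans j<i′ j<i) (ℕₚ.<-irrefl refl))
        (λ j<j _ → contradiction j<j (ℕₚ.<-irrefl refl))
        (λ {y} y≢i y≢j j<y _ → ℕₚ.<-trans j<i′ j<y)
        y)
      (λ {x} x≢i x≢j → transpose-cases i j (λ y y′ → x Fin.< y → ¬ (x ≡ i × y ≡ j) → x Fin.< y′)
        (λ x<i _ → ℕₚ.<-trans x<i j<i′)
        (λ x<j _ → ℕₚ.≤∧≢⇒< (ℕₚ.≤-pred (subst (toℕ x <_) adj x<j)) (x≢i ∘ Finₚ.toℕ-injective))
        (λ _ _ x<y _ → x<y)
        y)
      x
    where
    j<i′ = adjacent⇒< {i} {j} adj

  ℓ-adjacentˡ : ∀ {i j} → Adjacent i j → ∀ w → (w ⟨$⟩ˡ i) Fin.< (w ⟨$⟩ˡ j) →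
    ℓ (transpose i j ⊙ w) ≡ suc (ℓ w)
  ℓ-adjacentˡ {i} {j} adj w lt = trans (ℓ≡∑∑ (s ⊙ w)) (trans (∑∑-cong pointwise)
    (trans (sum-cong-≗ (λ a → ∑-distrib-+ (λ b → 𝟙 (inversion? w a b)) (δ a)))
    (trans (∑-distrib-+ _ (λ a → sum (δ a)))
    (trans (cong₂ _+_ (sym (ℓ≡∑∑ w)) ∑∑δ) (ℕₚ.+-comm (ℓ w) 1)))))
    where
    s  = transpose i j
    a₀ = w ⟨$⟩ˡ i
    b₀ = w ⟨$⟩ˡ j

    δ : Fin n → Fin n → ℕ
    δ a b = 𝟙 ((a Finₚ.≟ a₀) ×-dec (b Finₚ.≟ b₀))

    ∑∑δ : ∑[ a < n ] ∑[ b < n ] δ a b ≡ 1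
    ∑∑δ = trans (sum-supported _ a₀ (λ a a≢ → sum-zero (λ b →
        𝟙-no ((a Finₚ.≟ a₀) ×-dec (b Finₚ.≟ b₀)) (a≢ ∘ proj₁))))
      (trans (sum-supported _ b₀ (λ b b≢ → 𝟙-no ((a₀ Finₚ.≟ a₀) ×-dec (b Finₚ.≟ b₀)) (b≢ ∘ proj₂)))
      (𝟙-yes ((a₀ Finₚ.≟ a₀) ×-dec (b₀ Finₚ.≟ b₀)) (refl , refl)))

    at : ∀ {a x} → w ⟨$⟩ʳ a ≡ x → a ≡ w ⟨$⟩ˡ x
    at eq = trans (sym (inverseˡ w)) (cong (w ⟨$⟩ˡ_) eq)

    pointwise : ∀ a b → 𝟙 (inversion? (s ⊙ w) a b) ≡ 𝟙 (inversion? w a b) + δ a b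
    pointwise a b with (a Finₚ.≟ a₀) ×-dec (b Finₚ.≟ b₀)
    ... | yes (refl , refl) = trans
      (𝟙-yes (inversion? (s ⊙ w) a₀ b₀) (lt , subst₂ Fin._<_
        (sym (trans (cong (s ⟨$⟩ʳ_) (inverseʳ w)) (transpose-snd i j)))
        (sym (trans (cong (s ⟨$⟩ʳ_) (inverseʳ w)) (transpose-fst i j))) i<j))
      (sym (cong₂ _+_ (𝟙-no (inversion? w a₀ b₀) (λ (_ , lt′) →
        ℕₚ.<-asym i<j (subst₂ Fin._<_ (inverseʳ w) (inverseʳ w) lt′)))
        (𝟙-yes ((a₀ Finₚ.≟ a₀) ×-dec (b₀ Finₚ.≟ b₀)) (refl , refl))))
      where i<j = adjacent⇒< {i} {j} adj
    ... | no ≢ = trans (𝟙-cong to from (inversion? (s ⊙ w) a b) (inversion? w a b))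
                       (sym (trans (cong (_+_ (𝟙 (inversion? w a b)))
                         (𝟙-no ((a Finₚ.≟ a₀) ×-dec (b Finₚ.≟ b₀)) ≢)) (ℕₚ.+-identityʳ _)))
      where
      to : Inversion (s ⊙ w) a b → Inversion w a b
      to (a<b , lt′) = a<b , subst₂ Fin._<_ (transpose-involutive i j _) (transpose-involutive i j _)
        (adjacent-mono {i} {j} adj lt′ (λ (eq , eq′) → ≢
          ( at (trans (sym (transpose-involutive i j _))
            (trans (cong (s ⟨$⟩ʳ_) eq′) (transpose-snd i j)))
          , at (trans (sym (transpose-involutive i j _))
            (trans (cong (s ⟨$⟩ʳ_) eq) (transpose-fst i j))))))
      from : Inversion w a b → Inversion (s ⊙ w) a b
      from (a<b , lt′) = a<b , adjacent-mono {i} {j} adj lt′ (λ (eq , eq′) →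
        ℕₚ.<-asym a<b (subst₂ Fin._<_ (sym (at eq)) (sym (at eq′)) lt))

  ℓ-adjacentʳ : ∀ {i j} → Adjacent i j → ∀ w → (w ⟨$⟩ʳ i) Fin.< (w ⟨$⟩ʳ j) →
    ℓ (w ⊙ transpose i j) ≡ suc (ℓ w)
  ℓ-adjacentʳ {i} {j} adj w lt = trans (sym (ℓ-⁻¹ (w ⊙ transpose i j)))
    (trans (ℓ-cong {(w ⊙ transpose i j) ⁻¹} {transpose i j ⊙ w ⁻¹}
      (λ k → transpose-sym j i (w ⟨$⟩ˡ k)))
    (trans (ℓ-adjacentˡ {i} {j} adj (w ⁻¹) lt) (cong suc (ℓ-⁻¹ w))))

  transpose-conj : ∀ {i j k : Fin n} → i ≢ j → i ≢ k → j ≢ k →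
    ∀ (w : 𝔖 n) → ((w ⊙ transpose i k) ⊙ transpose k j) ⊙ transpose i k ≈ₚ w ⊙ transpose i j
  transpose-conj {i} {j} {k} i≢j i≢k j≢k w a = cong (w ⟨$⟩ʳ_) (pointwise a)
    where
    t = λ a → transpose i k ⟨$⟩ʳ (transpose k j ⟨$⟩ʳ a)
    pointwise : ∀ a → transpose i k ⟨$⟩ʳ (transpose k j ⟨$⟩ʳ (transpose i k ⟨$⟩ʳ a)) ≡ transpose i j
      ⟨$⟩ʳ a
    pointwise = transpose-cases i k (λ a a′ → t a′ ≡ transpose i j ⟨$⟩ʳ a)
      (trans (cong (transpose i k ⟨$⟩ʳ_) (transpose-fst k j))
        (trans (transpose-off (i≢j ∘ sym) j≢k) (sym (transpose-fst i j))))
      (trans (cong (transpose i k ⟨$⟩ʳ_) (transpose-off i≢k i≢j))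
        (trans (transpose-fst i k) (sym (transpose-off (i≢k ∘ sym) (j≢k ∘ sym)))))
      (λ {a} a≢i a≢k → transpose-cases k j
        (λ a a′ → a ≢ i → a ≢ k → transpose i k ⟨$⟩ʳ a′ ≡ transpose i j ⟨$⟩ʳ a)
        (λ _ k≢k → contradiction refl k≢k)
        (λ _ _ → trans (transpose-snd i k) (sym (transpose-snd i j)))
        (λ a≢k a≢j a≢i _ → trans (transpose-off a≢i a≢k) (sym (transpose-off a≢i a≢j)))
        a a≢i a≢k)

  perm-<-or-> : ∀ (w : 𝔖 n) {a b} → a ≢ b →
    (w ⟨$⟩ʳ a) Fin.< (w ⟨$⟩ʳ b) ⊎ (w ⟨$⟩ʳ b) Fin.< (w ⟨$⟩ʳ a)
  perm-<-or-> w {a} {b} a≢b with Finₚ.<-cmp (w ⟨$⟩ʳ a) (w ⟨$⟩ʳ b)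
  ... | tri< lt _ _ = inj₁ lt
  ... | tri≈ _ eq _ = contradiction (perm-injective w eq) a≢b
  ... | tri> _ _ gt = inj₂ gt

  <⇒≢ : ∀ {a b : Fin n} → a Fin.< b → a ≢ b
  <⇒≢ a<b refl = ℕₚ.<-irrefl refl a<b

  swapped-fst : ∀ (w : 𝔖 n) i j → (w ⊙ transpose i j) ⟨$⟩ʳ i ≡ w ⟨$⟩ʳ j
  swapped-fst w i j = cong (w ⟨$⟩ʳ_) (transpose-fst i j)

  swapped-snd : ∀ (w : 𝔖 n) i j → (w ⊙ transpose i j) ⟨$⟩ʳ j ≡ w ⟨$⟩ʳ i
  swapped-snd w i j = cong (w ⟨$⟩ʳ_) (transpose-snd i j)

  swapped-off : ∀ (w : 𝔖 n) {i j k} → k ≢ i → k ≢ j → (w ⊙ transpose i j) ⟨$⟩ʳ k ≡ w ⟨$⟩ʳ k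
  swapped-off w k≢i k≢j = cong (w ⟨$⟩ʳ_) (transpose-off k≢i k≢j)

  ℓ-adjacentʳ-down : ∀ {i j} → Adjacent i j → ∀ w → (w ⟨$⟩ʳ j) Fin.< (w ⟨$⟩ʳ i) →
    ℓ w ≡ suc (ℓ (w ⊙ transpose i j))
  ℓ-adjacentʳ-down {i} {j} adj w lt =
    trans (ℓ-cong {w} {(w ⊙ transpose i j) ⊙ transpose i j} (λ k → sym (⊙-transpose-involutive i j w k)))
    (ℓ-adjacentʳ {i} {j} adj (w ⊙ transpose i j)
      (subst₂ Fin._<_ (sym (swapped-fst w i j)) (sym (swapped-snd w i j)) lt))

  -- t_ij = t_ik t_kj t_ik with k = i + 1; the middle step always raises
  -- the length and at most one of the outer two lowers it.
  ℓ-transpose-up : ∀ d {i j} → toℕ j ≡ suc (d + toℕ i) → ∀ w →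
    (w ⟨$⟩ʳ i) Fin.< (w ⟨$⟩ʳ j) → ℓ w < ℓ (w ⊙ transpose i j)
  ℓ-transpose-up zero    {i} {j} adj w lt = ℕₚ.≤-reflexive (sym (ℓ-adjacentʳ {i} {j} adj w lt))
  ℓ-transpose-up (suc d) {i} {j} eq w lt =
    subst (ℓ w <_) (ℓ-cong {w₃} {w ⊙ transpose i j} (transpose-conj i≢j i≢k j≢k w))
      (go (perm-<-or-> w i≢k) (perm-<-or-> w j≢k))
    where
    1+i<j : suc (toℕ i) < toℕ j
    1+i<j = subst (suc (toℕ i) <_) (sym eq) (s≤s (s≤s (ℕₚ.m≤n+m (toℕ i) d)))
    k : Fin n
    k = fromℕ< (ℕₚ.<-trans 1+i<j (Finₚ.toℕ<n j))
    ki : Adjacent i k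
    ki = Finₚ.toℕ-fromℕ< _
    k<j : k Fin.< j
    k<j = subst (_< toℕ j) (sym ki) 1+i<j
    i≢k : i ≢ k
    i≢k = <⇒≢ {i} {k} (adjacent⇒< {i} {k} ki)
    j≢k : j ≢ k
    j≢k = <⇒≢ {k} {j} k<j ∘ sym
    i≢j : i ≢ j
    i≢j refl = ℕₚ.<-asym k<j (adjacent⇒< {i} {k} ki)
    w₁ = w ⊙ transpose i k
    w₂ = w₁ ⊙ transpose k j
    w₃ = w₂ ⊙ transpose i k
    w₂i : w₂ ⟨$⟩ʳ i ≡ w ⟨$⟩ʳ k
    w₂i = trans (swapped-off w₁ i≢k i≢j) (swapped-fst w i k)
    w₂k : w₂ ⟨$⟩ʳ k ≡ w ⟨$⟩ʳ j
    w₂k = trans (swapped-fst w₁ k j) (swapped-off w (i≢j ∘ sym) j≢k)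
    12< : ℓ w₁ < ℓ w₂
    12< = ℓ-transpose-up d {k} {j} (trans eq
      (cong suc (trans (sym (ℕₚ.+-suc d (toℕ i))) (cong (_+_ d) (sym ki)))))
      w₁ (subst₂ Fin._<_ (sym (swapped-snd w i k)) (sym (swapped-off w (i≢j ∘ sym) j≢k)) lt)
    up₃ : (w ⟨$⟩ʳ k) Fin.< (w ⟨$⟩ʳ j) → ℓ w₃ ≡ suc (ℓ w₂)
    up₃ k<j = ℓ-adjacentʳ {i} {k} ki w₂ (subst₂ Fin._<_ (sym w₂i) (sym w₂k) k<j)
    go : (w ⟨$⟩ʳ i) Fin.< (w ⟨$⟩ʳ k) ⊎ (w ⟨$⟩ʳ k) Fin.< (w ⟨$⟩ʳ i) →
         (w ⟨$⟩ʳ j) Fin.< (w ⟨$⟩ʳ k) ⊎ (w ⟨$⟩ʳ k) Fin.< (w ⟨$⟩ʳ j) → ℓ w < ℓ w₃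
    go (inj₂ k<i) _ = ℕₚ.≤-trans (ℕₚ.≤-reflexive (cong suc (ℓ-adjacentʳ-down {i} {k} ki w k<i)))
      (ℕₚ.≤-trans (s≤s 12<) (ℕₚ.≤-reflexive (sym (up₃ (ℕₚ.<-trans k<i lt)))))
    go (inj₁ i<k) (inj₂ k<j) = ℕₚ.≤-trans (ℕₚ.≤-reflexive (sym (ℓ-adjacentʳ {i} {k} ki w i<k)))
      (ℕₚ.≤-trans (ℕₚ.<⇒≤ 12<) (ℕₚ.≤-trans (ℕₚ.n≤1+n _) (ℕₚ.≤-reflexive (sym (up₃ k<j)))))
    go (inj₁ i<k) (inj₁ j<k) = ℕₚ.≤-trans (ℕₚ.≤-reflexive (sym (ℓ-adjacentʳ {i} {k} ki w i<k)))
      (ℕₚ.≤-pred (ℕₚ.≤-trans 12< (ℕₚ.≤-reflexive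
        (ℓ-adjacentʳ-down {i} {k} ki w₂ (subst₂ Fin._<_ (sym w₂k) (sym w₂i) j<k)))))

  ℓ-transpose-< : ∀ {i j} → i Fin.< j → ∀ w → (w ⟨$⟩ʳ i) Fin.< (w ⟨$⟩ʳ j) →
    ℓ w < ℓ (w ⊙ transpose i j)
  ℓ-transpose-< {i} {j} i<j = ℓ-transpose-up (toℕ j ∸ suc (toℕ i)) {i} {j}
    (trans (sym (ℕₚ.m∸n+n≡m i<j)) (ℕₚ.+-suc _ _))

  ℓ-transpose-> : ∀ {i j} → i Fin.< j → ∀ w → (w ⟨$⟩ʳ j) Fin.< (w ⟨$⟩ʳ i) →
    ℓ (w ⊙ transpose i j) < ℓ w
  ℓ-transpose-> {i} {j} i<j w gt = ℕₚ.<-≤-trans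
    (ℓ-transpose-< i<j (w ⊙ transpose i j)
      (subst₂ Fin._<_ (sym (swapped-fst w i j)) (sym (swapped-snd w i j)) gt))
    (ℕₚ.≤-reflexive (ℓ-cong {(w ⊙ transpose i j) ⊙ transpose i j} {w} (⊙-transpose-involutive i j w)))

  -- In t_ij = t_ik t_kj t_ik each factor lowers the length when the `k`-th letter lies between the
  -- other two, so `w ⊙ transpose i j` cannot have length ℓ(w) - 1.
  ℓ-transpose-between : ∀ {i k j} → i Fin.< k → k Fin.< j → ∀ w →
    (w ⟨$⟩ʳ j) Fin.< (w ⟨$⟩ʳ k) → (w ⟨$⟩ʳ k) Fin.< (w ⟨$⟩ʳ i) →
    suc (ℓ (w ⊙ transpose i j)) < ℓ w
  ℓ-transpose-between {i} {k} {j} i<k k<j w j<k k<i =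
    ℕₚ.<-≤-trans (s≤s (subst (_< ℓ w₂) (ℓ-cong {w₃} {w ⊙ transpose i j} (transpose-conj i≢j i≢k j≢k w))
      (ℓ-transpose-> i<k w₂ (subst₂ Fin._<_ (sym w₂k) (sym w₂i) j<k))))
    (ℕₚ.≤-trans (ℓ-transpose-> k<j w₁
      (subst₂ Fin._<_ (sym w₁j) (sym (swapped-snd w i k)) (ℕₚ.<-trans j<k k<i)))
    (ℕₚ.<⇒≤ (ℓ-transpose-> i<k w k<i)))
    where
    i≢k = <⇒≢ {i} {k} i<k
    j≢k = <⇒≢ {k} {j} k<j ∘ sym
    i≢j = <⇒≢ {i} {j} (ℕₚ.<-trans i<k k<j)
    w₁ = w ⊙ transpose i k
    w₂ = w₁ ⊙ transpose k j
    w₃ = w₂ ⊙ transpose i k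
    w₁j : w₁ ⟨$⟩ʳ j ≡ w ⟨$⟩ʳ j
    w₁j = swapped-off w (i≢j ∘ sym) j≢k
    w₂i : w₂ ⟨$⟩ʳ i ≡ w ⟨$⟩ʳ k
    w₂i = trans (swapped-off w₁ i≢k i≢j) (swapped-fst w i k)
    w₂k : w₂ ⟨$⟩ʳ k ≡ w ⟨$⟩ʳ j
    w₂k = trans (swapped-fst w₁ k j) w₁j

  ℓ-adjacentˡ-down : ∀ {i j} → Adjacent i j → ∀ w → (w ⟨$⟩ˡ j) Fin.< (w ⟨$⟩ˡ i) →
    ℓ w ≡ suc (ℓ (transpose i j ⊙ w))
  ℓ-adjacentˡ-down {i} {j} adj w lt =
    trans (ℓ-cong {w} {transpose i j ⊙ transpose i j ⊙ w} (λ k → sym (transpose-⊙-involutive i j w k)))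
    (ℓ-adjacentˡ {i} {j} adj (transpose i j ⊙ w) (subst₂ Fin._<_
      (cong (w ⟨$⟩ˡ_) (sym (transpose-snd j i))) (cong (w ⟨$⟩ˡ_) (sym (transpose-fst j i))) lt))

  -- Bruhat order, descents and induction on the length

  <ᴮ-adjacentˡ : ∀ {i j} → Adjacent i j → ∀ {w} → ℓ (transpose i j ⊙ w) ≡ suc (ℓ w) →
    w <ᴮ transpose i j ⊙ w
  <ᴮ-adjacentˡ {i} {j} adj {w} eq =
      step (w ⟨$⟩ˡ i) (w ⟨$⟩ˡ j)
        (ℕₚ.≤-reflexive (sym (trans (ℓ-cong {w ⊙ transpose (w ⟨$⟩ˡ i) (w ⟨$⟩ˡ j)}
          {transpose i j ⊙ w} sw≈wt) eq)))
        (done sw≈wt)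
    , (λ w≈ → ℕₚ.1+n≢n (trans (sym eq) (ℓ-cong {transpose i j ⊙ w} {w} (λ k → sym (w≈ k)))))
    where sw≈wt = transpose-⊙≈⊙-transpose w i j

  adjacent-step : ∀ {i j} → Adjacent i j → ∀ w →
    ℓ (transpose i j ⊙ w) ≡ suc (ℓ w) ⊎ ℓ w ≡ suc (ℓ (transpose i j ⊙ w))
  adjacent-step {i} {j} adj w with perm-<-or-> (w ⁻¹) (<⇒≢ {i} {j} (adjacent⇒< {i} {j} adj))
  ... | inj₁ lt = inj₁ (ℓ-adjacentˡ {i} {j} adj w lt)
  ... | inj₂ gt = inj₂ (ℓ-adjacentˡ-down {i} {j} adj w gt)

  ≤ᴮ⇒≈⊎< : ∀ {v w : 𝔖 n} → v ≤ᴮ w → v ≈ₚ w ⊎ ℓ v < ℓ w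
  ≤ᴮ⇒≈⊎< (done v≈w) = inj₁ v≈w
  ≤ᴮ⇒≈⊎< {v} {w} (step i j lt v≤w) with ≤ᴮ⇒≈⊎< v≤w
  ... | inj₁ eq = inj₂ (subst (ℓ v <_) (ℓ-cong {v ⊙ transpose i j} {w} eq) lt)
  ... | inj₂ lt′ = inj₂ (ℕₚ.<-trans lt lt′)

  increasing⇒≤ : ∀ (f : Fin n → Fin n) → (∀ {i j} → Adjacent i j → f i Fin.< f j) →
    ∀ d j → toℕ j ≡ d → j Fin.≤ f j
  increasing⇒≤ f mono zero    j eq = subst (_≤ toℕ (f j)) (sym eq) z≤n
  increasing⇒≤ f mono (suc d) j eq = subst (_≤ toℕ (f j)) (sym eq)
    (ℕₚ.≤-<-trans (subst (_≤ toℕ (f i)) i≡d (increasing⇒≤ f mono d i i≡d))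
      (mono {i} {j} (trans eq (cong suc (sym i≡d)))))
    where
    d<n : d < n
    d<n = ℕₚ.<-trans (ℕₚ.≤-reflexive (sym eq)) (Finₚ.toℕ<n j)
    i = fromℕ< d<n
    i≡d = Finₚ.toℕ-fromℕ< d<n

  increasing⇒mono : ∀ (f : Fin n → Fin n) → (∀ {i j} → Adjacent i j → f i Fin.< f j) →
    ∀ d {i j} → toℕ j ≡ suc (d + toℕ i) → f i Fin.< f j
  increasing⇒mono f mono zero    {i} {j} eq = mono {i} {j} eq
  increasing⇒mono f mono (suc d) {i} {j} eq = ℕₚ.<-trans
    (increasing⇒mono f mono d {i} {k} k≡) (mono {k} {j} (trans eq (cong suc (sym k≡))))
    where
    k<n : suc (d + toℕ i) < n
    k<n = ℕₚ.<-trans (ℕₚ.≤-reflexive (sym eq)) (Finₚ.toℕ<n j)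
    k = fromℕ< k<n
    k≡ = Finₚ.toℕ-fromℕ< k<n

  -- An increasing self-map never falls below the identity. Applied to `w` and to its inverse, this
  -- squeezes `w` between the identity and itself.
  no-descent⇒≈e : ∀ (w : 𝔖 n) → (∀ {i j} → Adjacent i j → (w ⟨$⟩ˡ i) Fin.< (w ⟨$⟩ˡ j)) → w ≈ₚ e
  no-descent⇒≈e w asc x = Finₚ.toℕ-injective (ℕₚ.≤-antisym
    (subst (toℕ (w ⟨$⟩ʳ x) ≤_) (cong toℕ (inverseˡ w)) (increasing⇒≤ (w ⟨$⟩ˡ_) asc _ (w ⟨$⟩ʳ x) refl))
    (increasing⇒≤ (w ⟨$⟩ʳ_) asc′ _ x refl))
    where
    asc′ : ∀ {i j} → Adjacent i j → (w ⟨$⟩ʳ i) Fin.< (w ⟨$⟩ʳ j)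
    asc′ {i} {j} adj with perm-<-or-> w (<⇒≢ {i} {j} (adjacent⇒< {i} {j} adj))
    ... | inj₁ lt = lt
    ... | inj₂ gt = contradiction (subst₂ Fin._<_ (inverseˡ w) (inverseˡ w)
      (increasing⇒mono (w ⟨$⟩ˡ_) asc (toℕ (w ⟨$⟩ʳ i) ∸ suc (toℕ (w ⟨$⟩ʳ j))) {w ⟨$⟩ʳ j} {w ⟨$⟩ʳ i}
        (trans (sym (ℕₚ.m∸n+n≡m gt)) (ℕₚ.+-suc _ _))))
      (ℕₚ.<-asym (adjacent⇒< {i} {j} adj))

  LeftDescent : 𝔖 n → Set
  LeftDescent w = ∃[ i ] ∃[ j ] (Adjacent i j × (w ⟨$⟩ˡ j) Fin.< (w ⟨$⟩ˡ i))

  -- The case distinction behind all inductions on the length in the Hecke algebra: a left descent s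
  -- gives T_w = T_s T_{sw} with sw shorter.
  e-or-descent : ∀ (w : 𝔖 n) → w ≈ₚ e ⊎ LeftDescent w
  e-or-descent w with Finₚ.any? (λ i → Finₚ.any? (λ j →
    (toℕ j ℕₚ.≟ suc (toℕ i)) ×-dec ((w ⟨$⟩ˡ j) Finₚ.<? (w ⟨$⟩ˡ i))))
  ... | yes d = inj₂ d
  ... | no ¬d = inj₁ (no-descent⇒≈e w asc)
    where
    asc : ∀ {i j} → Adjacent i j → (w ⟨$⟩ˡ i) Fin.< (w ⟨$⟩ˡ j)
    asc {i} {j} adj with perm-<-or-> (w ⁻¹) (<⇒≢ {i} {j} (adjacent⇒< {i} {j} adj))
    ... | inj₁ lt = lt
    ... | inj₂ gt = contradiction (i , j , adj , gt) ¬d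

  ℓ-e : ℓ {n} e ≡ 0
  ℓ-e = trans (ℓ≡∑∑ e) (sum-zero (λ a → sum-zero (λ b →
    𝟙-no (inversion? e a b) (λ (lt , gt) → ℕₚ.<-asym lt gt))))

  -- Parabolic subgroups of intervals

  Within : Interval n → 𝔖 n → Set
  Within I u = ∀ k → ¬ (k ∈ᴵ I) → u ⟨$⟩ʳ k ≡ k

  module _ (I : Interval n) (u : 𝔖 n) (u∈ : Within I u) where

    within-∈ : ∀ {k} → k ∈ᴵ I → (u ⟨$⟩ʳ k) ∈ᴵ I
    within-∈ {k} k∈ with (u ⟨$⟩ʳ k) ∈ᴵ? I
    ... | yes uk∈ = uk∈
    ... | no uk∉  = contradiction (subst (_∈ᴵ I) (sym (perm-injective u (u∈ _ uk∉))) k∈) uk∉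

    within-∈⁻¹ : ∀ {k} → (u ⟨$⟩ʳ k) ∈ᴵ I → k ∈ᴵ I
    within-∈⁻¹ {k} uk∈ with k ∈ᴵ? I
    ... | yes k∈ = k∈
    ... | no k∉  = contradiction (subst (_∈ᴵ I) (u∈ k k∉) uk∈) k∉

    -- `I` is convex and preserved by `u`, so a fixed point outside it stays on the same side of
    -- every other letter.
    within-inversion : ∀ {a b} → Inversion u a b → a ∈ᴵ I × b ∈ᴵ I
    within-inversion {a} {b} (a<b , ub<ua) with a ∈ᴵ? I | b ∈ᴵ? I
    ... | yes a∈ | yes b∈ = a∈ , b∈
    ... | no a∉  | yes b∈ = contradiction
      ( ℕₚ.<⇒≤ (ℕₚ.≤-<-trans (proj₁ (within-∈ b∈))
        (subst (toℕ (u ⟨$⟩ʳ b) <_) (cong toℕ (u∈ a a∉)) ub<ua))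
      , ℕₚ.<⇒≤ (ℕₚ.<-≤-trans a<b (proj₂ b∈))) a∉
    ... | yes a∈ | no b∉  = contradiction
      ( ℕₚ.<⇒≤ (ℕₚ.≤-<-trans (proj₁ a∈) a<b)
      , ℕₚ.<⇒≤ (ℕₚ.<-≤-trans (subst (_< toℕ (u ⟨$⟩ʳ a)) (cong toℕ (u∈ b b∉)) ub<ua)
        (proj₂ (within-∈ a∈)))) b∉
    ... | no a∉  | no b∉  = contradiction
      (subst₂ Fin._<_ (u∈ b b∉) (u∈ a a∉) ub<ua) (ℕₚ.<-asym a<b)

  within-⊙ : ∀ (I : Interval n) u v → Within I u → Within I v → Within I (u ⊙ v)
  within-⊙ I u v u∈ v∈ k k∉ = trans (cong (u ⟨$⟩ʳ_) (v∈ k k∉)) (u∈ k k∉)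

  within-transpose : ∀ (I : Interval n) {i j} → i ∈ᴵ I → j ∈ᴵ I → Within I (transpose i j)
  within-transpose I i∈ j∈ k k∉ =
    transpose-off (λ eq → k∉ (subst (_∈ᴵ I) (sym eq) i∈)) (λ eq → k∉ (subst (_∈ᴵ I) (sym eq) j∈))

  within-descent : ∀ (I : Interval n) u → Within I u → ∀ {i j} → Adjacent i j →
    (u ⟨$⟩ˡ j) Fin.< (u ⟨$⟩ˡ i) → i ∈ᴵ I × j ∈ᴵ I
  within-descent I u u∈ {i} {j} adj lt
    with within-inversion I u u∈ {u ⟨$⟩ˡ j} {u ⟨$⟩ˡ i}
      (lt , subst₂ Fin._<_ (sym (inverseʳ u)) (sym (inverseʳ u)) (adjacent⇒< {i} {j} adj))
  ... | j∈ , i∈ = subst (_∈ᴵ I) (inverseʳ u) (within-∈ I u u∈ i∈) , subst (_∈ᴵ I) (inverseʳ u)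
        (within-∈ I u u∈ j∈)

  ℓ-transpose-<⁻¹ : ∀ {v : 𝔖 n} {i j} → ℓ v < ℓ (v ⊙ transpose i j) →
    Inversion (v ⊙ transpose i j) i j ⊎ Inversion (v ⊙ transpose i j) j i
  ℓ-transpose-<⁻¹ {v} {i} {j} lt with Finₚ.<-cmp i j
  ... | tri≈ _ refl _ = contradiction lt
        (ℕₚ.<-irrefl (sym (ℓ-cong {v ⊙ transpose i i} {v} (λ k → cong (v ⟨$⟩ʳ_) (transpose-refl i k)))))
  ... | tri< i<j i≢j _ with perm-<-or-> v i≢j
  ...   | inj₁ vi<vj = inj₁ (i<j , subst₂ Fin._<_ (sym (swapped-snd v i j))
        (sym (swapped-fst v i j)) vi<vj)
  ...   | inj₂ vj<vi = contradiction lt (ℕₚ.<-asym (ℓ-transpose-> i<j v vj<vi))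
  ℓ-transpose-<⁻¹ {v} {i} {j} lt | tri> _ i≢j j<i with perm-<-or-> v i≢j
  ...   | inj₂ vj<vi = inj₂ (j<i , subst₂ Fin._<_ (sym (swapped-fst v i j))
        (sym (swapped-snd v i j)) vj<vi)
  ...   | inj₁ vi<vj = contradiction lt (ℕₚ.<-asym (subst (_< ℓ v)
          (ℓ-cong {v ⊙ transpose j i} {v ⊙ transpose i j} (λ k → cong (v ⟨$⟩ʳ_) (transpose-sym j i k)))
          (ℓ-transpose-> j<i v vi<vj)))

  -- A step of the Bruhat order undoes an inversion of the larger element. If that element lies in
  -- the parabolic subgroup, the inversion has both positions in `I`, and removing it does not leave
  -- the subgroup.
  within-≤ᴮ : ∀ (I : Interval n) {v w} → v ≤ᴮ w → Within I w → Within I v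
  within-≤ᴮ I (done v≈w) w∈ k k∉ = trans (v≈w k) (w∈ k k∉)
  within-≤ᴮ I {v} (step i j lt v≤w) w∈ k k∉ = trans
    (sym (swapped-off v (λ eq → k∉ (subst (_∈ᴵ I) (sym eq) (proj₁ ij∈)))
      (λ eq → k∉ (subst (_∈ᴵ I) (sym eq) (proj₂ ij∈)))))
    (vt∈ k k∉)
    where
    vt∈ = within-≤ᴮ I v≤w w∈
    ij∈ : i ∈ᴵ I × j ∈ᴵ I
    ij∈ with ℓ-transpose-<⁻¹ {v} {i} {j} lt
    ... | inj₁ inv = within-inversion I (v ⊙ transpose i j) vt∈ {i} {j} inv
    ... | inj₂ inv with within-inversion I (v ⊙ transpose i j) vt∈ {j} {i} inv
    ...   | j∈ , i∈ = i∈ , j∈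

-- Laurent polynomials

mono : ℤ → ℤ → ℤ → ℤ
mono c j k = if does (j ℤₚ.≟ k) then c else 0ℤ

mono-at : ∀ c {j k} → j ≡ k → mono c j k ≡ c
mono-at c {j} {k} j≡k with j ℤₚ.≟ k
... | yes _ = refl
... | no j≢k = contradiction j≡k j≢k

mono-off : ∀ c {j k} → j ≢ k → mono c j k ≡ 0ℤ
mono-off c {j} {k} j≢k with j ℤₚ.≟ k
... | yes j≡k = contradiction j≡k j≢k
... | no _ = refl

mono-⇔ : ∀ c {j k j′ k′} → (j ≡ k → j′ ≡ k′) → (j′ ≡ k′ → j ≡ k) → mono c j k ≡ mono c j′ k′
mono-⇔ c {j} {k} {j′} {k′} f g with j ℤₚ.≟ k
... | yes j≡k = sym (mono-at c (f j≡k))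
... | no j≢k  = sym (mono-off c (j≢k ∘ g))

mono-+ : ∀ c d j k → mono (c +ᶻ d) j k ≡ mono c j k +ᶻ mono d j k
mono-+ c d j k with j ℤₚ.≟ k
... | yes _ = refl
... | no _  = refl

mono-* : ∀ c d j k → mono (c ℤ.* d) j k ≡ c ℤ.* mono d j k
mono-* c d j k with j ℤₚ.≟ k
... | yes _ = refl
... | no _  = sym (ℤₚ.*-zeroʳ c)

coeffᴸ-∷ : ∀ c j p k → coeffᴸ ((c , j) ∷ p) k ≡ mono c j k +ᶻ coeffᴸ p k
coeffᴸ-∷ c j p k with j ℤₚ.≟ k
... | yes _ = refl
... | no _  = sym (ℤₚ.+-identityˡ _)

coeffᴸ-q½^ : ∀ j k → coeffᴸ (q½^ j) k ≡ mono 1ℤ j k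
coeffᴸ-q½^ j k = trans (coeffᴸ-∷ 1ℤ j [] k) (ℤₚ.+-identityʳ _)

coeffᴸ-++ : ∀ p r k → coeffᴸ (p ++ r) k ≡ coeffᴸ p k +ᶻ coeffᴸ r k
coeffᴸ-++ [] r k = sym (ℤₚ.+-identityˡ _)
coeffᴸ-++ ((c , j) ∷ p) r k = begin
  coeffᴸ ((c , j) ∷ p ++ r) k                      ≡⟨ coeffᴸ-∷ c j (p ++ r) k ⟩
  mono c j k +ᶻ coeffᴸ (p ++ r) k                 ≡⟨ cong (mono c j k +ᶻ_) (coeffᴸ-++ p r k) ⟩
  mono c j k +ᶻ (coeffᴸ p k +ᶻ coeffᴸ r k)       ≡⟨ ℤₚ.+-assoc (mono c j k) _ _ ⟨
  mono c j k +ᶻ coeffᴸ p k +ᶻ coeffᴸ r k         ≡⟨ cong (_+ᶻ coeffᴸ r k) (coeffᴸ-∷ c j p k) ⟨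
  coeffᴸ ((c , j) ∷ p) k +ᶻ coeffᴸ r k            ∎
  where open ≡-Reasoning

coeffᴸ-neg : ∀ p k → coeffᴸ (-ᴸ p) k ≡ ℤ.- coeffᴸ p k
coeffᴸ-neg [] k = refl
coeffᴸ-neg ((c , j) ∷ p) k with j ℤₚ.≟ k
... | yes _ = trans (cong (ℤ.- c +ᶻ_) (coeffᴸ-neg p k)) (sym (ℤₚ.neg-distrib-+ c _))
... | no _  = coeffᴸ-neg p k

coeffᴸ-conj : ∀ p k → coeffᴸ (conj p) k ≡ coeffᴸ p (ℤ.- k)
coeffᴸ-conj [] k = refl
coeffᴸ-conj ((c , j) ∷ p) k = trans (coeffᴸ-∷ c (ℤ.- j) (conj p) k)
  (trans (cong₂ _+ᶻ_ (mono-⇔ c {ℤ.- j} {k} {j} {ℤ.- k}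
      (λ eq → trans (sym (ℤₚ.neg-involutive j)) (cong ℤ.-_ eq))
      (λ eq → trans (cong ℤ.-_ eq) (ℤₚ.neg-involutive k)))
    (coeffᴸ-conj p k)) (sym (coeffᴸ-∷ c j p (ℤ.- k))))

-- act p (coeffᴸ r) is the convolution product.
act : Laurent → (ℤ → ℤ) → ℤ → ℤ
act p g k = List.foldr (λ (c , j) s → c ℤ.* g (k ℤ.- j) +ᶻ s) 0ℤ p

act-cong : ∀ p {g h} → (∀ k → g k ≡ h k) → ∀ k → act p g k ≡ act p h k
act-cong [] g≡h k = refl
act-cong ((c , j) ∷ p) g≡h k = cong₂ (λ x y → c ℤ.* x +ᶻ y) (g≡h (k ℤ.- j)) (act-cong p g≡h k)

act-++ : ∀ p r g k → act (p ++ r) g k ≡ act p g k +ᶻ act r g k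
act-++ [] r g k = sym (ℤₚ.+-identityˡ _)
act-++ ((c , j) ∷ p) r g k = trans (cong (c ℤ.* g (k ℤ.- j) +ᶻ_) (act-++ p r g k))
  (sym (ℤₚ.+-assoc (c ℤ.* g (k ℤ.- j)) _ _))

act-+ : ∀ p g h k → act p (λ x → g x +ᶻ h x) k ≡ act p g k +ᶻ act p h k
act-+ [] g h k = refl
act-+ ((c , j) ∷ p) g h k = trans (cong (c ℤ.* (g (k ℤ.- j) +ᶻ h (k ℤ.- j)) +ᶻ_) (act-+ p g h k))
  (rearrange c (g (k ℤ.- j)) (h (k ℤ.- j)) (act p g k) (act p h k))
  where
  rearrange : ∀ c x y z t → c ℤ.* (x +ᶻ y) +ᶻ (z +ᶻ t) ≡ c ℤ.* x +ᶻ z +ᶻ (c ℤ.* y +ᶻ t)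
  rearrange = solve-∀

act-neg : ∀ p g k → act (-ᴸ p) g k ≡ ℤ.- act p g k
act-neg [] g k = refl
act-neg ((c , j) ∷ p) g k = trans (cong (ℤ.- c ℤ.* g (k ℤ.- j) +ᶻ_) (act-neg p g k))
  (rearrange c (g (k ℤ.- j)) (act p g k))
  where
  rearrange : ∀ c x y → ℤ.- c ℤ.* x +ᶻ ℤ.- y ≡ ℤ.- (c ℤ.* x +ᶻ y)
  rearrange = solve-∀

act-negʳ : ∀ p g k → act p (λ j → ℤ.- g j) k ≡ ℤ.- act p g k
act-negʳ [] g k = refl
act-negʳ ((c , j) ∷ p) g k = trans (cong (c ℤ.* ℤ.- g (k ℤ.- j) +ᶻ_) (act-negʳ p g k))
  (rearrange c (g (k ℤ.- j)) (act p g k))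
  where
  rearrange : ∀ c x y → c ℤ.* ℤ.- x +ᶻ ℤ.- y ≡ ℤ.- (c ℤ.* x +ᶻ y)
  rearrange = solve-∀

act-translate : ∀ p g k → act p (λ j → g (j ℤ.- + 2)) k ≡ act p g (k ℤ.- + 2)
act-translate [] g k = refl
act-translate ((c , j) ∷ p) g k = cong₂ (λ x y → c ℤ.* g x +ᶻ y) (swap k j) (act-translate p g k)
  where
  swap : ∀ k j → k ℤ.- j ℤ.- + 2 ≡ k ℤ.- + 2 ℤ.- j
  swap = solve-∀

act-zero : ∀ p k → act p (λ _ → 0ℤ) k ≡ 0ℤ
act-zero [] k = refl
act-zero ((c , j) ∷ p) k = trans (cong₂ _+ᶻ_ (ℤₚ.*-zeroʳ c) (act-zero p k)) refl

act-shift : ∀ c j p g k → act (List.map (λ (d , i) → c ℤ.* d , j +ᶻ i) p) g k ≡ c ℤ.* act p g (k ℤ.- j)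
act-shift c j [] g k = sym (ℤₚ.*-zeroʳ c)
act-shift c j ((d , i) ∷ p) g k = trans
  (cong₂ (λ x y → c ℤ.* d ℤ.* g x +ᶻ y) (exponents k j i) (act-shift c j p g k))
  (rearrange c d (g (k ℤ.- j ℤ.- i)) (act p g (k ℤ.- j)))
  where
  exponents : ∀ k j i → k ℤ.- (j +ᶻ i) ≡ k ℤ.- j ℤ.- i
  exponents = solve-∀
  rearrange : ∀ c d x y → c ℤ.* d ℤ.* x +ᶻ c ℤ.* y ≡ c ℤ.* (d ℤ.* x +ᶻ y)
  rearrange = solve-∀

act-* : ∀ p r g k → act (p *ᴸ r) g k ≡ act p (act r g) k
act-* [] r g k = refl
act-* ((c , j) ∷ p) r g k = trans (act-++ (List.map (λ (d , i) → c ℤ.* d , j +ᶻ i) r) (p *ᴸ r) g k)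
  (cong₂ _+ᶻ_ (act-shift c j r g k) (act-* p r g k))

sub-swap : ∀ {j i k} → j ≡ k ℤ.- i → i ≡ k ℤ.- j
sub-swap {j} {i} {k} refl = lemma k i
  where
  lemma : ∀ k i → i ≡ k ℤ.- (k ℤ.- i)
  lemma = solve-∀

act-mono : ∀ p c j k → act p (mono c j) k ≡ c ℤ.* coeffᴸ p (k ℤ.- j)
act-mono [] c j k = sym (ℤₚ.*-zeroʳ c)
act-mono ((d , i) ∷ p) c j k = begin
  d ℤ.* mono c j (k ℤ.- i) +ᶻ act p (mono c j) k
    ≡⟨ cong₂ _+ᶻ_ (mono-* d c j (k ℤ.- i)) (sym (act-mono p c j k)) ⟨
  mono (d ℤ.* c) j (k ℤ.- i) +ᶻ c ℤ.* coeffᴸ p (k ℤ.- j)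
    ≡⟨ cong (_+ᶻ c ℤ.* coeffᴸ p (k ℤ.- j)) (trans (cong (λ x → mono x j (k ℤ.- i)) (ℤₚ.*-comm d c))
       (mono-⇔ (c ℤ.* d) {j} {k ℤ.- i} {i} {k ℤ.- j} (sub-swap {j} {i} {k}) (sub-swap {i} {j} {k}))) ⟩
  mono (c ℤ.* d) i (k ℤ.- j) +ᶻ c ℤ.* coeffᴸ p (k ℤ.- j)
    ≡⟨ cong (_+ᶻ c ℤ.* coeffᴸ p (k ℤ.- j)) (mono-* c d i (k ℤ.- j)) ⟩
  c ℤ.* mono d i (k ℤ.- j) +ᶻ c ℤ.* coeffᴸ p (k ℤ.- j)
    ≡⟨ ℤₚ.*-distribˡ-+ c (mono d i (k ℤ.- j)) _ ⟨
  c ℤ.* (mono d i (k ℤ.- j) +ᶻ coeffᴸ p (k ℤ.- j))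
    ≡⟨ cong (c ℤ.*_) (coeffᴸ-∷ d i p (k ℤ.- j)) ⟨
  c ℤ.* coeffᴸ ((d , i) ∷ p) (k ℤ.- j) ∎
  where open ≡-Reasoning

act-comm : ∀ p r k → act p (coeffᴸ r) k ≡ act r (coeffᴸ p) k
act-comm [] r k = sym (act-zero r k)
act-comm ((c , j) ∷ p) r k = sym (trans (act-cong r (coeffᴸ-∷ c j p) k)
  (trans (act-+ r (mono c j) (coeffᴸ p) k) (cong₂ _+ᶻ_ (act-mono r c j k) (sym (act-comm p r k)))))

act-1 : ∀ p k → act p (coeffᴸ 1ᴸ) k ≡ coeffᴸ p k
act-1 p k = trans (act-cong p (coeffᴸ-q½^ 0ℤ) k) (trans (act-mono p 1ℤ 0ℤ k)
  (trans (ℤₚ.*-identityˡ _) (cong (coeffᴸ p) (ℤₚ.+-identityʳ k))))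

coeffᴸ-* : ∀ p r k → coeffᴸ (p *ᴸ r) k ≡ act p (coeffᴸ r) k
coeffᴸ-* p r k = trans (sym (act-1 (p *ᴸ r) k)) (trans (act-* p r (coeffᴸ 1ᴸ) k)
  (act-cong p (act-1 r) k))

-- `act` recurses on the list `p`, so equality of coefficients of `p` is visible only after
-- commutativity has moved `p` into the second argument.
act-congˡ : ∀ {p p′} → p ≈ᴸ p′ → ∀ r k → act p (coeffᴸ r) k ≡ act p′ (coeffᴸ r) k
act-congˡ {p} {p′} p≈p′ r k = trans (act-comm p r k) (trans (act-cong r p≈p′ k) (act-comm r p′ k))

*ᴸ-cong : ∀ {p p′ r r′} → p ≈ᴸ p′ → r ≈ᴸ r′ → p *ᴸ r ≈ᴸ p′ *ᴸ r′
*ᴸ-cong {p} {p′} {r} {r′} p≈p′ r≈r′ k = trans (coeffᴸ-* p r k)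
  (trans (act-congˡ {p} {p′} p≈p′ r k) (trans (act-cong p′ r≈r′ k) (sym (coeffᴸ-* p′ r′ k))))

*ᴸ-comm : ∀ p r → p *ᴸ r ≈ᴸ r *ᴸ p
*ᴸ-comm p r k = trans (coeffᴸ-* p r k) (trans (act-comm p r k) (sym (coeffᴸ-* r p k)))

*ᴸ-assoc : ∀ p r s → (p *ᴸ r) *ᴸ s ≈ᴸ p *ᴸ (r *ᴸ s)
*ᴸ-assoc p r s k = trans (coeffᴸ-* (p *ᴸ r) s k) (trans (act-* p r (coeffᴸ s) k)
  (trans (act-cong p (λ x → sym (coeffᴸ-* r s x)) k) (sym (coeffᴸ-* p (r *ᴸ s) k))))

coeffᴸ-q½^* : ∀ j p k → coeffᴸ (q½^ j *ᴸ p) k ≡ coeffᴸ p (k ℤ.- j)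
coeffᴸ-q½^* j p k = trans (coeffᴸ-* (q½^ j) p k) (trans (ℤₚ.+-identityʳ _) (ℤₚ.*-identityˡ _))

coeffᴸ-*1 : ∀ p k → coeffᴸ (p *ᴸ 1ᴸ) k ≡ coeffᴸ p k
coeffᴸ-*1 p k = trans (coeffᴸ-* p 1ᴸ k) (act-1 p k)

-- Top p D b : p = q^(D/2) + b q^(D/2-1) up to terms of lower degree, and
-- without a term in q^((D-1)/2).
record Top (p : Laurent) (D b : ℤ) : Set where
  constructor top
  field coeffs : ∀ k → D ℤ.- + 2 ℤ.≤ k → coeffᴸ p k ≡ mono 1ℤ D k +ᶻ mono b (D ℤ.- + 2) k

open Top

Top-cong : ∀ {p r D b} → p ≈ᴸ r → Top p D b → Top r D b
Top-cong p≈r (top t) = top (λ k D≤k → trans (sym (p≈r k)) (t k D≤k))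

D-2<D : ∀ D → D ℤ.- + 2 ℤ.< D
D-2<D D = subst (D ℤ.- + 2 ℤ.<_) (ℤₚ.+-identityʳ D) (ℤₚ.+-monoʳ-< D (ℤ.-<+ {1} {0}))

below : ℤ → Laurent → Laurent
below D = filter (λ (_ , j) → j ℤₚ.<? D)

coeffᴸ-below-< : ∀ D p {k} → k ℤ.< D → coeffᴸ (below D p) k ≡ coeffᴸ p k
coeffᴸ-below-< D [] k<D = refl
coeffᴸ-below-< D ((c , j) ∷ p) {k} k<D with j ℤₚ.<? D
... | yes _ = trans (coeffᴸ-∷ c j (below D p) k) (trans (cong (mono c j k +ᶻ_) (coeffᴸ-below-< D p k<D))
                (sym (coeffᴸ-∷ c j p k)))
... | no j≮D = trans (coeffᴸ-below-< D p k<D) (sym (trans (coeffᴸ-∷ c j p k)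
                 (trans (cong (_+ᶻ coeffᴸ p k) (mono-off c {j} {k} (λ { refl → j≮D k<D }))) (ℤₚ.+-identityˡ _))))

coeffᴸ-below-≥ : ∀ D p {k} → D ℤ.≤ k → coeffᴸ (below D p) k ≡ 0ℤ
coeffᴸ-below-≥ D [] D≤k = refl
coeffᴸ-below-≥ D ((c , j) ∷ p) {k} D≤k with j ℤₚ.<? D
... | yes j<D = trans (coeffᴸ-∷ c j (below D p) k) (trans (cong₂ _+ᶻ_
                  (mono-off c {j} {k} (λ { refl → ℤₚ.<⇒≱ j<D D≤k })) (coeffᴸ-below-≥ D p D≤k)) refl)
... | no _    = coeffᴸ-below-≥ D p D≤k

act-below-zero : ∀ D p (g : ℤ → ℤ) k → (∀ {j} → j ℤ.< D → g (k ℤ.- j) ≡ 0ℤ) →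
  act (below D p) g k ≡ 0ℤ
act-below-zero D [] g k g≡0 = refl
act-below-zero D ((c , j) ∷ p) g k g≡0 with j ℤₚ.<? D
... | yes j<D = trans (cong₂ _+ᶻ_ (trans (cong (c ℤ.*_) (g≡0 j<D)) (ℤₚ.*-zeroʳ c))
      (act-below-zero D p g k g≡0)) refl
... | no _    = act-below-zero D p g k g≡0

Top-normal : ∀ {p D b} → Top p D b →
  p ≈ᴸ (1ℤ , D) ∷ (b , D ℤ.- + 2) ∷ below (D ℤ.- + 2) p
Top-normal {p} {D} {b} (top t) k = sym (trans (coeffᴸ-∷ 1ℤ D ((b , D ℤ.- + 2) ∷ below (D ℤ.- + 2) p) k)
  (trans (cong (mono 1ℤ D k +ᶻ_) (coeffᴸ-∷ b (D ℤ.- + 2) (below (D ℤ.- + 2) p) k))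
    (go (k ℤₚ.<? (D ℤ.- + 2)))))
  where
  go : Dec (k ℤ.< D ℤ.- + 2) → mono 1ℤ D k +ᶻ (mono b (D ℤ.- + 2) k +ᶻ
    coeffᴸ (below (D ℤ.- + 2) p) k) ≡ coeffᴸ p k
  go (yes k<) = trans (cong₂ _+ᶻ_ (mono-off 1ℤ {D} {k} (λ { refl → ℤₚ.<-asym k< (D-2<D D) }))
    (trans (cong₂ _+ᶻ_ (mono-off b {D ℤ.- + 2} {k} (λ { refl → ℤₚ.<-irrefl refl k< }))
       (coeffᴸ-below-< (D ℤ.- + 2) p k<)) (ℤₚ.+-identityˡ (coeffᴸ p k)))) (ℤₚ.+-identityˡ (coeffᴸ p k))
  go (no k≮) = trans (cong (λ x → mono 1ℤ D k +ᶻ (mono b (D ℤ.- + 2) k +ᶻ x))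
      (coeffᴸ-below-≥ (D ℤ.- + 2) p (ℤₚ.≮⇒≥ k≮)))
    (trans (cong (mono 1ℤ D k +ᶻ_) (ℤₚ.+-identityʳ _)) (sym (t k (ℤₚ.≮⇒≥ k≮))))

≤-shift : ∀ {x y} z → x ℤ.≤ y → x ℤ.- z ℤ.≤ y ℤ.- z
≤-shift z = ℤₚ.+-monoˡ-≤ (ℤ.- z)

-- Two leading terms multiply as (q^(D/2) + b q^(D/2-1)) (q^(E/2) + c q^(E/2-1)). Here the missing
-- half step matters: terms in q^((D-1)/2) and q^((E-1)/2) would also contribute to the second
-- coefficient of the product.
Top-* : ∀ {p r D E b c} → Top p D b → Top r E c → Top (p *ᴸ r) (D +ᶻ E) (b +ᶻ c)
Top-* {p} {r} {D} {E} {b} {c} topp topr = top product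
  where
  product : ∀ k → D +ᶻ E ℤ.- + 2 ℤ.≤ k → coeffᴸ (p *ᴸ r) k ≡ mono 1ℤ (D +ᶻ E) k +ᶻ mono (b +ᶻ c)
    (D +ᶻ E ℤ.- + 2) k
  product k D+E≤k = begin
    coeffᴸ (p *ᴸ r) k
      ≡⟨ coeffᴸ-* p r k ⟩
    act p (coeffᴸ r) k
      ≡⟨ act-congˡ {p} {(1ℤ , D) ∷ (b , D ℤ.- + 2) ∷ p′} (Top-normal topp) r k ⟩
    1ℤ ℤ.* coeffᴸ r (k ℤ.- D) +ᶻ (b ℤ.* coeffᴸ r (k ℤ.- (D ℤ.- + 2)) +ᶻ act p′ (coeffᴸ r) k)
      ≡⟨ cong₂ (λ x y → 1ℤ ℤ.* x +ᶻ (b ℤ.* coeffᴸ r (k ℤ.- (D ℤ.- + 2)) +ᶻ y))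
           (coeffs topr (k ℤ.- D) (subst (ℤ._≤ k ℤ.- D) (e₁ D E) (≤-shift D D+E≤k)))
           -- The remaining terms of `p` have exponent below D - 2, and are paired with coefficients
           -- of `r` beyond its leading exponent E.
           (act-below-zero (D ℤ.- + 2) p (coeffᴸ r) k (λ {j} j< → vanish (k ℤ.- j)
              (ℤₚ.≤-<-trans E≤ (ℤₚ.+-monoʳ-< k (ℤₚ.neg-mono-< j<))))) ⟩
    1ℤ ℤ.* (mono 1ℤ E (k ℤ.- D) +ᶻ mono c (E ℤ.- + 2) (k ℤ.- D)) +ᶻ
      (b ℤ.* coeffᴸ r (k ℤ.- (D ℤ.- + 2)) +ᶻ 0ℤ)
      ≡⟨ cong (λ x → 1ℤ ℤ.* (mono 1ℤ E (k ℤ.- D) +ᶻ mono c (E ℤ.- + 2) (k ℤ.- D)) +ᶻ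
        (b ℤ.* x +ᶻ 0ℤ)) lead ⟩
    1ℤ ℤ.* (mono 1ℤ E (k ℤ.- D) +ᶻ mono c (E ℤ.- + 2) (k ℤ.- D)) +ᶻ
      (b ℤ.* mono 1ℤ E (k ℤ.- (D ℤ.- + 2)) +ᶻ 0ℤ)
      ≡⟨ cong₂ (λ x y → 1ℤ ℤ.* (x +ᶻ y) +ᶻ (b ℤ.* mono 1ℤ E (k ℤ.- (D ℤ.- + 2)) +ᶻ 0ℤ))
           (shift 1ℤ E D (D +ᶻ E) (e₃ D E) (e₄ D E))
           (shift c (E ℤ.- + 2) D (D +ᶻ E ℤ.- + 2) (e₅ D E) (e₆ D E)) ⟩
    1ℤ ℤ.* (mono 1ℤ (D +ᶻ E) k +ᶻ mono c (D +ᶻ E ℤ.- + 2) k) +ᶻ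
      (b ℤ.* mono 1ℤ E (k ℤ.- (D ℤ.- + 2)) +ᶻ 0ℤ)
      ≡⟨ cong (λ x → 1ℤ ℤ.* (mono 1ℤ (D +ᶻ E) k +ᶻ mono c (D +ᶻ E ℤ.- + 2) k) +ᶻ (x +ᶻ 0ℤ))
           (trans (sym (mono-* b 1ℤ E (k ℤ.- (D ℤ.- + 2))))
             (trans (cong (λ x → mono x E (k ℤ.- (D ℤ.- + 2))) (ℤₚ.*-identityʳ b))
             (shift b E (D ℤ.- + 2) (D +ᶻ E ℤ.- + 2) (e₇ D E) (e₈ D E)))) ⟩
    1ℤ ℤ.* (mono 1ℤ (D +ᶻ E) k +ᶻ mono c (D +ᶻ E ℤ.- + 2) k) +ᶻ (mono b (D +ᶻ E ℤ.- + 2) k +ᶻ 0ℤ)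
      ≡⟨ rearrange (mono 1ℤ (D +ᶻ E) k) (mono c (D +ᶻ E ℤ.- + 2) k) (mono b (D +ᶻ E ℤ.- + 2) k) ⟩
    mono 1ℤ (D +ᶻ E) k +ᶻ (mono b (D +ᶻ E ℤ.- + 2) k +ᶻ mono c (D +ᶻ E ℤ.- + 2) k)
      ≡⟨ cong (mono 1ℤ (D +ᶻ E) k +ᶻ_) (mono-+ b c (D +ᶻ E ℤ.- + 2) k) ⟨
    mono 1ℤ (D +ᶻ E) k +ᶻ mono (b +ᶻ c) (D +ᶻ E ℤ.- + 2) k ∎
    where
    open ≡-Reasoning
    p′ = below (D ℤ.- + 2) p
    rearrange : ∀ x y z → 1ℤ ℤ.* (x +ᶻ y) +ᶻ (z +ᶻ 0ℤ) ≡ x +ᶻ (z +ᶻ y)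
    rearrange = solve-∀
    e₁ : ∀ D E → D +ᶻ E ℤ.- + 2 ℤ.- D ≡ E ℤ.- + 2
    e₁ = solve-∀
    e₂ : ∀ D E → D +ᶻ E ℤ.- + 2 ℤ.- (D ℤ.- + 2) ≡ E
    e₂ = solve-∀
    e₃ : ∀ D E → E +ᶻ D ≡ D +ᶻ E
    e₃ = solve-∀
    e₄ : ∀ D E → D +ᶻ E ℤ.- D ≡ E
    e₄ = solve-∀
    e₅ : ∀ D E → E ℤ.- + 2 +ᶻ D ≡ D +ᶻ E ℤ.- + 2
    e₅ = solve-∀
    e₆ : ∀ D E → D +ᶻ E ℤ.- + 2 ℤ.- D ≡ E ℤ.- + 2
    e₆ = solve-∀
    e₇ : ∀ D E → E +ᶻ (D ℤ.- + 2) ≡ D +ᶻ E ℤ.- + 2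
    e₇ = solve-∀
    e₈ : ∀ D E → D +ᶻ E ℤ.- + 2 ℤ.- (D ℤ.- + 2) ≡ E
    e₈ = solve-∀
    e₉ : ∀ x y → x ℤ.- y +ᶻ y ≡ x
    e₉ = solve-∀
    shift : ∀ c i j m → i +ᶻ j ≡ m → m ℤ.- j ≡ i → mono c i (k ℤ.- j) ≡ mono c m k
    shift c i j m to from = mono-⇔ c {i} {k ℤ.- j} {m} {k}
      (λ eq → trans (sym to) (trans (cong (_+ᶻ j) eq) (e₉ k j)))
      (λ eq → trans (sym from) (cong (ℤ._- j) eq))
    E≤ : E ℤ.≤ k ℤ.- (D ℤ.- + 2)
    E≤ = subst (ℤ._≤ k ℤ.- (D ℤ.- + 2)) (e₂ D E) (≤-shift (D ℤ.- + 2) D+E≤k)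
    vanish : ∀ x → E ℤ.< x → coeffᴸ r x ≡ 0ℤ
    vanish x E<x = trans (coeffs topr x (ℤₚ.<⇒≤ (ℤₚ.<-trans (D-2<D E) E<x)))
      (trans (cong₂ _+ᶻ_ (mono-off 1ℤ {E} {x} (λ { refl → ℤₚ.<-irrefl refl E<x }))
        (mono-off c {E ℤ.- + 2} {x} (λ { refl → ℤₚ.<-asym E<x (D-2<D E) }))) refl)
    lead : coeffᴸ r (k ℤ.- (D ℤ.- + 2)) ≡ mono 1ℤ E (k ℤ.- (D ℤ.- + 2))
    lead = trans (coeffs topr (k ℤ.- (D ℤ.- + 2)) (ℤₚ.≤-trans (ℤₚ.<⇒≤ (D-2<D E)) E≤))
      (trans (cong (mono 1ℤ E (k ℤ.- (D ℤ.- + 2)) +ᶻ_) (mono-off c {E ℤ.- + 2} {k ℤ.- (D ℤ.- + 2)}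
        (λ eq → ℤₚ.<-irrefl eq (ℤₚ.<-≤-trans (D-2<D E) E≤)))) (ℤₚ.+-identityʳ _))

Top-lead : ∀ {p D b} → Top p D b → coeffᴸ p D ≡ 1ℤ
Top-lead {p} {D} {b} t = trans (coeffs t D (ℤₚ.<⇒≤ (D-2<D D))) (cong₂ _+ᶻ_ (mono-at 1ℤ {D} refl)
  (mono-off b {D ℤ.- + 2} {D} (λ eq → ℤₚ.<-irrefl eq (D-2<D D))))

Top-above : ∀ {p D b} → Top p D b → ∀ {k} → D ℤ.< k → coeffᴸ p k ≡ 0ℤ
Top-above {p} {D} {b} t {k} D<k = trans (coeffs t k (ℤₚ.<⇒≤ (ℤₚ.<-trans (D-2<D D) D<k)))
  (cong₂ _+ᶻ_ (mono-off 1ℤ {D} {k} (λ { refl → ℤₚ.<-irrefl refl D<k }))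
    (mono-off b {D ℤ.- + 2} {k} (λ { refl → ℤₚ.<-asym D<k (D-2<D D) })))

Top-next : ∀ {p D b} → Top p D b → coeffᴸ p (D ℤ.- + 2) ≡ b
Top-next {p} {D} {b} t = trans (coeffs t (D ℤ.- + 2) ℤₚ.≤-refl) (trans (cong₂ _+ᶻ_
  (mono-off 1ℤ {D} {D ℤ.- + 2} (λ eq → ℤₚ.<-irrefl (sym eq) (D-2<D D)))
  (mono-at b {D ℤ.- + 2} refl)) (ℤₚ.+-identityˡ b))

Top-unique : ∀ {p r D E b c} → p ≈ᴸ r → Top p D b → Top r E c → D ≡ E × b ≡ c
Top-unique {p} {r} {D} {E} {b} {c} p≈r topp topr with ℤₚ.<-cmp D E
... | tri< D<E _ _ = contradiction (trans (sym (Top-lead topr))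
      (trans (sym (p≈r E)) (Top-above topp D<E))) λ ()
... | tri> _ _ E<D = contradiction (trans (sym (Top-lead topp))
      (trans (p≈r D) (Top-above topr E<D))) λ ()
... | tri≈ _ refl _ = refl , trans (sym (Top-next topp)) (trans (p≈r _) (Top-next topr))

mono-zero : ∀ j k → mono 0ℤ j k ≡ 0ℤ
mono-zero j k with j ℤₚ.≟ k
... | yes _ = refl
... | no _  = refl

Top-q½^ : ∀ D → Top (q½^ D) D 0ℤ
Top-q½^ D = top λ k _ → trans (coeffᴸ-q½^ D k)
  (sym (trans (cong (mono 1ℤ D k +ᶻ_) (mono-zero (D ℤ.- + 2) k)) (ℤₚ.+-identityʳ _)))

[]q-suc : ∀ k → [ suc k ]q ≡ [ k ]q ++ q½^ (+ (2 * k))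
[]q-suc k = trans (cong (List.map _) (sym (Listₚ.upTo-∷ʳ k))) (Listₚ.map-++ _ (List.upTo k) (k ∷ []))

+2*suc : ∀ k → + (2 * suc k) ≡ + (2 * k) +ᶻ + 2
+2*suc k = cong +_ (lemma k)
  where
  lemma : ∀ k → 2 * suc k ≡ 2 * k + 2
  lemma = ℕ-Solver.solve-∀

2*k<2*suc : ∀ k → + (2 * k) ℤ.< + (2 * suc k)
2*k<2*suc k = ℤ.+<+ (ℕₚ.*-monoʳ-< 2 (ℕₚ.n<1+n k))

[]q-above : ∀ k {x} → + (2 * k) ℤ.≤ x → coeffᴸ [ k ]q x ≡ 0ℤ
[]q-above zero    _ = refl
[]q-above (suc k) {x} ≤x = trans (cong (λ p → coeffᴸ p x) ([]q-suc k))
  (trans (coeffᴸ-++ [ k ]q _ x) (trans (cong₂ _+ᶻ_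
    ([]q-above k (ℤₚ.<⇒≤ (ℤₚ.<-≤-trans (2*k<2*suc k) ≤x)))
    (trans (coeffᴸ-q½^ (+ (2 * k)) x) (mono-off 1ℤ {+ (2 * k)} {x} (λ { refl → ℤₚ.<-irrefl refl (ℤₚ.<-≤-trans (2*k<2*suc k) ≤x) }))))
    refl))

Top-[1]q : Top [ 1 ]q 0ℤ 0ℤ
Top-[1]q = Top-q½^ 0ℤ

Top-[2+]q : ∀ k → Top [ suc (suc k) ]q (+ (2 * suc k)) 1ℤ
Top-[2+]q k = top λ x ≤x → begin
  coeffᴸ [ suc (suc k) ]q x
    ≡⟨ cong (λ p → coeffᴸ p x) ([]q-suc (suc k)) ⟩
  coeffᴸ ([ suc k ]q ++ q½^ (+ (2 * suc k))) x
    ≡⟨ coeffᴸ-++ [ suc k ]q _ x ⟩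
  coeffᴸ [ suc k ]q x +ᶻ coeffᴸ (q½^ (+ (2 * suc k))) x
    ≡⟨ cong₂ _+ᶻ_ (trans (cong (λ p → coeffᴸ p x) ([]q-suc k)) (coeffᴸ-++ [ k ]q _ x))
      (coeffᴸ-q½^ (+ (2 * suc k)) x) ⟩
  coeffᴸ [ k ]q x +ᶻ coeffᴸ (q½^ (+ (2 * k))) x +ᶻ mono 1ℤ (+ (2 * suc k)) x
    ≡⟨ cong₂ (λ y z → y +ᶻ z +ᶻ mono 1ℤ (+ (2 * suc k)) x)
         ([]q-above k (subst (ℤ._≤ x) 2k≡ ≤x))
         (trans (coeffᴸ-q½^ (+ (2 * k)) x) (cong (λ j → mono 1ℤ j x) (sym 2k≡))) ⟩
  0ℤ +ᶻ mono 1ℤ (+ (2 * suc k) ℤ.- + 2) x +ᶻ mono 1ℤ (+ (2 * suc k)) x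
    ≡⟨ trans (cong (_+ᶻ mono 1ℤ (+ (2 * suc k)) x) (ℤₚ.+-identityˡ (mono 1ℤ (+ (2 * suc k) ℤ.- + 2) x)))
           (ℤₚ.+-comm (mono 1ℤ (+ (2 * suc k) ℤ.- + 2) x) (mono 1ℤ (+ (2 * suc k)) x)) ⟩
  mono 1ℤ (+ (2 * suc k)) x +ᶻ mono 1ℤ (+ (2 * suc k) ℤ.- + 2) x ∎
  where
  open ≡-Reasoning
  cancel : ∀ y → y +ᶻ + 2 ℤ.- + 2 ≡ y
  cancel = solve-∀
  2k≡ : + (2 * suc k) ℤ.- + 2 ≡ + (2 * k)
  2k≡ = trans (cong (ℤ._- + 2) (+2*suc k)) (cancel (+ (2 * k)))

-- Exponents count half powers of q, hence k (k - 1) for the degree k (k - 1) / 2. Each of the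
-- factors [2], ..., [k] adds 1 to the second coefficient and [1] adds 0; truncation gives the
-- correct value 0 also for the empty product.
Top-[]q! : ∀ k → Top [ k ]q! (+ (k * (k ∸ 1))) (+ (k ∸ 1))
Top-[]q! zero          = Top-q½^ 0ℤ
Top-[]q! (suc zero)    = Top-* (Top-q½^ 0ℤ) Top-[1]q
Top-[]q! (suc (suc k)) = subst₂ (Top [ suc (suc k) ]q!) (cong +_ (degree k)) (cong +_ (ℕₚ.+-comm k 1))
  (Top-* (Top-[]q! (suc k)) (Top-[2+]q k))
  where
  degree : ∀ k → suc k * k + 2 * suc k ≡ suc (suc k) * suc k
  degree = ℕ-Solver.solve-∀

⟦⟧-even : ∀ p k → coeffᴸ ⟦ p ⟧ (+ (2 * k)) ≡ coeff p k
⟦⟧-even [] k = refl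
⟦⟧-even (c ∷ p) zero = trans (coeffᴸ-∷ c 0ℤ (q *ᴸ ⟦ p ⟧) 0ℤ) (trans (cong (c +ᶻ_)
  (trans (coeffᴸ-q½^* (+ 2) ⟦ p ⟧ 0ℤ) (⟦⟧-negative p 1))) (ℤₚ.+-identityʳ c))
  where
  ⟦⟧-negative : ∀ p k → coeffᴸ ⟦ p ⟧ -[1+ k ] ≡ 0ℤ
  ⟦⟧-negative [] k = refl
  ⟦⟧-negative (c ∷ p) k = trans (coeffᴸ-∷ c 0ℤ (q *ᴸ ⟦ p ⟧) -[1+ k ])
    (trans (ℤₚ.+-identityˡ _) (trans (coeffᴸ-q½^* (+ 2) ⟦ p ⟧ -[1+ k ]) (⟦⟧-negative p (suc (k + 1)))))
⟦⟧-even (c ∷ p) (suc k) = trans (coeffᴸ-∷ c 0ℤ (q *ᴸ ⟦ p ⟧) (+ (2 * suc k)))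
  (trans (cong (_+ᶻ coeffᴸ (q *ᴸ ⟦ p ⟧) (+ (2 * suc k))) (mono-off c {0ℤ} {+ (2 * suc k)} λ ()))
  (trans (ℤₚ.+-identityˡ _) (trans (coeffᴸ-q½^* (+ 2) ⟦ p ⟧ _)
  (trans (cong (coeffᴸ ⟦ p ⟧) (trans (cong (ℤ._- + 2) (+2*suc k)) (cancel (+ (2 * k)))))
    (⟦⟧-even p k)))))
  where
  cancel : ∀ y → y +ᶻ + 2 ℤ.- + 2 ≡ y
  cancel = solve-∀

⟦⟧-support : ∀ p x → coeffᴸ ⟦ p ⟧ x ≢ 0ℤ → ∃[ k ] x ≡ + (2 * k)
⟦⟧-support [] x ≢0 = contradiction refl ≢0
⟦⟧-support (c ∷ p) x ≢0 with 0ℤ ℤₚ.≟ x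
... | yes eq = 0 , sym eq
... | no _ with ⟦⟧-support p (x ℤ.- + 2) (λ eq → ≢0 (trans (coeffᴸ-q½^* (+ 2) ⟦ p ⟧ x) eq))
...   | k , eq = suc k , trans (sym (cancel x)) (trans (cong (_+ᶻ + 2) eq) (sym (+2*suc k)))
  where
  cancel : ∀ y → y ℤ.- + 2 +ᶻ + 2 ≡ y
  cancel = solve-∀

-- Coefficients of elements of the free module

module _ {n : ℕ} where

  ≈ₚ-sym : ∀ {v w : 𝔖 n} → v ≈ₚ w → w ≈ₚ v
  ≈ₚ-sym v≈w k = sym (v≈w k)

  ≈ₚ-trans : ∀ {u v w : 𝔖 n} → u ≈ₚ v → v ≈ₚ w → u ≈ₚ w
  ≈ₚ-trans u≈v v≈w k = trans (u≈v k) (v≈w k)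

  ⟨_⟩ : 𝓗 n → 𝔖 n → ℤ → ℤ
  ⟨ x ⟩ v k = coeffᴸ (coeffᵀ x v) k

  coeffᵀ-∷-≈ : ∀ {u v : 𝔖 n} → u ≈ₚ v → ∀ a x → coeffᵀ ((a , u) ∷ x) v ≡ a ++ coeffᵀ x v
  coeffᵀ-∷-≈ {u} {v} u≈v a x =
    cong (λ b → (if b then a else []) ++ coeffᵀ x v) (dec-true (u ≟ₚ v) u≈v)

  coeffᵀ-∷-≉ : ∀ {u v : 𝔖 n} → ¬ (u ≈ₚ v) → ∀ a x → coeffᵀ ((a , u) ∷ x) v ≡ coeffᵀ x v
  coeffᵀ-∷-≉ {u} {v} u≉v a x =
    cong (λ b → (if b then a else []) ++ coeffᵀ x v) (dec-false (u ≟ₚ v) u≉v)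

  ⟨⟩-∷-≈ : ∀ {u v} → u ≈ₚ v → ∀ a x k → ⟨ (a , u) ∷ x ⟩ v k ≡ coeffᴸ a k +ᶻ ⟨ x ⟩ v k
  ⟨⟩-∷-≈ {u} {v} u≈v a x k =
    trans (cong (λ p → coeffᴸ p k) (coeffᵀ-∷-≈ {u} {v} u≈v a x)) (coeffᴸ-++ a (coeffᵀ x v) k)

  ⟨⟩-∷-≉ : ∀ {u v} → ¬ (u ≈ₚ v) → ∀ a x k → ⟨ (a , u) ∷ x ⟩ v k ≡ ⟨ x ⟩ v k
  ⟨⟩-∷-≉ {u} {v} u≉v a x k = cong (λ p → coeffᴸ p k) (coeffᵀ-∷-≉ {u} {v} u≉v a x)

  coeffᵀ-++ : ∀ (x y : 𝓗 n) v → coeffᵀ (x ++ y) v ≡ coeffᵀ x v ++ coeffᵀ y v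
  coeffᵀ-++ x y v = Listₚ.concatMap-++ _ x y

  ⟨⟩-++ : ∀ x y v k → ⟨ x ++ y ⟩ v k ≡ ⟨ x ⟩ v k +ᶻ ⟨ y ⟩ v k
  ⟨⟩-++ x y v k = trans (cong (λ p → coeffᴸ p k) (coeffᵀ-++ x y v)) (coeffᴸ-++ (coeffᵀ x v) _ k)

  act-++ʳ : ∀ a p r k → act a (coeffᴸ (p ++ r)) k ≡ act a (coeffᴸ p) k +ᶻ act a (coeffᴸ r) k
  act-++ʳ a p r k = trans (act-cong a (coeffᴸ-++ p r) k) (act-+ a (coeffᴸ p) (coeffᴸ r) k)

  ⟨⟩-· : ∀ a x v k → ⟨ a · x ⟩ v k ≡ act a (⟨ x ⟩ v) k
  ⟨⟩-· a [] v k = sym (act-zero a k)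
  ⟨⟩-· a ((b , u) ∷ x) v k = go (u ≟ₚ v)
    where
    go : Dec (u ≈ₚ v) → ⟨ a · ((b , u) ∷ x) ⟩ v k ≡ act a (⟨ (b , u) ∷ x ⟩ v) k
    go (yes u≈v) = trans (⟨⟩-∷-≈ {u} {v} u≈v (a *ᴸ b) (a · x) k)
      (trans (cong₂ _+ᶻ_ (coeffᴸ-* a b k) (⟨⟩-· a x v k))
      (trans (sym (act-+ a (coeffᴸ b) (⟨ x ⟩ v) k))
      (act-cong a (λ j → sym (⟨⟩-∷-≈ {u} {v} u≈v b x j)) k)))
    go (no u≉v) = trans (⟨⟩-∷-≉ {u} {v} u≉v (a *ᴸ b) (a · x) k)
      (trans (⟨⟩-· a x v k) (act-cong a (λ j → sym (⟨⟩-∷-≉ {u} {v} u≉v b x j)) k))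

  ⟨⟩-q½· : ∀ j x v k → ⟨ q½^ j · x ⟩ v k ≡ ⟨ x ⟩ v (k ℤ.- j)
  ⟨⟩-q½· j x v k = trans (⟨⟩-· (q½^ j) x v k) (trans (ℤₚ.+-identityʳ _) (ℤₚ.*-identityˡ _))

  ⟨⟩-neg : ∀ x v k → ⟨ - x ⟩ v k ≡ ℤ.- ⟨ x ⟩ v k
  ⟨⟩-neg [] v k = refl
  ⟨⟩-neg ((a , u) ∷ x) v k = go (u ≟ₚ v)
    where
    go : Dec (u ≈ₚ v) → ⟨ - ((a , u) ∷ x) ⟩ v k ≡ ℤ.- ⟨ (a , u) ∷ x ⟩ v k
    go (yes u≈v) = trans (⟨⟩-∷-≈ {u} {v} u≈v (-ᴸ a) (- x) k)
      (trans (cong₂ _+ᶻ_ (coeffᴸ-neg a k) (⟨⟩-neg x v k))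
      (sym (trans (cong ℤ.-_ (⟨⟩-∷-≈ {u} {v} u≈v a x k)) (ℤₚ.neg-distrib-+ (coeffᴸ a k) _))))
    go (no u≉v) = trans (⟨⟩-∷-≉ {u} {v} u≉v (-ᴸ a) (- x) k)
      (trans (⟨⟩-neg x v k) (cong ℤ.-_ (sym (⟨⟩-∷-≉ {u} {v} u≉v a x k))))

  ⟨⟩-cong : ∀ x {v w} → v ≈ₚ w → ∀ k → ⟨ x ⟩ v k ≡ ⟨ x ⟩ w k
  ⟨⟩-cong [] v≈w k = refl
  ⟨⟩-cong ((a , u) ∷ x) {v} {w} v≈w k = go (u ≟ₚ v)
    where
    go : Dec (u ≈ₚ v) → ⟨ (a , u) ∷ x ⟩ v k ≡ ⟨ (a , u) ∷ x ⟩ w k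
    go (yes u≈v) = trans (⟨⟩-∷-≈ {u} {v} u≈v a x k)
      (trans (cong (coeffᴸ a k +ᶻ_) (⟨⟩-cong x {v} {w} v≈w k))
      (sym (⟨⟩-∷-≈ {u} {w} (≈ₚ-trans {u} {v} {w} u≈v v≈w) a x k)))
    go (no u≉v)  = trans (⟨⟩-∷-≉ {u} {v} u≉v a x k) (trans (⟨⟩-cong x {v} {w} v≈w k)
      (sym (⟨⟩-∷-≉ {u} {w} (λ u≈w → u≉v (≈ₚ-trans {u} {w} {v} u≈w (≈ₚ-sym {v} {w} v≈w))) a x k)))

  ⟨T⟩-≈ : ∀ {u v : 𝔖 n} → u ≈ₚ v → ∀ k → ⟨ T u ⟩ v k ≡ mono 1ℤ 0ℤ k
  ⟨T⟩-≈ {u} {v} u≈v k = trans (⟨⟩-∷-≈ {u} {v} u≈v 1ᴸ [] k) (trans (ℤₚ.+-identityʳ _) (coeffᴸ-q½^ 0ℤ k))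

  ⟨T⟩-≉ : ∀ {u v : 𝔖 n} → ¬ (u ≈ₚ v) → ∀ k → ⟨ T u ⟩ v k ≡ 0ℤ
  ⟨T⟩-≉ {u} {v} u≉v k = ⟨⟩-∷-≉ {u} {v} u≉v 1ᴸ [] k

  ⟨T⟩-cong : ∀ {u u′ v v′ : 𝔖 n} → (u ≈ₚ v → u′ ≈ₚ v′) → (u′ ≈ₚ v′ → u ≈ₚ v) → ∀ k →
    ⟨ T u ⟩ v k ≡ ⟨ T u′ ⟩ v′ k
  ⟨T⟩-cong {u} {u′} {v} {v′} f g k = go (u ≟ₚ v)
    where
    go : Dec (u ≈ₚ v) → ⟨ T u ⟩ v k ≡ ⟨ T u′ ⟩ v′ k
    go (yes u≈v) = trans (⟨T⟩-≈ {u} {v} u≈v k) (sym (⟨T⟩-≈ {u′} {v′} (f u≈v) k))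
    go (no u≉v)  = trans (⟨T⟩-≉ {u} {v} u≉v k) (sym (⟨T⟩-≉ {u′} {v′} (u≉v ∘ g) k))

  T-cong : ∀ {u v : 𝔖 n} → u ≈ₚ v → T u ≈ T v
  T-cong {u} {v} u≈v w = ⟨T⟩-cong {u} {v} {w} {w}
    (≈ₚ-trans {v} {u} {w} (≈ₚ-sym {u} {v} u≈v)) (≈ₚ-trans {u} {v} {w} u≈v)

  ·T : ∀ a (u : 𝔖 n) → (a , u) ∷ [] ≈ a · T u
  ·T a u v k = go (u ≟ₚ v)
    where
    go : Dec (u ≈ₚ v) → ⟨ (a , u) ∷ [] ⟩ v k ≡ ⟨ (a *ᴸ 1ᴸ , u) ∷ [] ⟩ v k
    go (yes u≈v) = trans (⟨⟩-∷-≈ {u} {v} u≈v a [] k) (trans (cong (_+ᶻ 0ℤ) (sym (coeffᴸ-*1 a k)))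
      (sym (⟨⟩-∷-≈ {u} {v} u≈v (a *ᴸ 1ᴸ) [] k)))
    go (no u≉v)  = trans (⟨⟩-∷-≉ {u} {v} u≉v a [] k) (sym (⟨⟩-∷-≉ {u} {v} u≉v (a *ᴸ 1ᴸ) [] k))

  ≈-trans : ∀ {x y z : 𝓗 n} → x ≈ y → y ≈ z → x ≈ z
  ≈-trans x≈y y≈z v k = trans (x≈y v k) (y≈z v k)

  ≈-sym : ∀ {x y : 𝓗 n} → x ≈ y → y ≈ x
  ≈-sym x≈y v k = sym (x≈y v k)

  ++-cong : ∀ {x x′ y y′ : 𝓗 n} → x ≈ x′ → y ≈ y′ → x ++ y ≈ x′ ++ y′
  ++-cong {x} {x′} {y} {y′} x≈ y≈ v k = trans (⟨⟩-++ x y v k)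
    (trans (cong₂ _+ᶻ_ (x≈ v k) (y≈ v k)) (sym (⟨⟩-++ x′ y′ v k)))

  ·-cong : ∀ a {x y : 𝓗 n} → x ≈ y → a · x ≈ a · y
  ·-cong a {x} {y} x≈y v k = trans (⟨⟩-· a x v k)
    (trans (act-cong a (x≈y v) k) (sym (⟨⟩-· a y v k)))

  -- Functionals Σ a T_v ↦ Σ φ v a

  record Additive (φ : 𝔖 n → Laurent → ℤ) : Set where
    field
      φ-cong : ∀ {u v} → u ≈ₚ v → ∀ a → φ u a ≡ φ v a
      φ-++   : ∀ u a b → φ u (a ++ b) ≡ φ u a +ᶻ φ u b
      φ-zero : ∀ u {a} → a ≈ᴸ [] → φ u a ≡ 0ℤ
      φ-neg  : ∀ u a → φ u (-ᴸ a) ≡ ℤ.- φ u a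

  Φ : (𝔖 n → Laurent → ℤ) → 𝓗 n → ℤ
  Φ φ = List.foldr (λ (a , u) s → φ u a +ᶻ s) 0ℤ

  Φ-++ : ∀ φ x y → Φ φ (x ++ y) ≡ Φ φ x +ᶻ Φ φ y
  Φ-++ φ [] y = sym (ℤₚ.+-identityˡ _)
  Φ-++ φ ((a , u) ∷ x) y = trans (cong (φ u a +ᶻ_) (Φ-++ φ x y)) (sym (ℤₚ.+-assoc (φ u a) _ _))

  infixl 6 _∖_
  _∖_ : 𝓗 n → 𝔖 n → 𝓗 n
  x ∖ v = filter (λ (_ , u) → ¬? (u ≟ₚ v)) x

  length-∖ : ∀ x v → length (x ∖ v) ≤ length x
  length-∖ x v = Listₚ.length-filter (λ (_ , u) → ¬? (u ≟ₚ v)) x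

  ∖-accept : ∀ {a u v} x → ¬ (u ≈ₚ v) → ((a , u) ∷ x) ∖ v ≡ (a , u) ∷ (x ∖ v)
  ∖-accept {v = v} x = Listₚ.filter-accept (λ (_ , u) → ¬? (u ≟ₚ v))

  ∖-reject : ∀ {a u v} x → u ≈ₚ v → ((a , u) ∷ x) ∖ v ≡ x ∖ v
  ∖-reject {v = v} x u≈v = Listₚ.filter-reject (λ (_ , u) → ¬? (u ≟ₚ v)) (λ u≉v → u≉v u≈v)

  coeffᵀ-∖-≈ : ∀ x {v w} → v ≈ₚ w → coeffᵀ (x ∖ v) w ≡ []
  coeffᵀ-∖-≈ [] v≈w = refl
  coeffᵀ-∖-≈ ((a , u) ∷ x) {v} {w} v≈w = go (u ≟ₚ v)
    where
    go : Dec (u ≈ₚ v) → coeffᵀ (((a , u) ∷ x) ∖ v) w ≡ []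
    go (yes u≈v) = trans (cong (λ y → coeffᵀ y w) (∖-reject {a} {u} {v} x u≈v))
      (coeffᵀ-∖-≈ x {v} {w} v≈w)
    go (no u≉v)  = trans (cong (λ y → coeffᵀ y w) (∖-accept {a} {u} {v} x u≉v))
      (trans (coeffᵀ-∷-≉ {u} {w} (λ u≈w → u≉v (≈ₚ-trans {u} {w} {v} u≈w (≈ₚ-sym {v} {w} v≈w))) a (x ∖ v))
      (coeffᵀ-∖-≈ x {v} {w} v≈w))

  coeffᵀ-∖-≉ : ∀ x {v w} → ¬ (v ≈ₚ w) → coeffᵀ (x ∖ v) w ≡ coeffᵀ x w
  coeffᵀ-∖-≉ [] v≉w = refl
  coeffᵀ-∖-≉ ((a , u) ∷ x) {v} {w} v≉w = go (u ≟ₚ v)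
    where
    go : Dec (u ≈ₚ v) → coeffᵀ (((a , u) ∷ x) ∖ v) w ≡ coeffᵀ ((a , u) ∷ x) w
    go (yes u≈v) = trans (cong (λ y → coeffᵀ y w) (∖-reject {a} {u} {v} x u≈v))
      (trans (coeffᵀ-∖-≉ x {v} {w} v≉w)
      (sym (coeffᵀ-∷-≉ {u} {w} (λ u≈w → v≉w (≈ₚ-trans {v} {u} {w} (≈ₚ-sym {u} {v} u≈v) u≈w)) a x)))
    go (no u≉v)  = trans (cong (λ y → coeffᵀ y w) (∖-accept {a} {u} {v} x u≉v))
      (cong ((if does (u ≟ₚ w) then a else []) ++_) (coeffᵀ-∖-≉ x {v} {w} v≉w))

  module Functional {φ : 𝔖 n → Laurent → ℤ} (additive : Additive φ) where
    open Additive additive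

    -- A list may mention one basis element several times, under different representatives.
    -- Collecting all of these terms at once replaces them by the total coefficient, which is the
    -- only part with a meaning in the module.
    Φ-split : ∀ x v → Φ φ x ≡ φ v (coeffᵀ x v) +ᶻ Φ φ (x ∖ v)
    Φ-split [] v = sym (trans (ℤₚ.+-identityʳ _) (φ-zero v {[]} λ _ → refl))
    Φ-split ((a , u) ∷ x) v = go (u ≟ₚ v)
      where
      swap : ∀ x y z → x +ᶻ (y +ᶻ z) ≡ y +ᶻ (x +ᶻ z)
      swap = solve-∀
      go : Dec (u ≈ₚ v) → φ u a +ᶻ Φ φ x ≡ φ v (coeffᵀ ((a , u) ∷ x) v) +ᶻ Φ φ (((a , u) ∷ x) ∖ v)
      go (yes u≈v) = trans (cong₂ _+ᶻ_ (φ-cong {u} {v} u≈v a) (Φ-split x v))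
        (trans (sym (ℤₚ.+-assoc (φ v a) _ _)) (cong₂ _+ᶻ_
          (trans (sym (φ-++ v a _)) (cong (φ v) (sym (coeffᵀ-∷-≈ {u} {v} u≈v a x))))
          (cong (Φ φ) (sym (∖-reject {a} {u} {v} x u≈v)))))
      go (no u≉v) = trans (cong (φ u a +ᶻ_) (Φ-split x v))
        (trans (swap (φ u a) (φ v (coeffᵀ x v)) (Φ φ (x ∖ v)))
        (cong₂ _+ᶻ_ (cong (φ v) (sym (coeffᵀ-∷-≉ {u} {v} u≉v a x)))
          (cong (Φ φ) (sym (∖-accept {a} {u} {v} x u≉v)))))

    -- Recursion on the length of the list: deleting the class of the first term shortens it and
    -- leaves the coefficients at all other classes unchanged.
    Φ-closed : (Q : ℤ → Set) → Q 0ℤ → (∀ {i j} → Q i → Q j → Q (i +ᶻ j)) →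
      ∀ x → (∀ v → Q (φ v (coeffᵀ x v))) → Q (Φ φ x)
    Φ-closed Q Q0 Q+ x = go (length x) x ℕₚ.≤-refl
      where
      go : ∀ N x → length x ≤ N → (∀ v → Q (φ v (coeffᵀ x v))) → Q (Φ φ x)
      go N [] _ Qx = Q0
      go (suc N) x@((a , v) ∷ xs) (s≤s len≤) Qx =
        subst Q (sym (Φ-split x v)) (Q+ (Qx v) (go N (x ∖ v) len′ Qx∖))
        where
        len′ : length (x ∖ v) ≤ N
        len′ = subst (λ y → length y ≤ N) (sym (∖-reject {a} {v} {v} xs (λ _ → refl)))
          (ℕₚ.≤-trans (length-∖ xs v) len≤)
        Qx∖ : ∀ w → Q (φ w (coeffᵀ (x ∖ v) w))
        Qx∖ w with v ≟ₚ w
        ... | yes v≈w = subst Q (sym (φ-zero w {coeffᵀ (x ∖ v) w}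
                          (λ k → cong (λ p → coeffᴸ p k) (coeffᵀ-∖-≈ x {v} {w} v≈w)))) Q0
        ... | no v≉w  = subst (λ p → Q (φ w p)) (sym (coeffᵀ-∖-≉ x {v} {w} v≉w)) (Qx w)

    Φ-vanish : ∀ x → (∀ v → φ v (coeffᵀ x v) ≡ 0ℤ) → Φ φ x ≡ 0ℤ
    Φ-vanish = Φ-closed (_≡ 0ℤ) refl (λ { refl refl → refl })

    Φ-neg : ∀ x → Φ φ (- x) ≡ ℤ.- Φ φ x
    Φ-neg [] = refl
    Φ-neg ((a , u) ∷ x) = trans (cong₂ _+ᶻ_ (φ-neg u a) (Φ-neg x)) (sym (ℤₚ.neg-distrib-+ (φ u a) _))

    -- All coefficients of x - y vanish, so the functional vanishes on x - y. In this way
    -- functionals written as recursions on lists become well defined on the module.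
    Φ-cong : ∀ {x y} → x ≈ y → Φ φ x ≡ Φ φ y
    Φ-cong {x} {y} x≈y = ℤₚ.i-j≡0⇒i≡j _ _ (trans (cong (Φ φ x +ᶻ_) (sym (Φ-neg y)))
      (trans (sym (Φ-++ φ x (- y))) (Φ-vanish (x ++ - y) (λ v → φ-zero v {coeffᵀ (x ++ - y) v} (λ k →
        trans (⟨⟩-++ x (- y) v k) (trans (cong₂ _+ᶻ_ (x≈y v k) (⟨⟩-neg y v k))
          (ℤₚ.+-inverseʳ (⟨ y ⟩ v k))))))))

    ∑ᴸ : 𝓗 n → List (𝔖 n) → ℤ
    ∑ᴸ x = List.foldr (λ v s → φ v (coeffᵀ x v) +ᶻ s) 0ℤ

    ∑ᴸ-∖ : ∀ x v L → All (λ w → ¬ (v ≈ₚ w)) L → ∑ᴸ (x ∖ v) L ≡ ∑ᴸ x L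
    ∑ᴸ-∖ x v [] [] = refl
    ∑ᴸ-∖ x v (w ∷ L) (v≉w ∷ v≉L) =
      cong₂ (λ p s → φ w p +ᶻ s) (coeffᵀ-∖-≉ x {v} {w} v≉w) (∑ᴸ-∖ x v L v≉L)

    -- Q is a submonoid of ℤ containing the contributions from outside L.
    Φ-list : (Q : ℤ → Set) → Q 0ℤ → (∀ {i j} → Q i → Q j → Q (i +ᶻ j)) →
      ∀ L → AllPairs (λ v w → ¬ (v ≈ₚ w)) L → ∀ x →
      (∀ v → All (λ w → ¬ (w ≈ₚ v)) L → Q (φ v (coeffᵀ x v))) →
      ∃[ r ] (Q r × Φ φ x ≡ ∑ᴸ x L +ᶻ r)
    Φ-list Q Q0 Q+ [] [] x Qx = Φ φ x , Φ-closed Q Q0 Q+ x (λ v → Qx v []) , sym (ℤₚ.+-identityˡ _)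
    Φ-list Q Q0 Q+ (w ∷ L) (w≉L ∷ distinct) x Qx with Φ-list Q Q0 Q+ L distinct (x ∖ w) Qx∖
      where
      Qx∖ : ∀ v → All (λ w → ¬ (w ≈ₚ v)) L → Q (φ v (coeffᵀ (x ∖ w) v))
      Qx∖ v v∉L with w ≟ₚ v
      ... | yes w≈v = subst Q (sym (φ-zero v {coeffᵀ (x ∖ w) v}
                        (λ k → cong (λ p → coeffᴸ p k) (coeffᵀ-∖-≈ x {w} {v} w≈v)))) Q0
      ... | no w≉v  = subst (λ p → Q (φ v p)) (sym (coeffᵀ-∖-≉ x {w} {v} w≉v)) (Qx v (w≉v ∷ v∉L))
    ... | r , Qr , eq = r , Qr , trans (Φ-split x w) (trans (cong (φ w (coeffᵀ x w) +ᶻ_)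
      (trans eq (cong (_+ᶻ r) (∑ᴸ-∖ x w L w≉L)))) (sym (ℤₚ.+-assoc (φ w (coeffᵀ x w)) _ r)))

    Φ-supported : ∀ L → AllPairs (λ v w → ¬ (v ≈ₚ w)) L → ∀ x →
      (∀ v → All (λ w → ¬ (w ≈ₚ v)) L → φ v (coeffᵀ x v) ≡ 0ℤ) → Φ φ x ≡ ∑ᴸ x L
    Φ-supported L distinct x x≡0 with Φ-list (_≡ 0ℤ) refl (λ { refl refl → refl }) L distinct x x≡0
    ... | .0ℤ , refl , eq = trans eq (ℤₚ.+-identityʳ _)

    Φ-nonneg : ∀ L → AllPairs (λ v w → ¬ (v ≈ₚ w)) L → ∀ x →
      (∀ v → 0ℤ ℤ.≤ φ v (coeffᵀ x v)) → ∑ᴸ x L ℤ.≤ Φ φ x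
    Φ-nonneg L distinct x 0≤x with Φ-list (0ℤ ℤ.≤_) ℤₚ.≤-refl ℤₚ.+-mono-≤ L distinct x (λ v _ → 0≤x v)
    ... | r , 0≤r , eq = subst (∑ᴸ x L ℤ.≤_) (sym eq)
      (subst (ℤ._≤ ∑ᴸ x L +ᶻ r) (ℤₚ.+-identityʳ _) (ℤₚ.+-monoʳ-≤ (∑ᴸ x L) 0≤r))

  act-additive : (G : 𝔖 n → Laurent) → (∀ {u v} → u ≈ₚ v → G u ≈ᴸ G v) → ∀ k →
    Additive (λ u a → act a (coeffᴸ (G u)) k)
  act-additive G G-cong k = record
    { φ-cong = λ {u} {v} u≈v a → act-cong a (G-cong {u} {v} u≈v) k
    ; φ-++   = λ u a b → act-++ a b (coeffᴸ (G u)) k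
    ; φ-zero = λ u {a} a≈0 → act-congˡ {a} {[]} a≈0 (G u) k
    ; φ-neg  = λ u a → act-neg a (coeffᴸ (G u)) k
    }

  -- The ring homomorphism T_w ↦ q^ℓ(w)

  qˡ : 𝔖 n → Laurent
  qˡ u = q½^ (+ (2 * ℓ u))

  qˡ-cong : ∀ {u v : 𝔖 n} → u ≈ₚ v → qˡ u ≈ᴸ qˡ v
  qˡ-cong {u} {v} u≈v k = cong (λ m → coeffᴸ (q½^ (+ (2 * m))) k) (ℓ-cong {v = u} {w = v} u≈v)

  ε : 𝓗 n → Laurent
  ε = concatMap (λ (a , u) → a *ᴸ qˡ u)

  εφ : ℤ → 𝔖 n → Laurent → ℤ
  εφ k u a = act a (coeffᴸ (qˡ u)) k

  εφ-additive : ∀ k → Additive (εφ k)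
  εφ-additive = act-additive qˡ (λ {u} {v} → qˡ-cong {u} {v})

  ε-Φ : ∀ x k → coeffᴸ (ε x) k ≡ Φ (εφ k) x
  ε-Φ [] k = refl
  ε-Φ ((a , u) ∷ x) k = trans (coeffᴸ-++ (a *ᴸ qˡ u) (ε x) k)
    (cong₂ _+ᶻ_ (coeffᴸ-* a (qˡ u) k) (ε-Φ x k))

  εφ-shift : ∀ k u a → εφ k u a ≡ coeffᴸ a (k ℤ.- + (2 * ℓ u))
  εφ-shift k u a = trans (act-cong a (coeffᴸ-q½^ (+ (2 * ℓ u))) k)
    (trans (act-mono a 1ℤ (+ (2 * ℓ u)) k) (ℤₚ.*-identityˡ _))

  ε-cong : ∀ {x y} → x ≈ y → ε x ≈ᴸ ε y
  ε-cong {x} {y} x≈y k = trans (ε-Φ x k)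
    (trans (Functional.Φ-cong (εφ-additive k) {x} {y} x≈y) (sym (ε-Φ y k)))

  ε-++ : ∀ x y k → coeffᴸ (ε (x ++ y)) k ≡ coeffᴸ (ε x) k +ᶻ coeffᴸ (ε y) k
  ε-++ x y k = trans (ε-Φ (x ++ y) k) (trans (Φ-++ (εφ k) x y) (sym (cong₂ _+ᶻ_ (ε-Φ x k) (ε-Φ y k))))

  ε-· : ∀ a x → ε (a · x) ≈ᴸ a *ᴸ ε x
  ε-· a [] k = sym (trans (coeffᴸ-* a [] k) (act-zero a k))
  ε-· a ((b , u) ∷ x) k = trans (coeffᴸ-++ ((a *ᴸ b) *ᴸ qˡ u) (ε (a · x)) k)
    (trans (cong₂ _+ᶻ_ (*ᴸ-assoc a b (qˡ u) k) (ε-· a x k))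
    (sym (trans (coeffᴸ-* a (b *ᴸ qˡ u ++ ε x) k) (trans (act-++ʳ a (b *ᴸ qˡ u) (ε x) k)
      (sym (cong₂ _+ᶻ_ (coeffᴸ-* a (b *ᴸ qˡ u) k) (coeffᴸ-* a (ε x) k)))))))

  ε-T : ∀ u → ε (T u) ≈ᴸ qˡ u
  ε-T u k = trans (coeffᴸ-++ (1ᴸ *ᴸ qˡ u) [] k) (trans (ℤₚ.+-identityʳ _)
    (trans (coeffᴸ-q½^* 0ℤ (qˡ u) k) (cong (coeffᴸ (qˡ u)) (ℤₚ.+-identityʳ k))))

module _ {n : ℕ} where

  ≤ᴮ-respʳ : ∀ {v w w′ : 𝔖 n} → w ≈ₚ w′ → v ≤ᴮ w → v ≤ᴮ w′
  ≤ᴮ-respʳ {v} {w} {w′} w≈w′ (done v≈w)       = done (≈ₚ-trans {n} {v} {w} {w′} v≈w w≈w′)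
  ≤ᴮ-respʳ {v} {w} {w′} w≈w′ (step i j lt v≤w) = step i j lt
    (≤ᴮ-respʳ {v ⊙ transpose i j} {w} {w′} w≈w′ v≤w)

  <ᴮ-respʳ : ∀ {v w w′ : 𝔖 n} → w ≈ₚ w′ → v <ᴮ w → v <ᴮ w′
  <ᴮ-respʳ {v} {w} {w′} w≈w′ (v≤w , v≉w) = ≤ᴮ-respʳ {v} {w} {w′} w≈w′ v≤w
    , λ v≈w′ → v≉w (≈ₚ-trans {n} {v} {w′} {w} v≈w′ (≈ₚ-sym {n} {w} {w′} w≈w′))

  ⟨⟩-∷ : ∀ a (u : 𝔖 n) x v k → ⟨ (a , u) ∷ x ⟩ v k ≡ act a (⟨ T u ⟩ v) k +ᶻ ⟨ x ⟩ v k
  ⟨⟩-∷ a u x v k = trans (⟨⟩-++ ((a , u) ∷ []) x v k)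
    (cong (_+ᶻ ⟨ x ⟩ v k) (trans (·T a u v k) (⟨⟩-· a (T u) v k)))

  ⟨⟩-q-1· : ∀ (x : 𝓗 n) v k → ⟨ q-1 · x ⟩ v k ≡ ⟨ x ⟩ v (k ℤ.- + 2) ℤ.- ⟨ x ⟩ v k
  ⟨⟩-q-1· x v k = trans (⟨⟩-· q-1 x v k)
    (trans (cong (λ j → 1ℤ ℤ.* ⟨ x ⟩ v (k ℤ.- + 2) +ᶻ (ℤ.- 1ℤ ℤ.* ⟨ x ⟩ v j +ᶻ 0ℤ)) (ℤₚ.+-identityʳ k))
    (lemma (⟨ x ⟩ v (k ℤ.- + 2)) (⟨ x ⟩ v k)))
    where
    lemma : ∀ x y → 1ℤ ℤ.* x +ᶻ (ℤ.- 1ℤ ℤ.* y +ᶻ 0ℤ) ≡ x ℤ.- y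
    lemma = solve-∀

  -- Elements spanned by the T_u with u in A

  Span : (𝔖 n → Set) → 𝓗 n → Set
  Span A x = ∃[ y ] (All (A ∘ proj₂) y × x ≈ y)

  Span-cong : ∀ {A x y} → x ≈ y → Span A y → Span A x
  Span-cong {A} {x} {y} x≈y (z , Az , y≈z) = z , Az , ≈-trans {n} {x} {y} {z} x≈y y≈z

  Span-T : ∀ {A : 𝔖 n → Set} {u} → A u → Span A (T u)
  Span-T {u = u} Au = T u , Au ∷ [] , λ _ _ → refl

  Span-++ : ∀ {A x y} → Span A x → Span A y → Span A (x ++ y)
  Span-++ {A} {x} {y} (x′ , Ax′ , x≈x′) (y′ , Ay′ , y≈y′) =
    x′ ++ y′ , Allₚ.++⁺ Ax′ Ay′ , ++-cong {n} {x} {x′} {y} {y′} x≈x′ y≈y′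

  Span-· : ∀ {A} a {x} → Span A x → Span A (a · x)
  Span-· a {x} (y , Ay , x≈y) = a · y , Allₚ.map⁺ Ay , ·-cong a {x} {y} x≈y

  Span-extend : ∀ {A B : 𝔖 n → Set} {M} → (∀ {u} → B u → Span A (M u)) →
    ∀ y → All (B ∘ proj₂) y → Span A (extend M y)
  Span-extend AM []            []        = [] , [] , λ _ _ → refl
  Span-extend {A} {B} {M} AM ((a , u) ∷ y) (Bu ∷ By) =
    Span-++ {A} {a · M u} {extend M y} (Span-· {A} a {M u} (AM Bu)) (Span-extend AM y By)

  module _ {A : 𝔖 n → Set} (A? : Decidable A) (A-resp : ∀ {u v} → u ≈ₚ v → A u → A v) where

    private
      restrict : 𝓗 n → 𝓗 n
      restrict = filter (A? ∘ proj₂)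

    coeffᵀ-restrict-∈ : ∀ x {v} → A v → coeffᵀ (restrict x) v ≡ coeffᵀ x v
    coeffᵀ-restrict-∈ [] Av = refl
    coeffᵀ-restrict-∈ ((a , u) ∷ x) {v} Av = go (A? u)
      where
      go : Dec (A u) → coeffᵀ (restrict ((a , u) ∷ x)) v ≡ coeffᵀ ((a , u) ∷ x) v
      go (yes Au) = trans (cong (λ y → coeffᵀ y v) (Listₚ.filter-accept (A? ∘ proj₂) {a , u} {x} Au))
        (cong ((if does (u ≟ₚ v) then a else []) ++_) (coeffᵀ-restrict-∈ x Av))
      go (no ¬Au) = trans (cong (λ y → coeffᵀ y v) (Listₚ.filter-reject (A? ∘ proj₂) {a , u} {x} ¬Au))
        (trans (coeffᵀ-restrict-∈ x Av)
          (sym (coeffᵀ-∷-≉ {n} {u} {v} (λ u≈v → ¬Au (A-resp {v} {u} (≈ₚ-sym {n} {u} {v} u≈v) Av)) a x)))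

    coeffᵀ-restrict-∉ : ∀ x {v} → ¬ A v → coeffᵀ (restrict x) v ≡ []
    coeffᵀ-restrict-∉ [] ¬Av = refl
    coeffᵀ-restrict-∉ ((a , u) ∷ x) {v} ¬Av = go (A? u)
      where
      go : Dec (A u) → coeffᵀ (restrict ((a , u) ∷ x)) v ≡ []
      go (yes Au) = trans (cong (λ y → coeffᵀ y v) (Listₚ.filter-accept (A? ∘ proj₂) {a , u} {x} Au))
        (trans (coeffᵀ-∷-≉ {n} {u} {v} (λ u≈v → ¬Av (A-resp {u} {v} u≈v Au)) a (restrict x))
          (coeffᵀ-restrict-∉ x ¬Av))
      go (no ¬Au) = trans (cong (λ y → coeffᵀ y v) (Listₚ.filter-reject (A? ∘ proj₂) {a , u} {x} ¬Au))
        (coeffᵀ-restrict-∉ x ¬Av)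

    Span-support : ∀ x → (∀ {v} → ¬ A v → coeffᵀ x v ≈ᴸ []) → Span A x
    Span-support x supp = restrict x , Allₚ.all-filter (A? ∘ proj₂) x , λ v → go v (A? v)
      where
      go : ∀ v → Dec (A v) → ∀ k → ⟨ x ⟩ v k ≡ ⟨ restrict x ⟩ v k
      go v (yes Av) k = cong (λ p → coeffᴸ p k) (sym (coeffᵀ-restrict-∈ x Av))
      go v (no ¬Av) k = trans (supp {v} ¬Av k) (cong (λ p → coeffᴸ p k) (sym (coeffᵀ-restrict-∉ x ¬Av)))

  Span-coeff : ∀ {A : 𝔖 n → Set} x → Span A x → ∀ {w} k → ⟨ x ⟩ w k ≢ 0ℤ → ∃[ u ] (A u × u ≈ₚ w)
  Span-coeff {A} x (y , Ay , x≈y) {w} k ≢0 = go y Ay (λ eq → ≢0 (trans (x≈y w k) eq))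
    where
    go : ∀ y → All (A ∘ proj₂) y → ⟨ y ⟩ w k ≢ 0ℤ → ∃[ u ] (A u × u ≈ₚ w)
    go [] [] ≢0 = contradiction refl ≢0
    go ((a , u) ∷ y) (Au ∷ Ay) ≢0 = case (u ≟ₚ w)
      where
      case : Dec (u ≈ₚ w) → ∃[ u ] (A u × u ≈ₚ w)
      case (yes u≈w) = u , Au , u≈w
      case (no u≉w)  = go y Ay (λ eq → ≢0 (trans (⟨⟩-∷-≉ {n} {u} {w} u≉w a y k) eq))

-- The Hecke algebra

module Hecke {n : ℕ} (H : HeckeAlgebra n) where

  open HeckeAlgebra H
  open IsRing isRing using (*-cong; *-assoc; *-identityˡ; distribˡ; distribʳ; zeroˡ; zeroʳ) public

  expandʳ : ∀ x y → x ∙ y ≈ extend (λ u → x ∙ T u) y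
  expandʳ x [] = zeroʳ x
  expandʳ x ((a , u) ∷ y) =
    ≈-trans {n} {x ∙ ((a , u) ∷ y)} {x ∙ ((a , u) ∷ []) ++ x ∙ y} {extend (λ u → x ∙ T u) ((a , u) ∷ y)}
      (distribˡ x ((a , u) ∷ []) y)
      (++-cong {n} {x ∙ ((a , u) ∷ [])} {a · (x ∙ T u)} {x ∙ y} {extend (λ u → x ∙ T u) y}
        (≈-trans {n} {x ∙ ((a , u) ∷ [])} {x ∙ (a · T u)} {a · (x ∙ T u)}
          (*-cong {x} {x} {(a , u) ∷ []} {a · T u} (λ _ _ → refl) (·T a u)) (·-assocʳ a x (T u)))
        (expandʳ x y))

  expandˡ : ∀ x y → x ∙ y ≈ extend (λ u → T u ∙ y) x
  expandˡ [] y = zeroˡ y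
  expandˡ ((a , u) ∷ x) y =
    ≈-trans {n} {((a , u) ∷ x) ∙ y} {((a , u) ∷ []) ∙ y ++ x ∙ y} {extend (λ u → T u ∙ y) ((a , u) ∷ x)}
      (distribʳ y ((a , u) ∷ []) x)
      (++-cong {n} {((a , u) ∷ []) ∙ y} {a · (T u ∙ y)} {x ∙ y} {extend (λ u → T u ∙ y) x}
        (≈-trans {n} {((a , u) ∷ []) ∙ y} {(a · T u) ∙ y} {a · (T u ∙ y)}
          (*-cong {(a , u) ∷ []} {a · T u} {y} {y} (·T a u) (λ _ _ → refl)) (·-assocˡ a (T u) y))
        (expandˡ x y))

  module _ {i j : Fin n} (adj : Adjacent i j) where

    private
      s = transpose i j

    T-up′ : ∀ {u} → ℓ (s ⊙ u) ≡ suc (ℓ u) → T s ∙ T u ≈ T (s ⊙ u)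
    T-up′ {u} up = T-up i j adj u (<ᴮ-adjacentˡ {n} {i} {j} adj up)

    T-down′ : ∀ {u} → ℓ u ≡ suc (ℓ (s ⊙ u)) → T s ∙ T u ≈ (q-1 · T u) ++ (q · T (s ⊙ u))
    T-down′ {u} down = T-down i j adj u
      (<ᴮ-respʳ {n} {s ⊙ u} {s ⊙ s ⊙ u} {u} (transpose-⊙-involutive i j u)
      (<ᴮ-adjacentˡ {n} {i} {j} adj {s ⊙ u}
        (trans (ℓ-cong {n} {s ⊙ s ⊙ u} {u} (transpose-⊙-involutive i j u)) down)))

    s-adjoint : ∀ {u v} → s ⊙ u ≈ₚ v → u ≈ₚ s ⊙ v
    s-adjoint {u} {v} su≈v = ≈ₚ-trans {n} {u} {s ⊙ s ⊙ u} {s ⊙ v}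
      (≈ₚ-sym {n} {s ⊙ s ⊙ u} {u} (transpose-⊙-involutive i j u)) (⊙-congˡ s {s ⊙ u} {v} su≈v)

    s-adjoint⁻¹ : ∀ {u v} → u ≈ₚ s ⊙ v → s ⊙ u ≈ₚ v
    s-adjoint⁻¹ {u} {v} u≈sv = ≈ₚ-trans {n} {s ⊙ u} {s ⊙ s ⊙ v} {v}
      (⊙-congˡ s {u} {s ⊙ v} u≈sv) (transpose-⊙-involutive i j v)

    up≉down : ∀ {u v} → ℓ (s ⊙ u) ≡ suc (ℓ u) → ℓ v ≡ suc (ℓ (s ⊙ v)) → ¬ (u ≈ₚ v)
    up≉down {u} {v} up down u≈v = ℕₚ.<-irrefl
      (trans (ℓ-cong {n} {u} {v} u≈v) down)
      (ℕₚ.m<n⇒m<1+n (ℕₚ.≤-reflexive (trans (sym up)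
        (ℓ-cong {n} {s ⊙ u} {s ⊙ v} (⊙-congˡ s {u} {v} u≈v)))))

    s-up : ∀ {v} → ℓ v ≡ suc (ℓ (s ⊙ v)) → ℓ (s ⊙ s ⊙ v) ≡ suc (ℓ (s ⊙ v))
    s-up {v} down = trans (ℓ-cong {n} {s ⊙ s ⊙ v} {v} (transpose-⊙-involutive i j v)) down

    s-down : ∀ {v} → ℓ (s ⊙ v) ≡ suc (ℓ v) → ℓ (s ⊙ v) ≡ suc (ℓ (s ⊙ s ⊙ v))
    s-down {v} up = trans up (cong suc (sym (ℓ-cong {n} {s ⊙ s ⊙ v} {v} (transpose-⊙-involutive i j v))))

    -- When sv is below v, T_v arises from u = sv with coefficient 1 and from u = v with coefficient
    -- q - 1 by the quadratic relation. Evaluation at `k - 2` is multiplication by q.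
    ⟨TT⟩-down : ∀ {v} → ℓ v ≡ suc (ℓ (s ⊙ v)) → ∀ u k →
      ⟨ T s ∙ T u ⟩ v k ≡ ⟨ T u ⟩ (s ⊙ v) k +ᶻ (⟨ T u ⟩ v (k ℤ.- + 2) ℤ.- ⟨ T u ⟩ v k)
    ⟨TT⟩-down {v} v↓ u k with adjacent-step {n} {i} {j} adj u
    ... | inj₁ u↑ = trans (T-up′ {u} u↑ v k)
      (trans (⟨T⟩-cong {n} {s ⊙ u} {u} {v} {s ⊙ v} (s-adjoint {u} {v}) (s-adjoint⁻¹ {u} {v}) k)
      (trans (sym (ℤₚ.+-identityʳ _)) (cong (⟨ T u ⟩ (s ⊙ v) k +ᶻ_)
        (sym (cong₂ ℤ._-_ (⟨T⟩-≉ {n} {u} {v} u≉v (k ℤ.- + 2)) (⟨T⟩-≉ {n} {u} {v} u≉v k))))))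
      where u≉v = up≉down {u} {v} u↑ v↓
    ... | inj₂ u↓ = trans (T-down′ {u} u↓ v k) (trans (⟨⟩-++ (q-1 · T u) (q · T (s ⊙ u)) v k)
      (trans (cong₂ _+ᶻ_ (⟨⟩-q-1· (T u) v k) (trans (⟨⟩-q½· (+ 2) (T (s ⊙ u)) v k)
        (⟨T⟩-≉ {n} {s ⊙ u} {v} (up≉down {s ⊙ u} {v} (s-up {u} u↓) v↓) (k ℤ.- + 2))))
      (trans (ℤₚ.+-comm (⟨ T u ⟩ v (k ℤ.- + 2) ℤ.- ⟨ T u ⟩ v k) 0ℤ)
        (cong (_+ᶻ (⟨ T u ⟩ v (k ℤ.- + 2) ℤ.- ⟨ T u ⟩ v k)) (sym (⟨T⟩-≉ {n} {u} {s ⊙ v}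
          (λ u≈sv → up≉down {s ⊙ v} {u} (s-up {v} v↓) u↓ (≈ₚ-sym {n} {u} {s ⊙ v} u≈sv)) k))))))

    -- When sv is above v, T_v arises only from u = sv, through the term q T_{su}.
    ⟨TT⟩-up : ∀ {v} → ℓ (s ⊙ v) ≡ suc (ℓ v) → ∀ u k →
      ⟨ T s ∙ T u ⟩ v k ≡ ⟨ T u ⟩ (s ⊙ v) (k ℤ.- + 2)
    ⟨TT⟩-up {v} v↑ u k with adjacent-step {n} {i} {j} adj u
    ... | inj₁ u↑ = trans (T-up′ {u} u↑ v k)
      (trans (⟨T⟩-≉ {n} {s ⊙ u} {v} (λ su≈v → up≉down {v} {s ⊙ u} v↑ (s-down {u} u↑)
        (≈ₚ-sym {n} {s ⊙ u} {v} su≈v)) k)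
      (sym (⟨T⟩-≉ {n} {u} {s ⊙ v} (up≉down {u} {s ⊙ v} u↑ (s-down {v} v↑)) (k ℤ.- + 2))))
    ... | inj₂ u↓ = trans (T-down′ {u} u↓ v k) (trans (⟨⟩-++ (q-1 · T u) (q · T (s ⊙ u)) v k)
      (trans (cong₂ _+ᶻ_
        (trans (⟨⟩-q-1· (T u) v k) (cong₂ ℤ._-_ (⟨T⟩-≉ {n} {u} {v} u≉v (k ℤ.- + 2))
          (⟨T⟩-≉ {n} {u} {v} u≉v k)))
        (trans (⟨⟩-q½· (+ 2) (T (s ⊙ u)) v k)
          (⟨T⟩-cong {n} {s ⊙ u} {u} {v} {s ⊙ v} (s-adjoint {u} {v}) (s-adjoint⁻¹ {u} {v}) (k ℤ.- + 2))))
      (ℤₚ.+-identityˡ _)))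
      where
      u≉v : ¬ (u ≈ₚ v)
      u≉v u≈v = up≉down {v} {u} v↑ u↓ (≈ₚ-sym {n} {u} {v} u≈v)

    ⟨T∙⟩-down : ∀ {v} → ℓ v ≡ suc (ℓ (s ⊙ v)) → ∀ y k →
      ⟨ T s ∙ y ⟩ v k ≡ ⟨ y ⟩ (s ⊙ v) k +ᶻ (⟨ y ⟩ v (k ℤ.- + 2) ℤ.- ⟨ y ⟩ v k)
    ⟨T∙⟩-down {v} v↓ y k = trans (expandʳ (T s) y v k) (go y)
      where
      rearrange : ∀ x y z x′ y′ z′ → x +ᶻ (y ℤ.- z) +ᶻ (x′ +ᶻ (y′ ℤ.- z′)) ≡ x +ᶻ x′ +ᶻ
        (y +ᶻ y′ ℤ.- (z +ᶻ z′))
      rearrange = solve-∀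
      go : ∀ y → ⟨ extend (λ u → T s ∙ T u) y ⟩ v k ≡ ⟨ y ⟩ (s ⊙ v) k +ᶻ
        (⟨ y ⟩ v (k ℤ.- + 2) ℤ.- ⟨ y ⟩ v k)
      go [] = refl
      go ((a , u) ∷ y) = begin
        ⟨ a · (T s ∙ T u) ++ extend (λ u → T s ∙ T u) y ⟩ v k
          ≡⟨ ⟨⟩-++ (a · (T s ∙ T u)) _ v k ⟩
        ⟨ a · (T s ∙ T u) ⟩ v k +ᶻ ⟨ extend (λ u → T s ∙ T u) y ⟩ v k
          ≡⟨ cong₂ _+ᶻ_ (trans (⟨⟩-· a (T s ∙ T u) v k) (act-cong a (⟨TT⟩-down {v} v↓ u) k)) (go y) ⟩
        act a (λ k → A k +ᶻ (B (k ℤ.- + 2) ℤ.- B k)) k +ᶻ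
          (⟨ y ⟩ (s ⊙ v) k +ᶻ (⟨ y ⟩ v (k ℤ.- + 2) ℤ.- ⟨ y ⟩ v k))
          ≡⟨ cong (_+ᶻ (⟨ y ⟩ (s ⊙ v) k +ᶻ (⟨ y ⟩ v (k ℤ.- + 2) ℤ.- ⟨ y ⟩ v k)))
               (trans (act-+ a A (λ k → B (k ℤ.- + 2) ℤ.- B k) k)
               (cong (act a A k +ᶻ_) (trans (act-+ a (λ k → B (k ℤ.- + 2)) (λ k → ℤ.- B k) k)
                 (cong₂ _+ᶻ_ (act-translate a B k) (act-negʳ a B k))))) ⟩
        act a A k +ᶻ (act a B (k ℤ.- + 2) ℤ.- act a B k) +ᶻ
          (⟨ y ⟩ (s ⊙ v) k +ᶻ (⟨ y ⟩ v (k ℤ.- + 2) ℤ.- ⟨ y ⟩ v k))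
          ≡⟨ rearrange (act a A k) (act a B (k ℤ.- + 2)) (act a B k) (⟨ y ⟩ (s ⊙ v) k)
            (⟨ y ⟩ v (k ℤ.- + 2)) (⟨ y ⟩ v k) ⟩
        act a A k +ᶻ ⟨ y ⟩ (s ⊙ v) k +ᶻ (act a B (k ℤ.- + 2) +ᶻ ⟨ y ⟩ v (k ℤ.- + 2) ℤ.-
          (act a B k +ᶻ ⟨ y ⟩ v k))
          ≡⟨ cong₂ _+ᶻ_ (⟨⟩-∷ a u y (s ⊙ v) k)
            (cong₂ ℤ._-_ (⟨⟩-∷ a u y v (k ℤ.- + 2)) (⟨⟩-∷ a u y v k)) ⟨
        ⟨ (a , u) ∷ y ⟩ (s ⊙ v) k +ᶻ (⟨ (a , u) ∷ y ⟩ v (k ℤ.- + 2) ℤ.- ⟨ (a , u) ∷ y ⟩ v k) ∎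
        where
        open ≡-Reasoning
        A = ⟨ T u ⟩ (s ⊙ v)
        B = ⟨ T u ⟩ v

    ⟨T∙⟩-up : ∀ {v} → ℓ (s ⊙ v) ≡ suc (ℓ v) → ∀ y k →
      ⟨ T s ∙ y ⟩ v k ≡ ⟨ y ⟩ (s ⊙ v) (k ℤ.- + 2)
    ⟨T∙⟩-up {v} v↑ y k = trans (expandʳ (T s) y v k) (go y)
      where
      go : ∀ y → ⟨ extend (λ u → T s ∙ T u) y ⟩ v k ≡ ⟨ y ⟩ (s ⊙ v) (k ℤ.- + 2)
      go [] = refl
      go ((a , u) ∷ y) = trans (⟨⟩-++ (a · (T s ∙ T u)) _ v k)
        (trans (cong₂ _+ᶻ_
          (trans (⟨⟩-· a (T s ∙ T u) v k) (trans (act-cong a (⟨TT⟩-up {v} v↑ u) k)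
            (act-translate a (⟨ T u ⟩ (s ⊙ v)) k)))
          (go y))
        (sym (⟨⟩-∷ a u y (s ⊙ v) (k ℤ.- + 2))))

    Span-T∙T : ∀ {A : 𝔖 n → Set} {u} → A u → A (s ⊙ u) → Span A (T s ∙ T u)
    Span-T∙T {A} {u} Au Asu with adjacent-step {n} {i} {j} adj u
    ... | inj₁ u↑ = Span-cong {n} {A} {T s ∙ T u} {T (s ⊙ u)} (T-up′ {u} u↑) (Span-T Asu)
    ... | inj₂ u↓ = Span-cong {n} {A} {T s ∙ T u} {q-1 · T u ++ q · T (s ⊙ u)} (T-down′ {u} u↓)
      (Span-++ {n} {A} {q-1 · T u} {q · T (s ⊙ u)} (Span-· q-1 {T u} (Span-T Au))
        (Span-· q {T (s ⊙ u)} (Span-T Asu)))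

    -- If su is below u, the quadratic relation gives (q - 1) q^ℓ(u) + q q^(ℓ(u)-1) = q q^ℓ(u), the
    -- same value as in the other case. This makes `ε` multiplicative.
    ε-T∙T : ∀ u → ε (T s ∙ T u) ≈ᴸ q *ᴸ qˡ u
    ε-T∙T u k with adjacent-step {n} {i} {j} adj u
    ... | inj₁ u↑ = trans (ε-cong {n} {T s ∙ T u} {T (s ⊙ u)} (T-up′ {u} u↑) k)
      (trans (ε-T (s ⊙ u) k) (cong (λ m → coeffᴸ (q½^ m) k)
        (trans (cong (λ m → + (2 * m)) u↑) (trans (+2*suc (ℓ u)) (ℤₚ.+-comm (+ (2 * ℓ u)) (+ 2))))))
    ... | inj₂ u↓ = begin
      coeffᴸ (ε (T s ∙ T u)) k
        ≡⟨ ε-cong {n} {T s ∙ T u} {q-1 · T u ++ q · T (s ⊙ u)} (T-down′ {u} u↓) k ⟩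
      coeffᴸ (ε (q-1 · T u ++ q · T (s ⊙ u))) k
        ≡⟨ ε-++ (q-1 · T u) (q · T (s ⊙ u)) k ⟩
      coeffᴸ (ε (q-1 · T u)) k +ᶻ coeffᴸ (ε (q · T (s ⊙ u))) k
        ≡⟨ cong₂ _+ᶻ_ (trans (ε-· q-1 (T u) k)
          (trans (*ᴸ-cong {q-1} {q-1} {ε (T u)} {qˡ u} (λ _ → refl) (ε-T u) k) (coeffᴸ-* q-1 (qˡ u) k)))
             (trans (ε-· q (T (s ⊙ u)) k) (trans
               (*ᴸ-cong {q} {q} {ε (T (s ⊙ u))} {qˡ (s ⊙ u)} (λ _ → refl) (ε-T (s ⊙ u)) k)
                (trans (coeffᴸ-q½^* (+ 2) (qˡ (s ⊙ u)) k) shift))) ⟩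
      act q-1 (coeffᴸ (qˡ u)) k +ᶻ coeffᴸ (qˡ u) k
        ≡⟨ trans (cong (λ j → (1ℤ ℤ.* coeffᴸ (qˡ u) (k ℤ.- + 2) +ᶻ
          (ℤ.- 1ℤ ℤ.* coeffᴸ (qˡ u) j +ᶻ 0ℤ)) +ᶻ coeffᴸ (qˡ u) k) (ℤₚ.+-identityʳ k))
             (cancel (coeffᴸ (qˡ u) (k ℤ.- + 2)) (coeffᴸ (qˡ u) k)) ⟩
      coeffᴸ (qˡ u) (k ℤ.- + 2)
        ≡⟨ coeffᴸ-q½^* (+ 2) (qˡ u) k ⟨
      coeffᴸ (q *ᴸ qˡ u) k ∎
      where
      open ≡-Reasoning
      cancel : ∀ x y → (1ℤ ℤ.* x +ᶻ (ℤ.- 1ℤ ℤ.* y +ᶻ 0ℤ)) +ᶻ y ≡ x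
      cancel = solve-∀
      shift : coeffᴸ (qˡ (s ⊙ u)) (k ℤ.- + 2) ≡ coeffᴸ (qˡ u) k
      shift = trans (sym (coeffᴸ-q½^* (+ 2) (qˡ (s ⊙ u)) k)) (cong (λ m → coeffᴸ (q½^ m) k)
        (trans (ℤₚ.+-comm (+ 2) (+ (2 * ℓ (s ⊙ u))))
          (trans (sym (+2*suc (ℓ (s ⊙ u)))) (cong (λ m → + (2 * m)) (sym u↓)))))

    ε-Ts∙ : ∀ y → ε (T s ∙ y) ≈ᴸ q *ᴸ ε y
    ε-Ts∙ y k = trans (ε-cong {n} {T s ∙ y} {extend M y} (expandʳ (T s) y) k)
      (trans (go y) (sym (coeffᴸ-q½^* (+ 2) (ε y) k)))
      where
      M : 𝔖 n → 𝓗 n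
      M u = T s ∙ T u
      go : ∀ y → coeffᴸ (ε (extend M y)) k ≡ coeffᴸ (ε y) (k ℤ.- + 2)
      go [] = refl
      go ((a , u) ∷ y) = trans (ε-++ (a · M u) (extend M y) k) (trans (cong₂ _+ᶻ_
        (trans (ε-· a (M u) k) (trans (*ᴸ-cong {a} {a} {ε (M u)} {q *ᴸ qˡ u} (λ _ → refl) (ε-T∙T u) k)
          (trans (sym (*ᴸ-assoc a q (qˡ u) k))
            (trans (*ᴸ-cong {a *ᴸ q} {q *ᴸ a} {qˡ u} {qˡ u} (*ᴸ-comm a q) (λ _ → refl) k)
          (trans (*ᴸ-assoc q a (qˡ u) k) (coeffᴸ-q½^* (+ 2) (a *ᴸ qˡ u) k))))))
        (go y)) (sym (coeffᴸ-++ (a *ᴸ qˡ u) (ε y) (k ℤ.- + 2))))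

  T-factor : ∀ {u i j} → (adj : Adjacent i j) → ℓ u ≡ suc (ℓ (transpose i j ⊙ u)) →
    T u ≈ T (transpose i j) ∙ T (transpose i j ⊙ u)
  T-factor {u} {i} {j} adj u↓ = ≈-sym {n} {T s ∙ T (s ⊙ u)} {T u}
    (≈-trans {n} {T s ∙ T (s ⊙ u)} {T (s ⊙ s ⊙ u)} {T u}
      (T-up′ {i} {j} adj {s ⊙ u} (s-up {i} {j} adj {u} u↓))
      (T-cong {n} {s ⊙ s ⊙ u} {u} (transpose-⊙-involutive i j u)))
    where s = transpose i j

  T-factor-∙ : ∀ {u i j} → (adj : Adjacent i j) → ℓ u ≡ suc (ℓ (transpose i j ⊙ u)) → ∀ y →
    T u ∙ y ≈ T (transpose i j) ∙ (T (transpose i j ⊙ u) ∙ y)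
  T-factor-∙ {u} {i} {j} adj u↓ y = ≈-trans {n} {T u ∙ y} {(T s ∙ T (s ⊙ u)) ∙ y} {T s ∙ (T (s ⊙ u) ∙ y)}
    (*-cong {T u} {T s ∙ T (s ⊙ u)} {y} {y} (T-factor {u} {i} {j} adj u↓) (λ _ _ → refl))
      (*-assoc (T s) (T (s ⊙ u)) y)
    where s = transpose i j

  T-e-∙ : ∀ {u} → u ≈ₚ e → ∀ y → T u ∙ y ≈ y
  T-e-∙ {u} u≈e y = ≈-trans {n} {T u ∙ y} {T e ∙ y} {y}
    (*-cong {T u} {T e} {y} {y} (T-cong {n} {u} {e} u≈e) (λ _ _ → refl)) (*-identityˡ y)

  descent-length : ∀ {u i j} → Adjacent i j → (u ⟨$⟩ˡ j) Fin.< (u ⟨$⟩ˡ i) → ℓ u ≡ suc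
    (ℓ (transpose i j ⊙ u))
  descent-length {u} {i} {j} adj lt = ℓ-adjacentˡ-down {n} {i} {j} adj u lt

  ε-T∙ : ∀ N u → ℓ u ≡ N → ∀ y → ε (T u ∙ y) ≈ᴸ qˡ u *ᴸ ε y
  ε-T∙ N u ℓu≡N y with e-or-descent u
  ε-T∙ N u ℓu≡N y | inj₁ u≈e = λ k → trans (ε-cong {n} {T u ∙ y} {y} (T-e-∙ {u} u≈e y) k)
    (sym (trans (*ᴸ-cong {qˡ u} {1ᴸ} {ε y} {ε y} (λ k → cong (λ m → coeffᴸ (q½^ (+ (2 * m))) k)
      (trans (ℓ-cong {n} {u} {e} u≈e) (ℓ-e {n}))) (λ _ → refl) k)
      (trans (coeffᴸ-q½^* 0ℤ (ε y) k) (cong (coeffᴸ (ε y)) (ℤₚ.+-identityʳ k)))))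
  ε-T∙ zero u ℓu≡N y | inj₂ (i , j , adj , lt) = contradiction
    (trans (sym (descent-length {u} {i} {j} adj lt)) ℓu≡N) λ ()
  ε-T∙ (suc N) u ℓu≡N y | inj₂ (i , j , adj , lt) = λ k →
    trans (ε-cong {n} {T u ∙ y} {T s ∙ (T (s ⊙ u) ∙ y)} (T-factor-∙ {u} {i} {j} adj u↓ y) k)
    (trans (ε-Ts∙ {i} {j} adj (T (s ⊙ u) ∙ y) k)
    (trans (*ᴸ-cong {q} {q} {ε (T (s ⊙ u) ∙ y)} {qˡ (s ⊙ u) *ᴸ ε y} (λ _ → refl)
      (ε-T∙ N (s ⊙ u) (ℕₚ.suc-injective (trans (sym u↓) ℓu≡N)) y) k)
    (trans (sym (*ᴸ-assoc q (qˡ (s ⊙ u)) (ε y) k))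
    (cong (λ m → coeffᴸ (q½^ m *ᴸ ε y) k)
      (trans (ℤₚ.+-comm (+ 2) (+ (2 * ℓ (s ⊙ u))))
        (trans (sym (+2*suc (ℓ (s ⊙ u)))) (cong (λ m → + (2 * m)) (sym u↓))))))))
    where
    s = transpose i j
    u↓ = descent-length {u} {i} {j} adj lt

  ε-∙ : ∀ x y → ε (x ∙ y) ≈ᴸ ε x *ᴸ ε y
  ε-∙ x y k = trans (ε-cong {n} {x ∙ y} {extend (λ u → T u ∙ y) x} (expandˡ x y) k) (go x)
    where
    go : ∀ x → coeffᴸ (ε (extend (λ u → T u ∙ y) x)) k ≡ coeffᴸ (ε x *ᴸ ε y) k
    go [] = refl
    go ((a , u) ∷ x) = trans (ε-++ (a · (T u ∙ y)) (extend (λ u → T u ∙ y) x) k) (trans (cong₂ _+ᶻ_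
      (trans (ε-· a (T u ∙ y) k) (trans (*ᴸ-cong {a} {a} {ε (T u ∙ y)} {qˡ u *ᴸ ε y} (λ _ → refl)
        (ε-T∙ (ℓ u) u refl y) k)
        (trans (sym (*ᴸ-assoc a (qˡ u) (ε y) k)) (coeffᴸ-* (a *ᴸ qˡ u) (ε y) k))))
      (trans (go x) (coeffᴸ-* (ε x) (ε y) k)))
      (sym (trans (coeffᴸ-* (a *ᴸ qˡ u ++ ε x) (ε y) k) (act-++ (a *ᴸ qˡ u) (ε x) (coeffᴸ (ε y)) k))))

  Coset : Interval n → (𝔖 n → Set) → 𝔖 n → Set
  Coset I B x = ∃[ u ] ∃[ v ] (Within I u × B v × x ≈ₚ u ⊙ v)

  Span-T∙ : ∀ {A : 𝔖 n → Set} {B : 𝔖 n → Set} x → (∀ {u} → B u → Span A (x ∙ T u)) →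
    ∀ y → Span B y → Span A (x ∙ y)
  Span-T∙ {A} {B} x AxB y (y′ , By′ , y≈y′) = Span-cong {n} {A} {x ∙ y} {extend (λ u → x ∙ T u) y′}
    (≈-trans {n} {x ∙ y} {x ∙ y′} {extend (λ u → x ∙ T u) y′}
      (*-cong {x} {x} {y} {y′} (λ _ _ → refl) y≈y′) (expandʳ x y′))
    (Span-extend {n} {A} {B} {λ u → x ∙ T u} AxB y′ By′)

  -- Only supports are followed, so possible cancellation is harmless. T_s T_x is supported on x and
  -- sx, and left multiplication by an s of the parabolic subgroup preserves `Coset I B`.
  Span-within-T∙ : ∀ I {B : 𝔖 n → Set} N u → ℓ u ≡ N → Within I u → ∀ {y} → Span B y → Span
    (Coset I B) (T u ∙ y)
  Span-within-T∙ I {B} N u ℓu≡N u∈ {y} By with e-or-descent u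
  Span-within-T∙ I {B} N u ℓu≡N u∈ {y} (y′ , By′ , y≈y′) | inj₁ u≈e =
    y′ , All.map (λ {(_ , v)} Bv → e , v , (λ _ _ → refl) , Bv , (λ _ → refl)) By′ ,
    ≈-trans {n} {T u ∙ y} {y} {y′} (T-e-∙ {u} u≈e y) y≈y′
  Span-within-T∙ I zero u ℓu≡N u∈ By | inj₂ (i , j , adj , lt) =
    contradiction (trans (sym (descent-length {u} {i} {j} adj lt)) ℓu≡N) λ ()
  Span-within-T∙ I {B} (suc N) u ℓu≡N u∈ {y} By | inj₂ (i , j , adj , lt) =
    Span-cong {n} {Coset I B} {T u ∙ y} {T s ∙ (T (s ⊙ u) ∙ y)} (T-factor-∙ {u} {i} {j} adj u↓ y)
      (Span-T∙ {Coset I B} {Coset I B} (T s)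
        (λ {x} Cx → Span-T∙T {i} {j} adj {Coset I B} {x} Cx (shift x Cx))
        (T (s ⊙ u) ∙ y)
        (Span-within-T∙ I {B} N (s ⊙ u) (ℕₚ.suc-injective (trans (sym u↓) ℓu≡N))
          (within-⊙ I s u s∈ u∈) {y} By))
    where
    s = transpose i j
    u↓ = descent-length {u} {i} {j} adj lt
    ij∈ = within-descent I u u∈ {i} {j} adj lt
    s∈ : Within I s
    s∈ = within-transpose I (proj₁ ij∈) (proj₂ ij∈)
    shift : ∀ x → Coset I B x → Coset I B (s ⊙ x)
    shift x (u , v , u∈ , Bv , x≈uv) = s ⊙ u , v , within-⊙ I s u s∈ u∈ , Bv , ⊙-congˡ s {x} {u ⊙ v} x≈uv

  Span-∙ : ∀ I {B : 𝔖 n → Set} x y → Span (Within I) x → Span B y → Span (Coset I B) (x ∙ y)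
  Span-∙ I {B} x y (x′ , x′∈ , x≈x′) By = Span-cong {n} {Coset I B} {x ∙ y} {extend (λ u → T u ∙ y) x′}
    (≈-trans {n} {x ∙ y} {x′ ∙ y} {extend (λ u → T u ∙ y) x′}
      (*-cong {x} {x′} {y} {y} x≈x′ (λ _ _ → refl)) (expandˡ x′ y))
    (Span-extend {n} {Coset I B} {Within I} {λ u → T u ∙ y}
      (λ {u} u∈ → Span-within-T∙ I {B} (ℓ u) u refl u∈ {y} By) x′ x′∈)

-- An equation of integers is stable under double negation, so it may be proved by cases on a
-- proposition without a decision procedure. It is applied to the inductively generated relation
-- `_≤ᴮ_`.
stable-cases : ∀ {p} {P : Set p} {x y : ℤ} → (P → x ≡ y) → (¬ P → x ≡ y) → x ≡ y
stable-cases {x = x} {y} f g = decidable-stable (x ℤₚ.≟ y) (λ x≢y → x≢y (g (x≢y ∘ f)))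

-- The bar involution to first order

module Bar {n : ℕ} {H : HeckeAlgebra n} (B : BarInvolution H) where

  open HeckeAlgebra H
  open Hecke H
  open BarInvolution B
  open RingMorphisms rawRing rawRing using (module IsRingHomomorphism)
  open IsRingHomomorphism isRingHom using (⟦⟧-cong; +-homo; *-homo; 1#-homo; 0#-homo)

  module _ {i j : Fin n} (adj : Adjacent i j) where

    private
      s = transpose i j

    T∙bar : ∀ y → T s ∙ (bar (T s) ∙ y) ≈ y
    T∙bar y = ≈-trans {n} {T s ∙ (bar (T s) ∙ y)} {(T s ∙ bar (T s)) ∙ y} {y}
      (≈-sym {n} {(T s ∙ bar (T s)) ∙ y} {T s ∙ (bar (T s) ∙ y)} (*-assoc (T s) (bar (T s)) y))
      (≈-trans {n} {(T s ∙ bar (T s)) ∙ y} {T e ∙ y} {y}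
        (*-cong {T s ∙ bar (T s)} {T e} {y} {y}
          (≈-trans {n} {T s ∙ bar (T s)} {T (s ⁻¹) ∙ bar (T s)} {T e}
            (*-cong {T s} {T (s ⁻¹)} {bar (T s)} {bar (T s)}
              (T-cong {n} {s} {s ⁻¹} (transpose-sym i j)) (λ _ _ → refl))
            (bar-T-inverseʳ s))
          (λ _ _ → refl))
        (*-identityˡ y))

    -- No explicit inverse of T_s is written down. The element z = `bar (T s) ∙ y` satisfies T_s z =
    -- y, and the known coefficients of T_s z are solved for those of z, first where sv is below v
    -- and then where it is above.
    ⟨bar∙⟩-down : ∀ {v} → ℓ v ≡ suc (ℓ (s ⊙ v)) → ∀ y k →
      ⟨ bar (T s) ∙ y ⟩ v k ≡ ⟨ y ⟩ (s ⊙ v) (k +ᶻ + 2)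
    ⟨bar∙⟩-down {v} v↓ y k = sym (trans (sym (T∙bar y (s ⊙ v) (k +ᶻ + 2)))
      (trans (⟨T∙⟩-up {i} {j} adj {s ⊙ v} (s-up {i} {j} adj {v} v↓) (bar (T s) ∙ y) (k +ᶻ + 2))
      (trans (⟨⟩-cong (bar (T s) ∙ y) {s ⊙ s ⊙ v} {v} (transpose-⊙-involutive i j v) (k +ᶻ + 2 ℤ.- + 2))
        (cong (⟨ bar (T s) ∙ y ⟩ v) (lemma k)))))
      where
      lemma : ∀ k → k +ᶻ + 2 ℤ.- + 2 ≡ k
      lemma = solve-∀

    ⟨bar∙⟩-up : ∀ {v} → ℓ (s ⊙ v) ≡ suc (ℓ v) → ∀ y k →
      ⟨ bar (T s) ∙ y ⟩ v k ≡ ⟨ y ⟩ (s ⊙ v) k ℤ.- ⟨ y ⟩ v k +ᶻ ⟨ y ⟩ v (k +ᶻ + 2)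
    ⟨bar∙⟩-up {v} v↑ y k = trans (solve₁ (Z v k) (Z (s ⊙ v) (k ℤ.- + 2)) (Z (s ⊙ v) k))
      (cong₂ (λ x y → x ℤ.- proj₁ y +ᶻ proj₂ y) {x = Z v k +ᶻ (Z (s ⊙ v) (k ℤ.- + 2) ℤ.- Z (s ⊙ v) k)}
        {v = ⟨ y ⟩ v k , ⟨ y ⟩ v (k +ᶻ + 2)}
        (sym (trans (sym (T∙bar y (s ⊙ v) k))
          (trans (⟨T∙⟩-down {i} {j} adj {s ⊙ v} (s-down {i} {j} adj {v} v↑) (bar (T s) ∙ y) k)
          (cong (_+ᶻ (Z (s ⊙ v) (k ℤ.- + 2) ℤ.- Z (s ⊙ v) k))
            (⟨⟩-cong (bar (T s) ∙ y) {s ⊙ s ⊙ v} {v} (transpose-⊙-involutive i j v) k)))))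
        (cong₂ _,_
          (trans (Zsv (k ℤ.- + 2)) (cong (⟨ y ⟩ v) (lemma k)))
          (Zsv k)))
      where
      Z = ⟨ bar (T s) ∙ y ⟩
      Zsv : ∀ k → Z (s ⊙ v) k ≡ ⟨ y ⟩ v (k +ᶻ + 2)
      Zsv k = trans (⟨bar∙⟩-down {s ⊙ v} (s-down {i} {j} adj {v} v↑) y k)
        (⟨⟩-cong y {s ⊙ s ⊙ v} {v} (transpose-⊙-involutive i j v) (k +ᶻ + 2))
      lemma : ∀ k → k ℤ.- + 2 +ᶻ + 2 ≡ k
      lemma = solve-∀
      solve₁ : ∀ x y z → x ≡ x +ᶻ (y ℤ.- z) ℤ.- y +ᶻ z
      solve₁ = solve-∀

  -- These are the R-polynomials of Kazhdan and Lusztig with q replaced by its inverse, times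
  -- q^-ℓ(v).
  R : 𝔖 n → 𝔖 n → ℤ → ℤ
  R v w = ⟨ bar (T w) ⟩ v

  bar-T-cong : ∀ {u v} → u ≈ₚ v → bar (T u) ≈ bar (T v)
  bar-T-cong {u} {v} u≈v = ⟦⟧-cong {T u} {T v} (T-cong {n} {u} {v} u≈v)

  -- The coefficients of q^-ℓ(w) (1 - q).
  d : 𝔖 n → ℤ → ℤ
  d w k = mono 1ℤ (ℤ.- + (2 * ℓ w)) k ℤ.- mono 1ℤ (ℤ.- + (2 * ℓ w)) (k ℤ.- + 2)

  -- Exactly what is needed to compare coefficients of bar C̃_w at an element one shorter than `w`.
  -- `R-coatom` leaves open which alternative occurs; in the second one the transposition identifies
  -- a cover, which is what an upper bound calls for.
  record LeadingTerms (w : 𝔖 n) : Set where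
    field
      R-above  : ∀ {v} → ℓ w ≤ ℓ v → ¬ (v ≈ₚ w) → ∀ k → R v w k ≡ 0ℤ
      R-diag   : ∀ {v} → v ≈ₚ w → ∀ k → R v w k ≡ mono 1ℤ (ℤ.- + (2 * ℓ w)) k
      R-coatom : ∀ {v} → suc (ℓ v) ≡ ℓ w → (∀ k → R v w k ≡ 0ℤ) ⊎
        ((∀ k → R v w k ≡ d w k) × ∃[ i ] ∃[ j ] (v ≈ₚ w ⊙ transpose i j))

  open LeadingTerms

  bar-T-e : ∀ {w} → w ≈ₚ e → bar (T w) ≈ T e
  bar-T-e {w} w≈e = ≈-trans {n} {bar (T w)} {bar (T e)} {T e} (bar-T-cong {w} {e} w≈e) 1#-homo

  leading-e : ∀ {w} → w ≈ₚ e → LeadingTerms w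
  leading-e {w} w≈e = record
    { R-above  = λ {v} _ v≉w k → trans (bar-T-e {w} w≈e v k) (⟨T⟩-≉ {n} {e} {v}
        (λ e≈v → v≉w (≈ₚ-trans {n} {v} {e} {w} (≈ₚ-sym {n} {e} {v} e≈v) (≈ₚ-sym {n} {w} {e} w≈e))) k)
    ; R-diag   = λ {v} v≈w k → trans (bar-T-e {w} w≈e v k) (trans (⟨T⟩-≈ {n} {e} {v}
        (≈ₚ-sym {n} {v} {e} (≈ₚ-trans {n} {v} {w} {e} v≈w w≈e)) k)
        (cong (λ m → mono 1ℤ (ℤ.- + (2 * m)) k) (sym ℓw≡0)))
    ; R-coatom = λ {v} eq → contradiction (trans eq ℓw≡0) λ ()
    }
    where
    ℓw≡0 : ℓ w ≡ 0
    ℓw≡0 = trans (ℓ-cong {n} {w} {e} w≈e) (ℓ-e {n})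

  mono-shift : ∀ m k → mono 1ℤ (ℤ.- + (2 * m)) (k +ᶻ + 2) ≡ mono 1ℤ (ℤ.- + (2 * suc m)) k
  mono-shift m k = mono-⇔ 1ℤ {ℤ.- + (2 * m)} {k +ᶻ + 2} {ℤ.- + (2 * suc m)} {k}
    (λ eq → trans (cong ℤ.-_ (+2*suc m)) (trans (to (+ (2 * m))) (trans (cong (ℤ._- + 2) eq) (from k))))
    (λ eq → trans (to′ (+ (2 * m))) (cong (_+ᶻ + 2) (trans (cong ℤ.-_ (sym (+2*suc m))) eq)))
    where
    to : ∀ x → ℤ.- (x +ᶻ + 2) ≡ ℤ.- x ℤ.- + 2
    to = solve-∀
    from : ∀ k → k +ᶻ + 2 ℤ.- + 2 ≡ k
    from = solve-∀
    to′ : ∀ x → ℤ.- x ≡ ℤ.- (x +ᶻ + 2) +ᶻ + 2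
    to′ = solve-∀

  module Step {w : 𝔖 n} {i j : Fin n} (adj : Adjacent i j)
              (w↓ : ℓ w ≡ suc (ℓ (transpose i j ⊙ w))) where

    s = transpose i j
    u = s ⊙ w

    bar-T-factor : bar (T w) ≈ bar (T s) ∙ bar (T u)
    bar-T-factor = ≈-trans {n} {bar (T w)} {bar (T s ∙ T u)} {bar (T s) ∙ bar (T u)}
      (⟦⟧-cong {T w} {T s ∙ T u} (T-factor {w} {i} {j} adj w↓)) (*-homo (T s) (T u))

    R-down : ∀ {v} → ℓ v ≡ suc (ℓ (s ⊙ v)) → ∀ k → R v w k ≡ R (s ⊙ v) u (k +ᶻ + 2)
    R-down {v} v↓ k = trans (bar-T-factor v k) (⟨bar∙⟩-down {i} {j} adj {v} v↓ (bar (T u)) k)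

    R-up : ∀ {v} → ℓ (s ⊙ v) ≡ suc (ℓ v) → ∀ k → R v w k ≡ R (s ⊙ v) u k ℤ.- R v u k +ᶻ R v u (k +ᶻ + 2)
    R-up {v} v↑ k = trans (bar-T-factor v k) (⟨bar∙⟩-up {i} {j} adj {v} v↑ (bar (T u)) k)

    sw≈ : ∀ {v} → s ⊙ v ≈ₚ u → v ≈ₚ w
    sw≈ {v} sv≈u = ≈ₚ-trans {n} {v} {s ⊙ u} {w} (s-adjoint {i} {j} adj {v} {u} sv≈u)
      (transpose-⊙-involutive i j w)

    <⇒≉ : ∀ {x y : 𝔖 n} → ℓ x < ℓ y → ¬ (y ≈ₚ x)
    <⇒≉ {x} {y} lt y≈x = ℕₚ.<-irrefl (sym (ℓ-cong {n} {y} {x} y≈x)) lt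

    d-shift : ∀ k → d u (k +ᶻ + 2) ≡ d w k
    d-shift k = cong₂ ℤ._-_ (trans (mono-shift (ℓ u) k)
      (cong (λ m → mono 1ℤ (ℤ.- + (2 * m)) k) (sym w↓)))
      (trans (cong (mono 1ℤ (ℤ.- + (2 * ℓ u))) (lemma k)) (trans (mono-shift (ℓ u) (k ℤ.- + 2))
        (cong (λ m → mono 1ℤ (ℤ.- + (2 * m)) (k ℤ.- + 2)) (sym w↓))))
      where
      lemma : ∀ k → k +ᶻ + 2 ℤ.- + 2 ≡ k ℤ.- + 2 +ᶻ + 2
      lemma = solve-∀

    R-coatom-u : LeadingTerms u → ∀ {v} → v ≈ₚ u → ∀ k → R v w k ≡ d w k
    R-coatom-u lead {v} v≈u k = begin
      R v w k
        ≡⟨ R-up {v} v↑ k ⟩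
      R (s ⊙ v) u k ℤ.- R v u k +ᶻ R v u (k +ᶻ + 2)
        ≡⟨ cong₂ (λ x y → x ℤ.- R v u k +ᶻ y)
          (R-above lead {s ⊙ v} (ℕₚ.<⇒≤ u<sv) (<⇒≉ {u} {s ⊙ v} u<sv) k)
             (trans (R-diag lead {v} v≈u (k +ᶻ + 2))
               (trans (mono-shift (ℓ u) k) (cong (λ m → mono 1ℤ (ℤ.- + (2 * m)) k) (sym w↓)))) ⟩
      0ℤ ℤ.- R v u k +ᶻ mono 1ℤ (ℤ.- + (2 * ℓ w)) k
        ≡⟨ cong (λ x → 0ℤ ℤ.- x +ᶻ mono 1ℤ (ℤ.- + (2 * ℓ w)) k) (trans (R-diag lead {v} v≈u k)
             (trans (cong (mono 1ℤ (ℤ.- + (2 * ℓ u))) (sym (e₁ k))) (trans (mono-shift (ℓ u) (k ℤ.- + 2))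
               (cong (λ m → mono 1ℤ (ℤ.- + (2 * m)) (k ℤ.- + 2)) (sym w↓))))) ⟩
      0ℤ ℤ.- mono 1ℤ (ℤ.- + (2 * ℓ w)) (k ℤ.- + 2) +ᶻ mono 1ℤ (ℤ.- + (2 * ℓ w)) k
        ≡⟨ e₂ (mono 1ℤ (ℤ.- + (2 * ℓ w)) (k ℤ.- + 2)) (mono 1ℤ (ℤ.- + (2 * ℓ w)) k) ⟩
      d w k ∎
      where
      open ≡-Reasoning
      e₁ : ∀ k → k ℤ.- + 2 +ᶻ + 2 ≡ k
      e₁ = solve-∀
      e₂ : ∀ x y → 0ℤ ℤ.- x +ᶻ y ≡ y ℤ.- x
      e₂ = solve-∀
      v↑ : ℓ (s ⊙ v) ≡ suc (ℓ v)
      v↑ = trans (ℓ-cong {n} {s ⊙ v} {s ⊙ u} (⊙-congˡ s {v} {u} v≈u))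
        (trans (s-up {i} {j} adj {w} w↓) (cong suc (sym (ℓ-cong {n} {v} {u} v≈u))))
      u<sv : ℓ u < ℓ (s ⊙ v)
      u<sv = ℕₚ.≤-reflexive (trans (cong suc (sym (ℓ-cong {n} {v} {u} v≈u))) (sym v↑))

    leading : LeadingTerms u → LeadingTerms w
    leading lead = record
      { R-above = λ {v} → above {v} ; R-diag = λ {v} → diag {v} ; R-coatom = λ {v} → coatom {v} }
      where
      above : ∀ {v} → ℓ w ≤ ℓ v → ¬ (v ≈ₚ w) → ∀ k → R v w k ≡ 0ℤ
      above {v} w≤v v≉w k with adjacent-step {n} {i} {j} adj v
      ... | inj₂ v↓ = trans (R-down {v} v↓ k) (R-above lead {s ⊙ v}
        (ℕₚ.≤-pred (subst₂ _≤_ w↓ v↓ w≤v)) (v≉w ∘ sw≈ {v}) (k +ᶻ + 2))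
      ... | inj₁ v↑ = trans (R-up {v} v↑ k) (cong₂ (λ x y → x ℤ.- proj₁ y +ᶻ proj₂ y)
        (R-above lead {s ⊙ v} (ℕₚ.<⇒≤ u<sv) (<⇒≉ {u} {s ⊙ v} u<sv) k)
        (cong₂ _,_ (R-above lead {v} (ℕₚ.<⇒≤ u<v) (<⇒≉ {u} {v} u<v) k)
                   (R-above lead {v} (ℕₚ.<⇒≤ u<v) (<⇒≉ {u} {v} u<v) (k +ᶻ + 2))))
        where
        u<v : ℓ u < ℓ v
        u<v = subst (_≤ ℓ v) w↓ w≤v
        u<sv : ℓ u < ℓ (s ⊙ v)
        u<sv = subst (ℓ u <_) (sym v↑) (ℕₚ.m<n⇒m<1+n u<v)
      diag : ∀ {v} → v ≈ₚ w → ∀ k → R v w k ≡ mono 1ℤ (ℤ.- + (2 * ℓ w)) k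
      diag {v} v≈w k = trans (R-down {v} v↓ k)
        (trans (R-diag lead {s ⊙ v} (⊙-congˡ s {v} {w} v≈w) (k +ᶻ + 2))
        (trans (mono-shift (ℓ u) k) (cong (λ m → mono 1ℤ (ℤ.- + (2 * m)) k) (sym w↓))))
        where
        v↓ : ℓ v ≡ suc (ℓ (s ⊙ v))
        v↓ = trans (ℓ-cong {n} {v} {w} v≈w)
          (trans w↓ (cong suc (sym (ℓ-cong {n} {s ⊙ v} {u} (⊙-congˡ s {v} {w} v≈w)))))
      coatom : ∀ {v} → suc (ℓ v) ≡ ℓ w → (∀ k → R v w k ≡ 0ℤ) ⊎
        ((∀ k → R v w k ≡ d w k) × ∃[ i ] ∃[ j ] (v ≈ₚ w ⊙ transpose i j))
      coatom {v} eq with adjacent-step {n} {i} {j} adj v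
      ... | inj₂ v↓ with R-coatom lead {s ⊙ v} (trans (sym v↓) (ℕₚ.suc-injective (trans eq w↓)))
      ...   | inj₁ R≡0 = inj₁ (λ k → trans (R-down {v} v↓ k) (R≡0 (k +ᶻ + 2)))
      ...   | inj₂ (R≡d , a , b , sv≈ut) = inj₂
            ((λ k → trans (R-down {v} v↓ k) (trans (R≡d (k +ᶻ + 2)) (d-shift k)))
              , a , b , ≈ₚ-trans {n} {v} {s ⊙ (u ⊙ transpose a b)} {w ⊙ transpose a b}
                  (s-adjoint {i} {j} adj {v} {u ⊙ transpose a b} sv≈ut)
                  (λ k → transpose-⊙-involutive i j w (transpose a b ⟨$⟩ʳ k)))
      -- Here `v` has the same length as `u`, so all three terms of `R-up` vanish unless `v` is
      -- `u = s ⊙ w` itself.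
      coatom {v} eq | inj₁ v↑ with v ≟ₚ u
      ... | yes v≈u = inj₂ (R-coatom-u lead {v} v≈u , w ⟨$⟩ˡ i , w ⟨$⟩ˡ j
              , ≈ₚ-trans {n} {v} {u} {w ⊙ transpose (w ⟨$⟩ˡ i) (w ⟨$⟩ˡ j)} v≈u
                (≈ₚ-sym {n} {w ⊙ transpose (w ⟨$⟩ˡ i) (w ⟨$⟩ˡ j)} {u} (transpose-⊙≈⊙-transpose w i j)))
      ... | no v≉u = inj₁ (λ k → trans (R-up {v} v↑ k) (cong₂ (λ x y → x ℤ.- proj₁ y +ᶻ proj₂ y)
              (R-above lead {s ⊙ v} (ℕₚ.<⇒≤ u<sv) (<⇒≉ {u} {s ⊙ v} u<sv) k)
              (cong₂ _,_ (R-above lead {v} u≤v v≉u k) (R-above lead {v} u≤v v≉u (k +ᶻ + 2)))))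
        where
        u≤v : ℓ u ≤ ℓ v
        u≤v = ℕₚ.≤-reflexive (sym (ℕₚ.suc-injective (trans eq w↓)))
        u<sv : ℓ u < ℓ (s ⊙ v)
        u<sv = subst (ℓ u <_) (sym v↑) (s≤s u≤v)

  leading-terms : ∀ N w → ℓ w ≡ N → LeadingTerms w
  leading-terms N w ℓw≡N with e-or-descent w
  ... | inj₁ w≈e = leading-e {w} w≈e
  leading-terms zero w ℓw≡N | inj₂ (i , j , adj , lt) =
    contradiction (trans (sym (descent-length {w} {i} {j} adj lt)) ℓw≡N) λ ()
  leading-terms (suc N) w ℓw≡N | inj₂ (i , j , adj , lt) =
    Step.leading {w} {i} {j} adj w↓ (leading-terms N (transpose i j ⊙ w)
      (ℕₚ.suc-injective (trans (sym w↓) ℓw≡N)))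
    where w↓ = descent-length {w} {i} {j} adj lt

  lead : ∀ w → LeadingTerms w
  lead w = leading-terms (ℓ w) w refl

  barφ : 𝔖 n → ℤ → 𝔖 n → Laurent → ℤ
  barφ v k u a = act (conj a) (R v u) k

  barφ-additive : ∀ v k → Additive (barφ v k)
  barφ-additive v k = record
    { φ-cong = λ {u} {u′} u≈u′ a → act-cong (conj a) (bar-T-cong {u} {u′} u≈u′ v) k
    ; φ-++   = λ u a b → trans (cong (λ p → act p (R v u) k) (Listₚ.map-++ _ a b))
      (act-++ (conj a) (conj b) (R v u) k)
    ; φ-zero = λ u {a} a≈0 → act-congˡ {conj a} {[]} (λ k → trans (coeffᴸ-conj a k) (a≈0 (ℤ.- k)))
      (coeffᵀ (bar (T u)) v) k
    ; φ-neg  = λ u a → trans (cong (λ p → act p (R v u) k) (conj-neg a)) (act-neg (conj a) (R v u) k)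
    }
    where
    conj-neg : ∀ a → conj (-ᴸ a) ≡ -ᴸ conj a
    conj-neg a = trans (sym (Listₚ.map-∘ a)) (Listₚ.map-∘ a)

  ⟨bar⟩ : ∀ x v k → ⟨ bar x ⟩ v k ≡ Φ (barφ v k) x
  ⟨bar⟩ [] v k = 0#-homo v k
  ⟨bar⟩ ((a , u) ∷ x) v k = trans (+-homo ((a , u) ∷ []) x v k)
    (trans (⟨⟩-++ (bar ((a , u) ∷ [])) (bar x) v k)
    (cong₂ _+ᶻ_ (trans (⟦⟧-cong {(a , u) ∷ []} {a · T u} (·T a u) v k)
      (trans (semilinear a (T u) v k) (⟨⟩-· (conj a) (bar (T u)) v k))) (⟨bar⟩ x v k)))

-- Kazhdan-Lusztig elements one step below the top

module KL {n : ℕ} {H : HeckeAlgebra n} {B : BarInvolution H} (K : KazhdanLusztigBasis H B) where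

  open HeckeAlgebra H
  open Hecke H
  open BarInvolution B
  open Bar B
  open LeadingTerms
  open KazhdanLusztigBasis K

  C̃-diag : ∀ {v w} → v ≈ₚ w → coeffᵀ (C̃ w) v ≈ᴸ 1ᴸ
  C̃-diag {v} {w} v≈w k = trans (⟨⟩-cong (C̃ w) {v} {w} v≈w k)
    (trans (C̃-coeff {w} {w} (done λ _ → refl) k) (P-diagonal w k))

  C̃-degree : ∀ {v w} → ¬ (v ≈ₚ w) → ∀ k → ¬ (∃[ i ] (k ≡ + (2 * i) × 2 * i + ℓ v < ℓ w)) → ⟨ C̃ w ⟩
    v k ≡ 0ℤ
  C̃-degree {v} {w} v≉w k ∄i = stable-cases {P = v ≤ᴮ w} if≤ (λ v≰w → C̃-support {v} {w} v≰w k)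
    where
    if≤ : v ≤ᴮ w → ⟨ C̃ w ⟩ v k ≡ 0ℤ
    if≤ v≤w = trans (C̃-coeff {v} {w} v≤w k)
      (decidable-stable (coeffᴸ ⟦ P v w ⟧ k ℤₚ.≟ 0ℤ) (λ ≢0 → bound ≢0 (⟦⟧-support (P v w) k ≢0)))
      where
      bound : coeffᴸ ⟦ P v w ⟧ k ≢ 0ℤ → ¬ (∃[ i ] (k ≡ + (2 * i)))
      bound ≢0 (i , refl) = ∄i (i , refl , P-degree {v} {w} (v≤w , v≉w) i
        (λ eq → ≢0 (trans (⟦⟧-even (P v w) i) eq)))

  -- Since C̃_w = q^(ℓ(w)/2) C′_w with C′_w invariant, the bar involution multiplies C̃_w by
  -- q^-ℓ(w).
  bar-C̃ : ∀ w v k → ⟨ bar (C̃ w) ⟩ v k ≡ ⟨ C̃ w ⟩ v (k +ᶻ + (2 * ℓ w))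
  bar-C̃ w v k = trans (semilinear (q½^ (+ ℓ w)) (C′ w) v k)
    (trans (⟨⟩-· (conj (q½^ (+ ℓ w))) (bar (C′ w)) v k)
    (trans (act-cong (conj (q½^ (+ ℓ w))) (bar-C′ w v) k)
    (trans (sym (⟨⟩-· (conj (q½^ (+ ℓ w))) (C′ w) v k))
    (trans (⟨⟩-q½· (ℤ.- + ℓ w) (C′ w) v k)
    (sym (trans (⟨⟩-q½· (+ ℓ w) (C′ w) v (k +ᶻ + (2 * ℓ w)))
      (cong (⟨ C′ w ⟩ v) (trans (cong (λ x → k +ᶻ x ℤ.- + ℓ w) (cong +_ (double (ℓ w))))
        (lemma k (+ ℓ w))))))))))
    where
    double : ∀ m → 2 * m ≡ m + m
    double = ℕ-Solver.solve-∀
    lemma : ∀ k x → k +ᶻ (x +ᶻ x) ℤ.- x ≡ k ℤ.- (ℤ.- x)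
    lemma = solve-∀

  module _ {v w : 𝔖 n} (cover : suc (ℓ v) ≡ ℓ w) where

    private
      v≉w : ¬ (v ≈ₚ w)
      v≉w v≈w = ℕₚ.1+n≢n (trans cover (sym (ℓ-cong {n} {v} {w} v≈w)))

      φ = barφ v (ℤ.- + (2 * ℓ w))

      only-v-w : ∀ u → All (λ x → ¬ (x ≈ₚ u)) (w ∷ v ∷ []) → φ u (coeffᵀ (C̃ w) u) ≡ 0ℤ
      only-v-w u (w≉u ∷ v≉u ∷ []) = stable-cases {P = u ≤ᴮ w} if≤
        (λ u≰w → Additive.φ-zero (barφ-additive v (ℤ.- + (2 * ℓ w))) u {coeffᵀ (C̃ w) u}
          (C̃-support {u} {w} u≰w))
        where
        if≤ : u ≤ᴮ w → φ u (coeffᵀ (C̃ w) u) ≡ 0ℤ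
        if≤ u≤w with ≤ᴮ⇒≈⊎< {n} {u} {w} u≤w
        ... | inj₁ u≈w = contradiction (≈ₚ-sym {n} {u} {w} u≈w) w≉u
        ... | inj₂ u<w = trans (act-cong (conj (coeffᵀ (C̃ w) u))
              (R-above (lead u) {v} (ℕₚ.≤-pred (subst (ℓ u <_) (sym cover) u<w)) v≉u) (ℤ.- + (2 * ℓ w)))
              (act-zero (conj (coeffᵀ (C̃ w) u)) (ℤ.- + (2 * ℓ w)))

      w-term : φ w (coeffᵀ (C̃ w) w) ≡ R v w (ℤ.- + (2 * ℓ w))
      w-term = trans (act-congˡ {conj (coeffᵀ (C̃ w) w)} {1ᴸ}
          (λ k → trans (coeffᴸ-conj (coeffᵀ (C̃ w) w) k)
            (trans (C̃-diag {w} {w} (λ _ → refl) (ℤ.- k)) (sym (coeffᴸ-conj 1ᴸ k))))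
          (coeffᵀ (bar (T w)) v) (ℤ.- + (2 * ℓ w)))
        (trans (ℤₚ.+-identityʳ _) (trans (ℤₚ.*-identityˡ _) (cong (R v w) (ℤₚ.+-identityʳ _))))

      v-term : φ v (coeffᵀ (C̃ w) v) ≡ 0ℤ
      v-term = trans (act-cong (conj (coeffᵀ (C̃ w) v)) (R-diag (lead v) {v} (λ _ → refl))
        (ℤ.- + (2 * ℓ w)))
        (trans (act-mono (conj (coeffᵀ (C̃ w) v)) 1ℤ (ℤ.- + (2 * ℓ v)) (ℤ.- + (2 * ℓ w)))
        (trans (ℤₚ.*-identityˡ _) (trans (coeffᴸ-conj (coeffᵀ (C̃ w) v) _)
          (trans (cong (⟨ C̃ w ⟩ v) exponent)
          (C̃-degree {v} {w} v≉w (+ 2) too-big)))))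
        where
        exponent : ℤ.- (ℤ.- + (2 * ℓ w) ℤ.- (ℤ.- + (2 * ℓ v))) ≡ + 2
        exponent = trans (cong (λ m → ℤ.- (ℤ.- + (2 * m) ℤ.- (ℤ.- + (2 * ℓ v)))) (sym cover))
          (trans (cong (λ x → ℤ.- (ℤ.- x ℤ.- (ℤ.- + (2 * ℓ v)))) (+2*suc (ℓ v))) (lemma (+ (2 * ℓ v))))
          where
          lemma : ∀ x → ℤ.- (ℤ.- (x +ᶻ + 2) ℤ.- (ℤ.- x)) ≡ + 2
          lemma = solve-∀
        too-big : ¬ (∃[ i ] (+ 2 ≡ + (2 * i) × 2 * i + ℓ v < ℓ w))
        too-big (i , eq , lt) = ℕₚ.<⇒≱ lt (ℕₚ.≤-trans (ℕₚ.≤-reflexive (sym cover))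
          (ℕₚ.+-monoˡ-≤ (ℓ v) (subst (1 ≤_) (ℤₚ.+-injective eq) (s≤s z≤n))))

    -- The constant term of P_{v,w} is read off from bar C̃_w = q^-ℓ(w) C̃_w at T_v and q^-ℓ(w). The
    -- term of bar C̃_w coming from `v` itself would need q in P_{v,w}, beyond the degree bound; any
    -- other element below `w` is at most as long as `v` and contributes nothing by `R-above`. Only
    -- `w` remains.
    C̃-coatom-R : ⟨ C̃ w ⟩ v 0ℤ ≡ R v w (ℤ.- + (2 * ℓ w))
    C̃-coatom-R = begin
      ⟨ C̃ w ⟩ v 0ℤ
        ≡⟨ cong (⟨ C̃ w ⟩ v) (ℤₚ.+-inverseˡ (+ (2 * ℓ w))) ⟨
      ⟨ C̃ w ⟩ v (ℤ.- + (2 * ℓ w) +ᶻ + (2 * ℓ w))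
        ≡⟨ bar-C̃ w v (ℤ.- + (2 * ℓ w)) ⟨
      ⟨ bar (C̃ w) ⟩ v (ℤ.- + (2 * ℓ w))
        ≡⟨ ⟨bar⟩ (C̃ w) v (ℤ.- + (2 * ℓ w)) ⟩
      Φ φ (C̃ w)
        ≡⟨ Functional.Φ-supported (barφ-additive v (ℤ.- + (2 * ℓ w))) (w ∷ v ∷ [])
             (((λ w≈v → v≉w (≈ₚ-sym {n} {w} {v} w≈v)) ∷ []) ∷ [] ∷ []) (C̃ w) only-v-w ⟩
      φ w (coeffᵀ (C̃ w) w) +ᶻ (φ v (coeffᵀ (C̃ w) v) +ᶻ 0ℤ)
        ≡⟨ cong₂ (λ x y → x +ᶻ (y +ᶻ 0ℤ)) w-term v-term ⟩
      R v w (ℤ.- + (2 * ℓ w)) +ᶻ 0ℤ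
        ≡⟨ ℤₚ.+-identityʳ _ ⟩
      R v w (ℤ.- + (2 * ℓ w)) ∎
      where open ≡-Reasoning

    d-value : d w (ℤ.- + (2 * ℓ w)) ≡ 1ℤ
    d-value = cong₂ ℤ._-_ (mono-at 1ℤ {ℤ.- + (2 * ℓ w)} refl)
      (mono-off 1ℤ {ℤ.- + (2 * ℓ w)} (λ eq → ℤₚ.<-irrefl (sym eq) (D-2<D (ℤ.- + (2 * ℓ w)))))

    C̃-coatom : ⟨ C̃ w ⟩ v 0ℤ ≡ 0ℤ ⊎ (⟨ C̃ w ⟩ v 0ℤ ≡ 1ℤ × ∃[ i ] ∃[ j ] (v ≈ₚ w ⊙ transpose i j))
    C̃-coatom with R-coatom (lead w) {v} cover
    ... | inj₁ R≡0 = inj₁ (trans C̃-coatom-R (R≡0 _))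
    ... | inj₂ (R≡d , t) = inj₂ (trans C̃-coatom-R (trans (R≡d _) d-value) , t)

  -- Along a left descent the value 1 is certain. For the reversals this supplies the lower bound,
  -- where `C̃-coatom` alone would allow 0.
  C̃-descent : ∀ {w i j} → (adj : Adjacent i j) → ℓ w ≡ suc (ℓ (transpose i j ⊙ w)) →
    ⟨ C̃ w ⟩ (transpose i j ⊙ w) 0ℤ ≡ 1ℤ
  C̃-descent {w} {i} {j} adj w↓ = trans (C̃-coatom-R {u} {w} (sym w↓))
    (trans (Step.R-coatom-u {w} {i} {j} adj w↓ (lead u) {u} (λ _ → refl) _) (d-value {u} {w} (sym w↓)))
    where u = transpose i j ⊙ w

AllPairs-refine : ∀ {a p r s} {A : Set a} {P : A → Set p} {R : A → A → Set r} {S : A → A → Set s} →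
  (∀ {x y} → P x → P y → R x y → S x y) → ∀ {xs} → All P xs → AllPairs R xs → AllPairs S xs
AllPairs-refine f [] [] = []
AllPairs-refine f (px ∷ pxs) (rx ∷ rxs) =
  All.map (λ (py , rxy) → f px py rxy) (All.zip (pxs , rx)) ∷ AllPairs-refine f pxs rxs

-- Covers of w in the Bruhat order

module _ {n : ℕ} where

  Cover : 𝔖 n → Fin n → Fin n → Set
  Cover w i j = Inversion w i j ×
    (∀ k → i Fin.< k → k Fin.< j → ¬ ((w ⟨$⟩ʳ j) Fin.< (w ⟨$⟩ʳ k) × (w ⟨$⟩ʳ k) Fin.< (w ⟨$⟩ʳ i)))

  IsCover : 𝔖 n → Fin n × Fin n → Set
  IsCover w (i , j) = Cover w i j

  cover? : ∀ w → Decidable (IsCover w)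
  cover? w (i , j) = inversion? w i j ×-dec Finₚ.all? (λ k →
    (i Finₚ.<? k) →-dec (k Finₚ.<? j) →-dec
    ¬? (((w ⟨$⟩ʳ j) Finₚ.<? (w ⟨$⟩ʳ k)) ×-dec ((w ⟨$⟩ʳ k) Finₚ.<? (w ⟨$⟩ʳ i))))

  covers : 𝔖 n → List (Fin n × Fin n)
  covers w = filter (cover? w) (cartesianProduct (allFin n) (allFin n))

  -- The order in which `covers` enumerates its pairs. It gives distinctness and also fixes which
  -- edges count as later when cycles are excluded.
  Lex : Fin n × Fin n → Fin n × Fin n → Set
  Lex (i , j) (i′ , j′) = i Fin.< i′ ⊎ (i ≡ i′ × j Fin.< j′)

  cartesianProduct-lex : ∀ {xs ys : List (Fin n)} → AllPairs Fin._<_ xs → AllPairs Fin._<_ ys →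
    AllPairs Lex (cartesianProduct xs ys)
  cartesianProduct-lex [] _ = []
  cartesianProduct-lex {x ∷ xs} {ys} (x< ∷ xs<) ys< = AllPairsₚ.++⁺
    (AllPairsₚ.map⁺ (AllPairs.map (λ y<y′ → inj₂ (refl , y<y′)) ys<))
    (cartesianProduct-lex xs< ys<)
    (Allₚ.map⁺ (All.universal (λ y → later xs x<) ys))
    where
    later : ∀ {y} xs → All (x Fin.<_) xs → All (Lex (x , y)) (cartesianProduct xs ys)
    later [] [] = []
    later {y} (x′ ∷ xs) (x<x′ ∷ x<xs) = Allₚ.++⁺ (Allₚ.map⁺ (All.universal (λ _ → inj₁ x<x′) ys))
      (later {y} xs x<xs)

  allFin-< : AllPairs Fin._<_ (allFin n)
  allFin-< = AllPairsₚ.tabulate⁺-< id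

  covers-lex : ∀ w → AllPairs Lex (covers w)
  covers-lex w = AllPairsₚ.filter⁺ (cover? w) (cartesianProduct-lex allFin-< allFin-<)

  covers-cover : ∀ w → All (IsCover w) (covers w)
  covers-cover w = Allₚ.all-filter (cover? w) (cartesianProduct (allFin n) (allFin n))

  ∈-covers : ∀ {w i j} → Cover w i j → (i , j) ∈ covers w
  ∈-covers {w} {i} {j} = ∈-filter⁺ (cover? w) (∈-cartesianProduct⁺ (∈-allFin i) (∈-allFin j))

  -- A letter between the two in position and value would lower the length further, by
  -- `ℓ-transpose-between`. This direction makes `covers` large enough for an upper bound on the
  -- second coefficient.
  lengthened⇒cover : ∀ {w i j} → suc (ℓ (w ⊙ transpose i j)) ≡ ℓ w → i Fin.< j → Cover w i j
  lengthened⇒cover {w} {i} {j} eq i<j with perm-<-or-> w (<⇒≢ {n} {i} {j} i<j)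
  ... | inj₁ up = contradiction (ℓ-transpose-< i<j w up) (ℕₚ.<-asym (ℕₚ.≤-reflexive eq))
  ... | inj₂ down = (i<j , down) , λ k i<k k<j (j<k , k<i) →
    ℕₚ.<-irrefl eq (ℓ-transpose-between {n} {i} {k} {j} i<k k<j w j<k k<i)

  coatom-cover : ∀ {v w} → suc (ℓ v) ≡ ℓ w → ∀ {i j} → v ≈ₚ w ⊙ transpose i j →
    ∃[ i ] ∃[ j ] (Cover w i j × v ≈ₚ w ⊙ transpose i j)
  coatom-cover {v} {w} eq {i} {j} v≈wt with Finₚ.<-cmp i j
  ... | tri< i<j _ _ = i , j , lengthened⇒cover {w} {i} {j}
        (trans (cong suc (sym (ℓ-cong {n} {v} {w ⊙ transpose i j} v≈wt))) eq) i<j , v≈wt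
  ... | tri> _ _ j<i = j , i , lengthened⇒cover {w} {j} {i}
        (trans (cong suc (sym (ℓ-cong {n} {v} {w ⊙ transpose j i} v≈wt′))) eq) j<i , v≈wt′
    where
    v≈wt′ : v ≈ₚ w ⊙ transpose j i
    v≈wt′ k = trans (v≈wt k) (cong (w ⟨$⟩ʳ_) (transpose-sym i j k))
  ... | tri≈ _ refl _ = contradiction
        (trans eq (trans (ℓ-cong {n} {w} {w ⊙ transpose i i}
          (λ k → cong (w ⟨$⟩ʳ_) (sym (transpose-refl i k))))
          (sym (ℓ-cong {n} {v} {w ⊙ transpose i i} v≈wt)))) ℕₚ.1+n≢n

  Lex-irrefl : ∀ {x} → ¬ Lex x x
  Lex-irrefl (inj₁ lt)       = ℕₚ.<-irrefl refl lt
  Lex-irrefl (inj₂ (_ , lt)) = ℕₚ.<-irrefl refl lt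

  transpose-injective : ∀ {i j k l : Fin n} → i Fin.< j → k Fin.< l →
    transpose i j ≈ₚ transpose k l → (i , j) ≡ (k , l)
  transpose-injective {i} {j} {k} {l} i<j k<l t≈ =
    transpose-cases k l (λ a a′ → a ≡ i → a′ ≡ j → (i , j) ≡ (k , l))
      (λ { refl refl → refl })
      (λ { refl refl → contradiction i<j (ℕₚ.<-asym k<l) })
      (λ { _ _ refl i≡j → contradiction i≡j (<⇒≢ {n} {i} {j} i<j) })
      i refl (trans (sym (t≈ i)) (transpose-fst i j))

  coverPerms : 𝔖 n → List (𝔖 n)
  coverPerms w = List.map (λ (i , j) → w ⊙ transpose i j) (covers w)

  coverPerms-distinct : ∀ w → AllPairs (λ u v → ¬ (u ≈ₚ v)) (coverPerms w)
  coverPerms-distinct w = AllPairsₚ.map⁺ (AllPairs-refine distinct (covers-cover w) (covers-lex w))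
    where
    distinct : ∀ {x y} → IsCover w x → IsCover w y → Lex x y →
      ¬ (w ⊙ transpose (proj₁ x) (proj₂ x) ≈ₚ w ⊙ transpose (proj₁ y) (proj₂ y))
    distinct {i , j} {k , l} ((i<j , _) , _) ((k<l , _) , _) lex wt≈
      with transpose-injective {i} {j} {k} {l} i<j k<l (λ a → perm-injective w (wt≈ a))
    ... | refl = Lex-irrefl {i , j} lex

-- The two leading coefficients of ε (C̃ w)

module Leading {n : ℕ} {H : HeckeAlgebra n} {B : BarInvolution H} (K : KazhdanLusztigBasis H B) where

  open KazhdanLusztigBasis K
  open KL K

  next : 𝔖 n → ℤ
  next w = coeffᴸ (ε (C̃ w)) (+ (2 * ℓ w) ℤ.- + 2)

  private
    term : 𝔖 n → ℤ → 𝔖 n → ℤ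
    term w k u = εφ k u (coeffᵀ (C̃ w) u)

    term-coeff : ∀ w k u → term w k u ≡ ⟨ C̃ w ⟩ u (k ℤ.- + (2 * ℓ u))
    term-coeff w k u = εφ-shift k u (coeffᵀ (C̃ w) u)

    diag-term : ∀ {w u} → u ≈ₚ w → ∀ k → term w k u ≡ mono 1ℤ (+ (2 * ℓ w)) k
    diag-term {w} {u} u≈w k = trans (term-coeff w k u) (trans (C̃-diag {u} {w} u≈w (k ℤ.- + (2 * ℓ u)))
      (trans (coeffᴸ-q½^ 0ℤ (k ℤ.- + (2 * ℓ u))) (mono-⇔ 1ℤ {0ℤ} {k ℤ.- + (2 * ℓ u)} {+ (2 * ℓ w)} {k}
        (λ eq → trans (cong (λ m → + (2 * m)) (sym ℓu≡ℓw)) (sym (ℤₚ.i-j≡0⇒i≡j k (+ (2 * ℓ u)) (sym eq))))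
        (λ eq → sym (ℤₚ.i≡j⇒i-j≡0 {k} {+ (2 * ℓ u)}
          (trans (sym eq) (cong (λ m → + (2 * m)) (sym ℓu≡ℓw))))))))
      where ℓu≡ℓw = ℓ-cong {n} {u} {w} u≈w

    cancel : ∀ k x → k ≡ k ℤ.- x +ᶻ x
    cancel = solve-∀

    off-term : ∀ {w u} → ¬ (u ≈ₚ w) → ∀ k → + (2 * ℓ w) ℤ.- + 2 ℤ.≤ k →
      ¬ (k ≡ + (2 * ℓ u) × suc (ℓ u) ≡ ℓ w) → term w k u ≡ 0ℤ
    off-term {w} {u} u≉w k ≤k ¬coatom = trans (term-coeff w k u)
      (C̃-degree {u} {w} u≉w (k ℤ.- + (2 * ℓ u)) bound)
      where
      -- A term q^i of P_{u,w} contributes q^(i+ℓ(u)). From ℓ(w) - 1 ≤ i + ℓ(u) and 2 i + ℓ(u) <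
      -- ℓ(w) it follows that i = 0 and ℓ(u) = ℓ(w) - 1.
      ineq : ∀ i a b → 2 * b ≤ 2 * (i + a + 1) → 2 * i + a < b → i ≡ 0 × suc a ≡ b
      ineq i a b 2b≤ lt = i≡0 , ℕₚ.≤-antisym (ℕₚ.≤-trans (s≤s (ℕₚ.m≤n+m a (2 * i))) lt)
        (ℕₚ.≤-trans b≤ (ℕₚ.≤-reflexive (trans (cong (λ i → i + a + 1) i≡0) (ℕₚ.+-comm a 1))))
        where
        b≤ : b ≤ i + a + 1
        b≤ = ℕₚ.*-cancelˡ-≤ 2 2b≤
        regroup : ∀ i a → suc (2 * i + a) ≡ i + (i + a + 1)
        regroup = ℕ-Solver.solve-∀
        i≡0 : i ≡ 0
        i≡0 = ℕₚ.n≤0⇒n≡0 (ℕₚ.+-cancelʳ-≤ (i + a + 1) i 0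
          (ℕₚ.≤-trans (ℕₚ.≤-reflexive (sym (regroup i a))) (ℕₚ.≤-trans lt b≤)))
      bound : ¬ (∃[ i ] (k ℤ.- + (2 * ℓ u) ≡ + (2 * i) × 2 * i + ℓ u < ℓ w))
      bound (i , eq , lt) = ¬coatom (trans k≡ (cong (λ i → + (2 * i + 2 * ℓ u)) (proj₁ i,u)) , proj₂ i,u)
        where
        k≡ : k ≡ + (2 * i + 2 * ℓ u)
        k≡ = trans (cancel k (+ (2 * ℓ u))) (cong (_+ᶻ + (2 * ℓ u)) eq)
        lemma : ∀ i a → 2 * i + 2 * a + 2 ≡ 2 * (i + a + 1)
        lemma = ℕ-Solver.solve-∀
        i,u = ineq i (ℓ u) (ℓ w) (ℕₚ.≤-trans
          (ℤₚ.drop‿+≤+ (subst (ℤ._≤ + (2 * i + 2 * ℓ u) +ᶻ + 2) (sym (cancel (+ (2 * ℓ w)) (+ 2)))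
          (ℤₚ.+-monoˡ-≤ (+ 2) (subst (+ (2 * ℓ w) ℤ.- + 2 ℤ.≤_) k≡ ≤k))))
            (ℕₚ.≤-reflexive (lemma i (ℓ u)))) lt

  Top-C̃ : ∀ w → Top (ε (C̃ w)) (+ (2 * ℓ w)) (next w)
  Top-C̃ w = top go
    where
    D = + (2 * ℓ w)
    go : ∀ k → D ℤ.- + 2 ℤ.≤ k → coeffᴸ (ε (C̃ w)) k ≡ mono 1ℤ D k +ᶻ mono (next w) (D ℤ.- + 2) k
    go k ≤k with (D ℤ.- + 2) ℤₚ.≟ k
    ... | yes refl = sym (trans (cong (_+ᶻ next w)
            (mono-off 1ℤ {D} {D ℤ.- + 2} (λ eq → ℤₚ.<-irrefl (sym eq) (D-2<D D)))) (ℤₚ.+-identityˡ _))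
    ... | no k≢ = trans (ε-Φ (C̃ w) k) (trans
            (Functional.Φ-supported (εφ-additive k) (w ∷ []) ([] ∷ []) (C̃ w)
              (λ { u (w≉u ∷ []) → off-term {w} {u} (λ u≈w → w≉u (≈ₚ-sym {n} {u} {w} u≈w)) k ≤k
                (λ (k≡ , cover) → k≢ (trans (shift {u} cover) (sym k≡))) }))
            (cong (_+ᶻ 0ℤ) (diag-term {w} {w} (λ _ → refl) k)))
      where
      e₁ : ∀ x → x +ᶻ + 2 ℤ.- + 2 ≡ x
      e₁ = solve-∀
      shift : ∀ {u} → suc (ℓ u) ≡ ℓ w → D ℤ.- + 2 ≡ + (2 * ℓ u)
      shift {u} cover = trans (cong (λ m → + (2 * m) ℤ.- + 2) (sym cover))
        (trans (cong (ℤ._- + 2) (+2*suc (ℓ u))) (e₁ (+ (2 * ℓ u))))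

  module _ (w : 𝔖 n) where

    private
      k₀ = + (2 * ℓ w) ℤ.- + 2

      e₂ : ∀ x → x +ᶻ + 2 ℤ.- + 2 ℤ.- x ≡ 0ℤ
      e₂ = solve-∀

      coatom-term : ∀ {u} → suc (ℓ u) ≡ ℓ w → term w k₀ u ≡ ⟨ C̃ w ⟩ u 0ℤ
      coatom-term {u} cover = trans (term-coeff w k₀ u) (cong (⟨ C̃ w ⟩ u)
        (trans (cong (λ m → + (2 * m) ℤ.- + 2 ℤ.- + (2 * ℓ u)) (sym cover))
        (trans (cong (λ x → x ℤ.- + 2 ℤ.- + (2 * ℓ u)) (+2*suc (ℓ u))) (e₂ (+ (2 * ℓ u))))))

      term-cases : ∀ u → term w k₀ u ≡ 0ℤ ⊎
        (term w k₀ u ≡ 1ℤ × ∃[ i ] ∃[ j ] (Cover w i j × u ≈ₚ w ⊙ transpose i j))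
      term-cases u with u ≟ₚ w
      ... | yes u≈w = inj₁ (trans (diag-term {w} {u} u≈w k₀)
              (mono-off 1ℤ {+ (2 * ℓ w)} {k₀} (λ eq → ℤₚ.<-irrefl (sym eq) (D-2<D (+ (2 * ℓ w))))))
      ... | no u≉w with suc (ℓ u) ℕₚ.≟ ℓ w
      ...   | no ≢ = inj₁ (off-term {w} {u} u≉w k₀ ℤₚ.≤-refl (≢ ∘ proj₂))
      ...   | yes cover with C̃-coatom {u} {w} cover
      ...     | inj₁ ≡0 = inj₁ (trans (coatom-term {u} cover) ≡0)
      ...     | inj₂ (≡1 , i , j , u≈wt) = inj₂
            (trans (coatom-term {u} cover) ≡1 , coatom-cover {n} {u} {w} cover {i} {j} u≈wt)

    -- Every nonzero contribution in degree ℓ(w) - 1 is a 1 at some w t with t a cover.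
    next-upper : next w ℤ.≤ + length (covers w)
    next-upper = subst₂ ℤ._≤_ (sym (trans (ε-Φ (C̃ w) k₀)
        (Functional.Φ-supported (εφ-additive k₀) (coverPerms w) (coverPerms-distinct w) (C̃ w)
          uncovered)))
      (cong +_ (Listₚ.length-map _ (covers w)))
      (bounded (coverPerms w))
      where
      uncovered : ∀ u → All (λ v → ¬ (v ≈ₚ u)) (coverPerms w) → term w k₀ u ≡ 0ℤ
      uncovered u u∉ with term-cases u
      ... | inj₁ ≡0 = ≡0
      ... | inj₂ (_ , i , j , cov , u≈wt) = contradiction (≈ₚ-sym {n} {u} {w ⊙ transpose i j} u≈wt)
              (All.lookup (Allₚ.map⁻ u∉) (∈-covers {n} {w} cov))
      term≤1 : ∀ u → term w k₀ u ℤ.≤ 1ℤ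
      term≤1 u with term-cases u
      ... | inj₁ ≡0       = ℤₚ.≤-trans (ℤₚ.≤-reflexive ≡0) (ℤ.+≤+ z≤n)
      ... | inj₂ (≡1 , _) = ℤₚ.≤-reflexive ≡1
      bounded : ∀ L → Functional.∑ᴸ (εφ-additive k₀) (C̃ w) L ℤ.≤ + length L
      bounded []      = ℤₚ.≤-refl
      bounded (u ∷ L) = ℤₚ.+-mono-≤ (term≤1 u) (bounded L)

    -- All contributions in this degree are 0 or 1, so the elements outside `L` cannot lower the
    -- sum.
    next-lower : ∀ L → AllPairs (λ u v → ¬ (u ≈ₚ v)) L →
      All (λ u → suc (ℓ u) ≡ ℓ w × ⟨ C̃ w ⟩ u 0ℤ ≡ 1ℤ) L → + length L ℤ.≤ next w
    next-lower L distinct coatoms = subst₂ ℤ._≤_ (exact L coatoms) (sym (ε-Φ (C̃ w) k₀))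
      (Functional.Φ-nonneg (εφ-additive k₀) L distinct (C̃ w) nonneg)
      where
      nonneg : ∀ u → 0ℤ ℤ.≤ term w k₀ u
      nonneg u with term-cases u
      ... | inj₁ ≡0       = ℤₚ.≤-reflexive (sym ≡0)
      ... | inj₂ (≡1 , _) = ℤₚ.≤-trans (ℤ.+≤+ z≤n) (ℤₚ.≤-reflexive (sym ≡1))
      exact : ∀ L → All (λ u → suc (ℓ u) ≡ ℓ w × ⟨ C̃ w ⟩ u 0ℤ ≡ 1ℤ) L →
        Functional.∑ᴸ (εφ-additive k₀) (C̃ w) L ≡ + length L
      exact []      []                    = refl
      exact (u ∷ L) ((cover , ≡1) ∷ rest) = cong₂ _+ᶻ_ (trans (coatom-term {u} cover) ≡1) (exact L rest)

-- Counting repetitions and pairs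

module _ {n p} {P : Fin n → Set p} (P? : Decidable P) where

  -- All elements satisfying `P` except the least have a smaller companion. Truncation takes care of
  -- the empty case.
  count-∸1 : sum (λ k → 𝟙 (P? k)) ∸ 1 ≤ sum
    (λ k → 𝟙 (P? k ×-dec Finₚ.any? (λ k′ → (k′ Finₚ.<? k) ×-dec P? k′)))
  count-∸1 = go (Finₚ.any? P?)
    where
    Repeated : Fin n → Set p
    Repeated k = P k × ∃[ k′ ] (k′ Fin.< k × P k′)
    repeated? : Decidable Repeated
    repeated? k = P? k ×-dec Finₚ.any? (λ k′ → (k′ Finₚ.<? k) ×-dec P? k′)
    go : Dec (∃ P) → sum (λ k → 𝟙 (P? k)) ∸ 1 ≤ sum (λ k → 𝟙 (repeated? k))
    go (no ∄P) = subst (λ c → c ∸ 1 ≤ sum (λ k → 𝟙 (repeated? k)))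
      (sym (sum-zero (λ k → 𝟙-no (P? k) (λ Pk → ∄P (k , Pk))))) z≤n
    go (yes ∃P) with Finₚ.¬∀⟶∃¬-smallest n (¬_ ∘ P) (λ k → ¬? (P? k)) (λ ∄ → ∄ (proj₁ ∃P) (proj₂ ∃P))
    ... | k₀ , ¬¬P , least = ℕₚ.m≤n+o⇒m∸n≤o (sum (λ k → 𝟙 (P? k))) 1 (ℕₚ.≤-trans (sum-mono pointwise)
      (ℕₚ.≤-reflexive (trans (∑-distrib-+ (λ k → 𝟙 (k Finₚ.≟ k₀)) (λ k → 𝟙 (repeated? k)))
        (cong (_+ sum (λ k → 𝟙 (repeated? k)))
          (trans (sum-supported (λ k → 𝟙 (k Finₚ.≟ k₀)) k₀ (λ k k≢ → 𝟙-no (k Finₚ.≟ k₀) k≢))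
          (𝟙-yes (k₀ Finₚ.≟ k₀) refl))))))
      where
      pointwise : ∀ k → 𝟙 (P? k) ≤ 𝟙 (k Finₚ.≟ k₀) + 𝟙 (repeated? k)
      pointwise k with P? k
      ... | no _ = z≤n
      ... | yes Pk with Finₚ.<-cmp k₀ k
      ...   | tri≈ _ refl _ = ℕₚ.≤-trans (ℕₚ.≤-reflexive (sym (𝟙-yes (k Finₚ.≟ k) refl))) (ℕₚ.m≤m+n _ _)
      ...   | tri> _ _ k<k₀ = contradiction Pk (least′ k k<k₀)
        where
        least′ : ∀ k → k Fin.< k₀ → ¬ P k
        least′ k k<k₀ = subst (¬_ ∘ P) (Finₚ.toℕ-injective
          (trans (Finₚ.toℕ-inject (fromℕ< k<k₀)) (Finₚ.toℕ-fromℕ< k<k₀))) (least (fromℕ< k<k₀))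
      ...   | tri< k₀<k _ _ with P? k₀
      ...     | no ¬Pk₀ = contradiction ¬Pk₀ ¬¬P
      ...     | yes Pk₀ = ℕₚ.≤-trans (ℕₚ.≤-reflexive
            (sym (𝟙-yes (Finₚ.any? (λ k′ → (k′ Finₚ.<? k) ×-dec P? k′)) (k₀ , k₀<k , Pk₀))))
            (ℕₚ.m≤n+m _ _)

  count-pairs : sum (λ k → 𝟙 (P? k)) * (sum (λ k → 𝟙 (P? k)) ∸ 1) ≡
    ∑[ k < n ] ∑[ k′ < n ] 𝟙 (¬? (k Finₚ.≟ k′) ×-dec (P? k ×-dec P? k′))
  count-pairs = trans (sym (sum-*ʳ (c ∸ 1) (λ k → 𝟙 (P? k)))) (sum-cong-≗ row)
    where
    c = sum (λ k → 𝟙 (P? k))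
    row : ∀ k → 𝟙 (P? k) * (c ∸ 1) ≡ ∑[ k′ < n ] 𝟙 (¬? (k Finₚ.≟ k′) ×-dec (P? k ×-dec P? k′))
    row k = go (P? k)
      where
      go : (d : Dec (P k)) → 𝟙 d * (c ∸ 1) ≡ ∑[ k′ < n ] 𝟙 (¬? (k Finₚ.≟ k′) ×-dec (d ×-dec P? k′))
      go (no ¬Pk) = sym (sum-zero (λ k′ → 𝟙-no (¬? (k Finₚ.≟ k′) ×-dec (no ¬Pk ×-dec P? k′))
        (λ (_ , Pk , _) → ¬Pk Pk)))
      go (yes Pk) = trans (ℕₚ.*-identityˡ _) (trans (cong (_∸ 1) split) (ℕₚ.m+n∸m≡n 1 _))
        where
        split : c ≡ 1 + ∑[ k′ < n ] 𝟙 (¬? (k Finₚ.≟ k′) ×-dec (yes Pk ×-dec P? k′))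
        split = trans (sum-cong-≗ pointwise) (trans (∑-distrib-+ (λ k′ → 𝟙 (k′ Finₚ.≟ k)) _)
          (cong (_+ ∑[ k′ < n ] 𝟙 (¬? (k Finₚ.≟ k′) ×-dec (yes Pk ×-dec P? k′)))
            (trans (sum-supported (λ k′ → 𝟙 (k′ Finₚ.≟ k)) k (λ k′ k≢ → 𝟙-no (k′ Finₚ.≟ k) k≢))
              (𝟙-yes (k Finₚ.≟ k) refl))))
          where
          pointwise : ∀ k′ → 𝟙 (P? k′) ≡ 𝟙 (k′ Finₚ.≟ k) + 𝟙
            (¬? (k Finₚ.≟ k′) ×-dec (yes Pk ×-dec P? k′))
          pointwise k′ with k Finₚ.≟ k′
          ... | yes refl = trans (𝟙-yes (P? k) Pk)
                (sym (trans (cong (_+ 0) (𝟙-yes (k Finₚ.≟ k) refl)) refl))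
          ... | no k≢k′  = sym (cong (_+ 𝟙 (P? k′)) (𝟙-no (k′ Finₚ.≟ k) (k≢k′ ∘ sym)))

-- Networks of intervals

module _ {n : ℕ} where

  -- `u zero` acts last: a path enters at the last block, and its level just before block 0 is given
  -- by `prod (u ∘ suc)`.
  prod : ∀ {m} → (Fin m → 𝔖 n) → 𝔖 n
  prod {zero}  u = e
  prod {suc m} u = u zero ⊙ prod (u ∘ suc)

  -- Owned 𝓐 j k : the leftmost interval of 𝓐 containing k is the j-th.
  Owned : ∀ {m} → (Fin m → Interval n) → Fin m → Fin n → Set
  Owned 𝓐 zero    k = k ∈ᴵ 𝓐 zero
  Owned 𝓐 (suc j) k = ¬ (k ∈ᴵ 𝓐 zero) × Owned (𝓐 ∘ suc) j k

  owned? : ∀ {m} (𝓐 : Fin m → Interval n) j → Decidable (Owned 𝓐 j)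
  owned? 𝓐 zero    k = k ∈ᴵ? 𝓐 zero
  owned? 𝓐 (suc j) k = ¬? (k ∈ᴵ? 𝓐 zero) ×-dec owned? (𝓐 ∘ suc) j k

  owned⇒∈ : ∀ {m} (𝓐 : Fin m → Interval n) j {k} → Owned 𝓐 j k → k ∈ᴵ 𝓐 j
  owned⇒∈ 𝓐 zero    k∈      = k∈
  owned⇒∈ 𝓐 (suc j) (_ , o) = owned⇒∈ (𝓐 ∘ suc) j o

  owned-unique : ∀ {m} (𝓐 : Fin m → Interval n) i j {k} → Owned 𝓐 i k → Owned 𝓐 j k → i ≡ j
  owned-unique 𝓐 zero    zero    _        _        = refl
  owned-unique 𝓐 zero    (suc j) k∈       (k∉ , _) = contradiction k∈ k∉
  owned-unique 𝓐 (suc i) zero    (k∉ , _) k∈       = contradiction k∈ k∉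
  owned-unique 𝓐 (suc i) (suc j) (_ , o)  (_ , o′) = cong suc (owned-unique (𝓐 ∘ suc) i j o o′)

  -- The owner of a level is the last block traversed by a path that leaves at this level. Two
  -- levels with the same owner are wires coming out of a common block.
  SameOwner : ∀ {m} → (Fin m → Interval n) → Fin n → Fin n → Set
  SameOwner 𝓐 k k′ = ∃[ j ] (Owned 𝓐 j k × Owned 𝓐 j k′)

  sameOwner? : ∀ {m} (𝓐 : Fin m → Interval n) k k′ → Dec (SameOwner 𝓐 k k′)
  sameOwner? 𝓐 k k′ = Finₚ.any? (λ j → owned? 𝓐 j k ×-dec owned? 𝓐 j k′)

  sameOwner-sym : ∀ {m} (𝓐 : Fin m → Interval n) {k k′} → SameOwner 𝓐 k k′ → SameOwner 𝓐 k′ k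
  sameOwner-sym 𝓐 (j , o , o′) = j , o′ , o

  sameOwner-trans : ∀ {m} (𝓐 : Fin m → Interval n) {k k′ k″} →
    SameOwner 𝓐 k k′ → SameOwner 𝓐 k′ k″ → SameOwner 𝓐 k k″
  sameOwner-trans 𝓐 {k″ = k″} (i , o , o′) (j , p , p′) =
    i , o , subst (λ j → Owned 𝓐 j k″) (sym (owned-unique 𝓐 i j o′ p)) p′

  -- Bond I k : both k - 1 and k lie in I.
  Bond : Interval n → Fin n → Set
  Bond I k = lo I Fin.< k × k Fin.≤ hi I

  bond? : ∀ I → Decidable (Bond I)
  bond? I k = (lo I Finₚ.<? k) ×-dec (k Finₚ.≤? hi I)

  Bonded : ∀ {m} → (Fin m → Interval n) → Fin n → Set
  Bonded 𝓐 k = ∃[ j ] Bond (𝓐 j) k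

  bonded? : ∀ {m} (𝓐 : Fin m → Interval n) → Decidable (Bonded 𝓐)
  bonded? 𝓐 k = Finₚ.any? (λ j → bond? (𝓐 j) k)

  -- Intervals are convex, so two levels lie in one component exactly if every step between
  -- consecutive levels on the way is inside some interval. This turns connectedness into a
  -- condition on single levels.
  Connected : ∀ {m} → (Fin m → Interval n) → Fin n → Fin n → Set
  Connected 𝓐 x y = ∀ k → (x Fin.< k × k Fin.≤ y) ⊎ (y Fin.< k × k Fin.≤ x) → Bonded 𝓐 k

  module _ {m} (𝓐 : Fin m → Interval n) where

    connected-sym : ∀ {x y} → Connected 𝓐 x y → Connected 𝓐 y x
    connected-sym c k (inj₁ p) = c k (inj₂ p)
    connected-sym c k (inj₂ p) = c k (inj₁ p)

    connected-trans : ∀ {x y z} → Connected 𝓐 x y → Connected 𝓐 y z → Connected 𝓐 x z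
    connected-trans {x} {y} {z} c d k (inj₁ (x<k , k≤z)) with k Finₚ.≤? y
    ... | yes k≤y = c k (inj₁ (x<k , k≤y))
    ... | no k≰y  = d k (inj₁ (ℕₚ.≰⇒> k≰y , k≤z))
    connected-trans {x} {y} {z} c d k (inj₂ (z<k , k≤x)) with k Finₚ.≤? y
    ... | yes k≤y = d k (inj₂ (z<k , k≤y))
    ... | no k≰y  = c k (inj₂ (ℕₚ.≰⇒> k≰y , k≤x))

    block-connected : ∀ j {x y} → x ∈ᴵ 𝓐 j → y ∈ᴵ 𝓐 j → Connected 𝓐 x y
    block-connected j (l≤x , _) (_ , y≤h) k (inj₁ (x<k , k≤y)) = j , ℕₚ.≤-<-trans l≤x x<k ,
      ℕₚ.≤-trans k≤y y≤h
    block-connected j (_ , x≤h) (l≤y , _) k (inj₂ (y<k , k≤x)) = j , ℕₚ.≤-<-trans l≤y y<k ,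
      ℕₚ.≤-trans k≤x x≤h

    sameOwner-connected : ∀ {x y} → SameOwner 𝓐 x y → Connected 𝓐 x y
    sameOwner-connected (j , o , o′) = block-connected j (owned⇒∈ 𝓐 j o) (owned⇒∈ 𝓐 j o′)

  connected-suc : ∀ {m} (𝓐 : Fin (suc m) → Interval n) {x y} → Connected (𝓐 ∘ suc) x y → Connected 𝓐 x y
  connected-suc 𝓐 c k p with c k p
  ... | j , b = suc j , b

  -- joint 𝓐 j = |I_{0,j+1}|, hence joints h 𝓐 = Σ_{i<j} h |I_{i,j}|.
  joint : ∀ {m} → (Fin (suc m) → Interval n) → Fin m → ℕ
  joint 𝓐 j = ∑[ k < n ] 𝟙 ((k ∈ᴵ? 𝓐 zero) ×-dec owned? (𝓐 ∘ suc) j k)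

  joints : (ℕ → ℕ) → ∀ {m} → (Fin m → Interval n) → ℕ
  joints h {zero}  𝓐 = 0
  joints h {suc m} 𝓐 = ∑[ j < m ] h (joint 𝓐 j) + joints h (𝓐 ∘ suc)

  -- This is |I| - 1, the number of adjacent transpositions in the parabolic subgroup of `I`.
  width : Interval n → ℕ
  width I = ∑[ k < n ] 𝟙 (bond? I k)

  -- Equal to n minus the number of components, since an unbonded level is the first of its
  -- component.
  bonds : ∀ {m} → (Fin m → Interval n) → ℕ
  bonds 𝓐 = ∑[ k < n ] 𝟙 (bonded? 𝓐 k)

  -- The graph on the intervals with an edge between i and j whenever
  -- I_{i,j} ≠ ∅ is a forest.
  Tree : ∀ {m} → (Fin m → Interval n) → Set
  Tree {zero}  𝓐 = ⊤
  Tree {suc m} 𝓐 = Tree (𝓐 ∘ suc) × (∀ k → Bond (𝓐 zero) k → Bonded (𝓐 ∘ suc) k →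
    ∃[ k′ ] (k′ Fin.< k × k′ ∈ᴵ 𝓐 zero × SameOwner (𝓐 ∘ suc) k′ k))

  module _ {m} (𝓐 : Fin (suc m) → Interval n) where

    private
      I = 𝓐 zero
      𝓑 = 𝓐 ∘ suc

      -- The levels of `I` other than the least one of each nonempty I_{0,j}; they are what the sum
      -- of the |I_{0,j}| - 1 counts.
      Doubled : Fin n → Set
      Doubled k = k ∈ᴵ I × ∃[ k′ ] (k′ Fin.< k × k′ ∈ᴵ I × SameOwner 𝓑 k′ k)

      doubled? : Decidable Doubled
      doubled? k = (k ∈ᴵ? I) ×-dec Finₚ.any?
        (λ k′ → (k′ Finₚ.<? k) ×-dec ((k′ ∈ᴵ? I) ×-dec sameOwner? 𝓑 k′ k))

      f g : Fin n → ℕ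
      f k = 𝟙 (doubled? k) + 𝟙 (bonded? 𝓐 k)
      g k = 𝟙 (bond? I k) + 𝟙 (bonded? 𝓑 k)

      doubled⇒ : ∀ {k} → Doubled k → Bond I k × Bonded 𝓑 k
      doubled⇒ {k} ((_ , k≤h) , k′ , k′<k , (l≤k′ , _) , s) =
        (ℕₚ.≤-<-trans l≤k′ k′<k , k≤h) , sameOwner-connected 𝓑 s k (inj₁ (k′<k , ℕₚ.≤-refl))

      -- Inclusion and exclusion at one level: a bond of `𝓐` is one of `I` or one of `𝓑`, and a
      -- doubled level is both, because its owner contains a smaller level of `I` and hence the
      -- level just below it.
      f≤g : ∀ k → f k ≤ g k
      f≤g k = go (doubled? k) (bonded? 𝓐 k)
        where
        go : (D : Dec (Doubled k)) (c : Dec (Bonded 𝓐 k)) → 𝟙 D + 𝟙 c ≤ g k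
        go (yes D) c = ℕₚ.≤-trans (ℕₚ.+-monoʳ-≤ 1 (𝟙≤1 c)) (ℕₚ.≤-reflexive (sym (cong₂ _+_
          (𝟙-yes (bond? I k) (proj₁ (doubled⇒ D))) (𝟙-yes (bonded? 𝓑 k) (proj₂ (doubled⇒ D))))))
        go (no _) (no _)              = z≤n
        go (no _) (yes (zero , b))    = ℕₚ.≤-trans (ℕₚ.≤-reflexive (sym (𝟙-yes (bond? I k) b)))
          (ℕₚ.m≤m+n _ _)
        go (no _) (yes (suc j , b))   = ℕₚ.≤-trans
          (ℕₚ.≤-reflexive (sym (𝟙-yes (bonded? 𝓑 k) (j , b)))) (ℕₚ.m≤n+m _ _)

      joint≤doubled : ∑[ j < m ] (joint 𝓐 j ∸ 1) ≤ ∑[ k < n ] 𝟙 (doubled? k)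
      joint≤doubled = ℕₚ.≤-trans (sum-mono (λ j → count-∸1 (λ k → (k ∈ᴵ? I) ×-dec owned? 𝓑 j k)))
        (ℕₚ.≤-trans (ℕₚ.≤-reflexive (∑-comm (λ j k → 𝟙 (rep? j k)))) (sum-mono one-owner))
        where
        Rep : Fin m → Fin n → Set
        Rep j k = (k ∈ᴵ I × Owned 𝓑 j k) × ∃[ k′ ] (k′ Fin.< k × (k′ ∈ᴵ I × Owned 𝓑 j k′))
        rep? : ∀ j k → Dec (Rep j k)
        rep? j k = ((k ∈ᴵ? I) ×-dec owned? 𝓑 j k) ×-dec
          Finₚ.any? (λ k′ → (k′ Finₚ.<? k) ×-dec ((k′ ∈ᴵ? I) ×-dec owned? 𝓑 j k′))
        one-owner : ∀ k → ∑[ j < m ] 𝟙 (rep? j k) ≤ 𝟙 (doubled? k)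
        one-owner k = go (Finₚ.any? (λ j → rep? j k))
          where
          go : Dec (∃[ j ] Rep j k) → ∑[ j < m ] 𝟙 (rep? j k) ≤ 𝟙 (doubled? k)
          go (no ∄) = ℕₚ.≤-trans (ℕₚ.≤-reflexive
            (sum-zero (λ j → 𝟙-no (rep? j k) (λ r → ∄ (j , r))))) z≤n
          go (yes (j , r@((k∈ , o) , k′ , k′<k , k′∈ , o′))) = ℕₚ.≤-trans
            (ℕₚ.≤-reflexive (sum-supported (λ j → 𝟙 (rep? j k)) j
            (λ i i≢j → 𝟙-no (rep? i k) (λ r′ → i≢j (owned-unique 𝓑 i j (proj₂ (proj₁ r′)) o)))))
            (𝟙-mono (λ _ → k∈ , k′ , k′<k , k′∈ , j , o′ , o) (rep? j k) (doubled? k))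

      Σf = sum f
      Σg = sum g
      Σf≡ : Σf ≡ ∑[ k < n ] 𝟙 (doubled? k) + bonds 𝓐
      Σf≡ = ∑-distrib-+ (λ k → 𝟙 (doubled? k)) (λ k → 𝟙 (bonded? 𝓐 k))
      Σg≡ : Σg ≡ width I + bonds 𝓑
      Σg≡ = ∑-distrib-+ (λ k → 𝟙 (bond? I k)) (λ k → 𝟙 (bonded? 𝓑 k))

    joints-step : joints (_∸ 1) 𝓐 + bonds 𝓐 ≤ joints (_∸ 1) 𝓑 + Σf
    joints-step = ℕₚ.≤-trans (ℕₚ.≤-reflexive
      (regroup (∑[ j < m ] (joint 𝓐 j ∸ 1)) (joints (_∸ 1) 𝓑) (bonds 𝓐)))
      (ℕₚ.+-monoʳ-≤ (joints (_∸ 1) 𝓑) (ℕₚ.≤-trans (ℕₚ.+-monoˡ-≤ (bonds 𝓐) joint≤doubled)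
        (ℕₚ.≤-reflexive (sym Σf≡))))
      where
      regroup : ∀ x y z → x + y + z ≡ y + (x + z)
      regroup = ℕ-Solver.solve-∀

    private
      regroup′ : ∀ x y z → x + (y + z) ≡ y + (x + z)
      regroup′ = ℕ-Solver.solve-∀

    joints+bonds≤-suc : joints (_∸ 1) 𝓑 + bonds 𝓑 ≤ ∑[ i < m ] width (𝓑 i) →
      joints (_∸ 1) 𝓐 + bonds 𝓐 ≤ ∑[ i < suc m ] width (𝓐 i)
    joints+bonds≤-suc ih = ℕₚ.≤-trans joints-step
      (ℕₚ.≤-trans (ℕₚ.+-monoʳ-≤ (joints (_∸ 1) 𝓑) (sum-mono f≤g))
      (ℕₚ.≤-trans (ℕₚ.≤-reflexive (trans (cong (_+_ (joints (_∸ 1) 𝓑)) Σg≡)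
        (regroup′ (joints (_∸ 1) 𝓑) (width I) (bonds 𝓑))))
        (ℕₚ.+-monoʳ-≤ (width I) ih)))

    module _ (ih : joints (_∸ 1) 𝓑 + bonds 𝓑 ≤ ∑[ i < m ] width (𝓑 i))
             (tight : ∑[ i < suc m ] width (𝓐 i) ≤ joints (_∸ 1) 𝓐 + bonds 𝓐) where

      tight-suc : ∑[ i < m ] width (𝓑 i) ≤ joints (_∸ 1) 𝓑 + bonds 𝓑
      tight-suc = ℕₚ.+-cancelˡ-≤ (width I) _ _ (ℕₚ.≤-trans tight (ℕₚ.≤-trans joints-step
        (ℕₚ.≤-trans (ℕₚ.+-monoʳ-≤ (joints (_∸ 1) 𝓑) (sum-mono f≤g))
          (ℕₚ.≤-reflexive (trans (cong (_+_ (joints (_∸ 1) 𝓑)) Σg≡)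
            (regroup′ (joints (_∸ 1) 𝓑) (width I) (bonds 𝓑)))))))

      -- Equality of the totals forces `f` and `g` to agree at every level. Where `I` and the other
      -- blocks both bond `k`, `g k` is 2, and `f k` reaches 2 only if `k` is doubled.
      tight-head : ∀ k → Bond I k → Bonded 𝓑 k → ∃[ k′ ] (k′ Fin.< k × k′ ∈ᴵ I × SameOwner 𝓑 k′ k)
      tight-head k b c = go (doubled? k) (sum-pinch f≤g Σg≤Σf k)
        where
        go : (D : Dec (Doubled k)) → 𝟙 D + 𝟙 (bonded? 𝓐 k) ≡ g k → ∃[ k′ ]
          (k′ Fin.< k × k′ ∈ᴵ I × SameOwner 𝓑 k′ k)
        go (yes (_ , r)) _  = r
        go (no _)        eq = contradiction (𝟙≤1 (bonded? 𝓐 k)) (ℕₚ.<⇒≱ (ℕₚ.≤-reflexive (sym (trans eq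
          (cong₂ _+_ (𝟙-yes (bond? I k) b) (𝟙-yes (bonded? 𝓑 k) c))))))
        Σg≤Σf : Σg ≤ Σf
        Σg≤Σf = ℕₚ.+-cancelˡ-≤ (joints (_∸ 1) 𝓑) _ _ (ℕₚ.≤-trans
          (ℕₚ.≤-reflexive (trans (cong (_+_ (joints (_∸ 1) 𝓑)) Σg≡)
            (regroup′ (joints (_∸ 1) 𝓑) (width I) (bonds 𝓑))))
          (ℕₚ.≤-trans (ℕₚ.+-monoʳ-≤ (width I) ih) (ℕₚ.≤-trans tight joints-step)))

  -- Euler characteristic: Σ |J_i| counts every covered level once and every element of each I_{i,j}
  -- once more, so the slack is edges minus vertices plus components of the graph of blocks.
  joints+bonds≤ : ∀ {m} (𝓐 : Fin m → Interval n) → joints (_∸ 1) 𝓐 + bonds 𝓐 ≤ ∑[ i < m ] width (𝓐 i)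
  joints+bonds≤ {zero}  𝓐 = ℕₚ.≤-reflexive (sum-zero (λ k → 𝟙-no (bonded? 𝓐 k) (λ ())))
  joints+bonds≤ {suc m} 𝓐 = joints+bonds≤-suc 𝓐 (joints+bonds≤ (𝓐 ∘ suc))

  tight⇒tree : ∀ {m} (𝓐 : Fin m → Interval n) →
    ∑[ i < m ] width (𝓐 i) ≤ joints (_∸ 1) 𝓐 + bonds 𝓐 → Tree 𝓐
  tight⇒tree {zero}  𝓐 _     = tt
  tight⇒tree {suc m} 𝓐 tight = tight⇒tree (𝓐 ∘ suc) (tight-suc 𝓐 (joints+bonds≤ (𝓐 ∘ suc)) tight)
    , tight-head 𝓐 (joints+bonds≤ (𝓐 ∘ suc)) tight

  -- Descent on the larger level. The forest condition at `y` provides a smaller level `k` of the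
  -- block with the same owner; then `k` is `x`, or the pair `k`, `x` is handled first, its larger
  -- member being below `y`.
  tree-connected : ∀ {m} (𝓐 : Fin (suc m) → Interval n) → Tree 𝓐 → ∀ N {x y} → toℕ y < N → x Fin.< y →
    x ∈ᴵ 𝓐 zero → y ∈ᴵ 𝓐 zero → Connected (𝓐 ∘ suc) x y → SameOwner (𝓐 ∘ suc) x y
  tree-connected 𝓐 tree (suc N) {x} {y} (s≤s y≤N) x<y x∈ y∈ c
    with proj₂ tree y (ℕₚ.≤-<-trans (proj₁ x∈) x<y , proj₂ y∈) (c y (inj₁ (x<y , ℕₚ.≤-refl)))
  ... | k , k<y , k∈ , s with Finₚ.<-cmp k x
  ...   | tri≈ _ refl _ = s
  ...   | tri> _ _ x<k = sameOwner-trans (𝓐 ∘ suc)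
        (tree-connected 𝓐 tree N (ℕₚ.<-≤-trans k<y y≤N) x<k x∈ k∈
          (connected-trans (𝓐 ∘ suc) c (connected-sym (𝓐 ∘ suc) (sameOwner-connected (𝓐 ∘ suc) s)))) s
  ...   | tri< k<x _ _ = sameOwner-trans (𝓐 ∘ suc)
        (sameOwner-sym (𝓐 ∘ suc) (tree-connected 𝓐 tree N (ℕₚ.<-≤-trans x<y y≤N) k<x k∈ x∈
          (connected-trans (𝓐 ∘ suc) (sameOwner-connected (𝓐 ∘ suc) s) (connected-sym (𝓐 ∘ suc) c)))) s

  -- Meet 𝓐 u a b : the paths of a and b through the factors of prod u
  -- pass through a common block.
  Meet : ∀ {m} → (Fin m → Interval n) → (Fin m → 𝔖 n) → Fin n → Fin n → Set
  Meet {zero}  𝓐 u a b = ⊥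
  Meet {suc m} 𝓐 u a b = Meet (𝓐 ∘ suc) (u ∘ suc) a b ⊎
    ((prod (u ∘ suc) ⟨$⟩ʳ a) ∈ᴵ 𝓐 zero × (prod (u ∘ suc) ⟨$⟩ʳ b) ∈ᴵ 𝓐 zero)

  meet-sym : ∀ {m} (𝓐 : Fin m → Interval n) u {a b} → Meet 𝓐 u a b → Meet 𝓐 u b a
  meet-sym {suc m} 𝓐 u (inj₁ t)       = inj₁ (meet-sym (𝓐 ∘ suc) (u ∘ suc) t)
  meet-sym {suc m} 𝓐 u (inj₂ (x , y)) = inj₂ (y , x)

  module _ where

    Factors : ∀ {m} → (Fin m → Interval n) → (Fin m → 𝔖 n) → Set
    Factors 𝓐 u = ∀ i → Within (𝓐 i) (u i)

    path-connected : ∀ {m} (𝓐 : Fin m → Interval n) u → Factors 𝓐 u → ∀ a → Connected 𝓐 a (prod u ⟨$⟩ʳ a)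
    path-connected {zero}  𝓐 u u∈ a k (inj₁ (a<k , k≤a)) = contradiction k≤a (ℕₚ.<⇒≱ a<k)
    path-connected {zero}  𝓐 u u∈ a k (inj₂ (a<k , k≤a)) = contradiction k≤a (ℕₚ.<⇒≱ a<k)
    path-connected {suc m} 𝓐 u u∈ a with (prod (u ∘ suc) ⟨$⟩ʳ a) ∈ᴵ? 𝓐 zero
    ... | yes x∈ = connected-trans 𝓐 (connected-suc 𝓐 (path-connected (𝓐 ∘ suc) (u ∘ suc) (u∈ ∘ suc) a))
                     (block-connected 𝓐 zero x∈ (within-∈ (𝓐 zero) (u zero) (u∈ zero) x∈))
    ... | no x∉  = subst (Connected 𝓐 a) (sym (u∈ zero _ x∉))
                     (connected-suc 𝓐 (path-connected (𝓐 ∘ suc) (u ∘ suc) (u∈ ∘ suc) a))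

    meet-connected : ∀ {m} (𝓐 : Fin m → Interval n) u → Factors 𝓐 u → ∀ {a b} → Meet 𝓐 u a b →
      Connected 𝓐 a b
    meet-connected {suc m} 𝓐 u u∈ (inj₁ t) = connected-suc 𝓐
      (meet-connected (𝓐 ∘ suc) (u ∘ suc) (u∈ ∘ suc) t)
    meet-connected {suc m} 𝓐 u u∈ {a} {b} (inj₂ (x∈ , y∈)) =
      connected-trans 𝓐 (connected-suc 𝓐 (path-connected (𝓐 ∘ suc) (u ∘ suc) (u∈ ∘ suc) a))
      (connected-trans 𝓐 (block-connected 𝓐 zero x∈ y∈)
        (connected-sym 𝓐 (connected-suc 𝓐 (path-connected (𝓐 ∘ suc) (u ∘ suc) (u∈ ∘ suc) b))))

    -- After the owner no block contains the level, so both wires run straight back to the owner,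
    -- where the paths were together.
    owner-meet : ∀ {m} (𝓐 : Fin m → Interval n) u → Factors 𝓐 u → ∀ {a b} →
      SameOwner 𝓐 (prod u ⟨$⟩ʳ a) (prod u ⟨$⟩ʳ b) → Meet 𝓐 u a b
    owner-meet {suc m} 𝓐 u u∈ (zero , x∈ , y∈) =
      inj₂ (within-∈⁻¹ (𝓐 zero) (u zero) (u∈ zero) x∈ , within-∈⁻¹ (𝓐 zero) (u zero) (u∈ zero) y∈)
    owner-meet {suc m} 𝓐 u u∈ {a} {b} (suc j , (x∉ , o) , (y∉ , o′)) =
      inj₁ (owner-meet (𝓐 ∘ suc) (u ∘ suc) (u∈ ∘ suc) (j
        , subst (Owned (𝓐 ∘ suc) j) (u∈ zero _ (x∉ ∘ within-∈ (𝓐 zero) (u zero) (u∈ zero))) o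
        , subst (Owned (𝓐 ∘ suc) j) (u∈ zero _ (y∉ ∘ within-∈ (𝓐 zero) (u zero) (u∈ zero))) o′))

    -- Some factor reverses the order of the two paths, and a factor can invert only levels of its
    -- own interval.
    inversion-meet : ∀ {m} (𝓐 : Fin m → Interval n) u → Factors 𝓐 u → ∀ {a b} → Inversion (prod u) a
      b → Meet 𝓐 u a b
    inversion-meet {zero}  𝓐 u u∈ (a<b , b<a) = contradiction b<a (ℕₚ.<-asym a<b)
    inversion-meet {suc m} 𝓐 u u∈ {a} {b} (a<b , lt)
      with perm-<-or-> (prod (u ∘ suc)) (<⇒≢ {n} {a} {b} a<b)
    ... | inj₂ gt = inj₁ (inversion-meet (𝓐 ∘ suc) (u ∘ suc) (u∈ ∘ suc) (a<b , gt))
    ... | inj₁ x<y = inj₂ (within-inversion (𝓐 zero) (u zero) (u∈ zero) (x<y , lt))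

    -- Two paths which are already linked through other blocks can share a
    -- further block of a forest only if they have met before.
    remeet : ∀ {m} (𝓐 : Fin (suc m) → Interval n) u → Factors (𝓐 ∘ suc) u → Tree 𝓐 → ∀ {a b} → a ≢ b →
      (prod u ⟨$⟩ʳ a) ∈ᴵ 𝓐 zero → (prod u ⟨$⟩ʳ b) ∈ᴵ 𝓐 zero → Connected (𝓐 ∘ suc) a b → Meet
        (𝓐 ∘ suc) u a b
    remeet 𝓐 u u∈ tree {a} {b} a≢b x∈ y∈ c = go (Finₚ.<-cmp (prod u ⟨$⟩ʳ a) (prod u ⟨$⟩ʳ b))
      where
      𝓑 = 𝓐 ∘ suc
      cxy : Connected 𝓑 (prod u ⟨$⟩ʳ a) (prod u ⟨$⟩ʳ b)
      cxy = connected-trans 𝓑 (connected-sym 𝓑 (path-connected 𝓑 u u∈ a))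
        (connected-trans 𝓑 c (path-connected 𝓑 u u∈ b))
      go : _ → Meet 𝓑 u a b
      go (tri< x<y _ _) = owner-meet 𝓑 u u∈ (tree-connected 𝓐 tree _ ℕₚ.≤-refl x<y x∈ y∈ cxy)
      go (tri> _ _ y<x) = meet-sym 𝓑 u (owner-meet 𝓑 u u∈
        (tree-connected 𝓐 tree _ ℕₚ.≤-refl y<x y∈ x∈ (connected-sym 𝓑 cxy)))
      go (tri≈ _ eq _)  = contradiction (perm-injective (prod u) eq) a≢b

    -- If two of the four meetings take place in block 0, then `a` and `b`, or `c` and `d`, share
    -- this block. If only one does, the other three link its two paths through the remaining
    -- blocks, and `remeet` replaces it by an earlier meeting.
    no-square : ∀ {m} (𝓐 : Fin m → Interval n) u → Factors 𝓐 u → Tree 𝓐 → ∀ {a b c d} →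
      a ≢ c → a ≢ d → b ≢ c → b ≢ d → ¬ Meet 𝓐 u a b → ¬ Meet 𝓐 u c d →
      Meet 𝓐 u a c → Meet 𝓐 u a d → Meet 𝓐 u b c → Meet 𝓐 u b d → ⊥
    no-square {suc m} 𝓐 u u∈ tree {a} {b} {c} {d} a≢c a≢d b≢c b≢d ¬ab ¬cd = cases
      where
      𝓑 = 𝓐 ∘ suc
      v = u ∘ suc
      v∈ : Factors 𝓑 v
      v∈ = u∈ ∘ suc
      M = Meet 𝓑 v
      C = Connected 𝓑
      mc : ∀ {a b} → M a b → C a b
      mc = meet-connected 𝓑 v v∈
      sy : ∀ {a b} → C a b → C b a
      sy = connected-sym 𝓑
      infixr 5 _⨟_
      _⨟_ : ∀ {a b c} → C a b → C b c → C a c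
      _⨟_ = connected-trans 𝓑
      again : ∀ {a b} → a ≢ b → (prod v ⟨$⟩ʳ a) ∈ᴵ 𝓐 zero × (prod v ⟨$⟩ʳ b) ∈ᴵ 𝓐 zero → C a b → M a b
      again a≢b (x∈ , y∈) = remeet 𝓐 v v∈ tree a≢b x∈ y∈
      done′ : M a c → M a d → M b c → M b d → ⊥
      done′ = no-square 𝓑 v v∈ (proj₁ tree) a≢c a≢d b≢c b≢d (¬ab ∘ inj₁) (¬cd ∘ inj₁)
      cases : Meet 𝓐 u a c → Meet 𝓐 u a d → Meet 𝓐 u b c → Meet 𝓐 u b d → ⊥
      cases (inj₁ ac) (inj₁ ad) (inj₁ bc) (inj₁ bd) = done′ ac ad bc bd
      cases (inj₂ (_ , z)) (inj₂ (_ , t)) _ _ = ¬cd (inj₂ (z , t))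
      cases _ _ (inj₂ (_ , z)) (inj₂ (_ , t)) = ¬cd (inj₂ (z , t))
      cases (inj₂ (x , _)) _ (inj₂ (y , _)) _ = ¬ab (inj₂ (x , y))
      cases _ (inj₂ (x , _)) _ (inj₂ (y , _)) = ¬ab (inj₂ (x , y))
      cases (inj₂ (x , _)) _ _ (inj₂ (y , _)) = ¬ab (inj₂ (x , y))
      cases _ (inj₂ (x , _)) (inj₂ (y , _)) _ = ¬ab (inj₂ (x , y))
      cases (inj₂ h) (inj₁ ad) (inj₁ bc) (inj₁ bd) = done′
        (again a≢c h (mc ad ⨟ sy (mc bd) ⨟ mc bc)) ad bc bd
      cases (inj₁ ac) (inj₂ h) (inj₁ bc) (inj₁ bd) = done′ ac
        (again a≢d h (mc ac ⨟ sy (mc bc) ⨟ mc bd)) bc bd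
      cases (inj₁ ac) (inj₁ ad) (inj₂ h) (inj₁ bd) = done′ ac ad
        (again b≢c h (mc bd ⨟ sy (mc ad) ⨟ mc ac)) bd
      cases (inj₁ ac) (inj₁ ad) (inj₁ bc) (inj₂ h) = done′ ac ad bc
        (again b≢d h (mc bc ⨟ sy (mc ac) ⨟ mc ad))

-- Counting meetings of paths

pairsOf : ℕ → ℕ
pairsOf c = c * (c ∸ 1)

module _ {n : ℕ} where

  ∑∑-distrib-+ : ∀ (f g : Fin n → Fin n → ℕ) →
    ∑[ a < n ] ∑[ b < n ] (f a b + g a b) ≡ ∑[ a < n ] ∑[ b < n ] f a b + ∑[ a < n ] ∑[ b < n ] g a b
  ∑∑-distrib-+ f g = trans (sum-cong-≗ (λ a → ∑-distrib-+ (f a) (g a))) (∑-distrib-+ (sum ∘ f) (sum ∘ g))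

  ∑∑-pinch : ∀ {f g : Fin n → Fin n → ℕ} → (∀ a b → f a b ≤ g a b) →
    ∑[ a < n ] ∑[ b < n ] g a b ≤ ∑[ a < n ] ∑[ b < n ] f a b → ∀ a b → f a b ≡ g a b
  ∑∑-pinch f≤g Σg≤Σf a = sum-pinch (f≤g a)
    (ℕₚ.≤-reflexive (sym (sum-pinch (λ a → sum-mono (f≤g a)) Σg≤Σf a)))

  pair? : ∀ (I : Interval n) k k′ → Dec (k ≢ k′ × (k ∈ᴵ I × k′ ∈ᴵ I))
  pair? I k k′ = ¬? (k Finₚ.≟ k′) ×-dec ((k ∈ᴵ? I) ×-dec (k′ ∈ᴵ? I))

  pairs : Interval n → ℕ
  pairs I = ∑[ k < n ] ∑[ k′ < n ] 𝟙 (pair? I k k′)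

  Event : ∀ {m} → (Fin (suc m) → Interval n) → Fin n → Fin n → Set
  Event 𝓐 k k′ = (k ≢ k′ × (k ∈ᴵ 𝓐 zero × k′ ∈ᴵ 𝓐 zero)) × ¬ SameOwner (𝓐 ∘ suc) k k′

  event? : ∀ {m} (𝓐 : Fin (suc m) → Interval n) k k′ → Dec (Event 𝓐 k k′)
  event? 𝓐 k k′ = pair? (𝓐 zero) k k′ ×-dec ¬? (sameOwner? (𝓐 ∘ suc) k k′)

  -- The number of times the paths of a and b come together.
  meetings : ∀ {m} → (Fin m → Interval n) → (Fin m → 𝔖 n) → Fin n → Fin n → ℕ
  meetings {zero}  𝓐 u a b = 0
  meetings {suc m} 𝓐 u a b =
    𝟙 (event? 𝓐 (prod (u ∘ suc) ⟨$⟩ʳ a) (prod (u ∘ suc) ⟨$⟩ʳ b)) + meetings (𝓐 ∘ suc) (u ∘ suc) a b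

  -- A pair of levels of block 0 either comes together there or arrives from a common owner. Pairs
  -- of the second kind, sorted by owner, are the ordered pairs inside the I_{0,j}.
  head-meetings : ∀ {m} (𝓐 : Fin (suc m) → Interval n) →
    ∑[ k < n ] ∑[ k′ < n ] 𝟙 (event? 𝓐 k k′) + ∑[ j < m ] pairsOf (joint 𝓐 j) ≡ pairs (𝓐 zero)
  head-meetings {m} 𝓐 = trans (cong (_+_ (∑[ k < n ] ∑[ k′ < n ] 𝟙 (event? 𝓐 k k′))) together)
    (trans (sym (∑∑-distrib-+ _ _)) (∑∑-cong (λ k k′ → split (pair? I k k′) (sameOwner? 𝓑 k k′))))
    where
    I = 𝓐 zero
    𝓑 = 𝓐 ∘ suc
    split : ∀ {a b} {A : Set a} {B : Set b} (d : Dec A) (d′ : Dec B) → 𝟙 (d ×-dec ¬? d′) + 𝟙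
      (d ×-dec d′) ≡ 𝟙 d
    split (no _)  _       = refl
    split (yes _) (yes _) = refl
    split (yes _) (no _)  = refl
    own? : ∀ j k → Dec (k ∈ᴵ I × Owned 𝓑 j k)
    own? j k = (k ∈ᴵ? I) ×-dec owned? 𝓑 j k
    both? : ∀ j k k′ → Dec (k ≢ k′ × ((k ∈ᴵ I × Owned 𝓑 j k) × (k′ ∈ᴵ I × Owned 𝓑 j k′)))
    both? j k k′ = ¬? (k Finₚ.≟ k′) ×-dec (own? j k ×-dec own? j k′)
    one : ∀ k k′ → ∑[ j < m ] 𝟙 (both? j k k′) ≡ 𝟙 (pair? I k k′ ×-dec sameOwner? 𝓑 k k′)
    one k k′ = go (Finₚ.any? (λ j → both? j k k′))
      where
      go : Dec _ → ∑[ j < m ] 𝟙 (both? j k k′) ≡ 𝟙 (pair? I k k′ ×-dec sameOwner? 𝓑 k k′)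
      go (no ∄) = trans (sum-zero (λ j → 𝟙-no (both? j k k′) (λ b → ∄ (j , b))))
        (sym (𝟙-no (pair? I k k′ ×-dec sameOwner? 𝓑 k k′)
          (λ ((≢ , k∈ , k′∈) , j , o , o′) → ∄ (j , ≢ , (k∈ , o) , k′∈ , o′))))
      go (yes (j , ≢ , (k∈ , o) , k′∈ , o′)) = trans (sum-supported (λ j → 𝟙 (both? j k k′)) j
          (λ i i≢j → 𝟙-no (both? i k k′) (λ (_ , (_ , p) , _) → i≢j (owned-unique 𝓑 i j p o))))
        (trans (𝟙-yes (both? j k k′) (≢ , (k∈ , o) , k′∈ , o′))
        (sym (𝟙-yes (pair? I k k′ ×-dec sameOwner? 𝓑 k k′) ((≢ , k∈ , k′∈) , j , o , o′))))
    together : ∑[ j < m ] pairsOf (joint 𝓐 j) ≡ ∑[ k < n ] ∑[ k′ < n ] 𝟙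
      (pair? I k k′ ×-dec sameOwner? 𝓑 k k′)
    together = trans (sum-cong-≗ (λ j → count-pairs (own? j)))
      (trans (∑-comm (λ j k → ∑[ k′ < n ] 𝟙 (both? j k k′)))
      (sum-cong-≗ (λ k → trans (∑-comm (λ j k′ → 𝟙 (both? j k k′))) (sum-cong-≗ (one k)))))

  -- Just before each block the paths occupy every level once, so summing over paths is summing over
  -- levels. The total therefore depends on the intervals alone.
  total-meetings : ∀ {m} (𝓐 : Fin m → Interval n) u →
    ∑[ a < n ] ∑[ b < n ] meetings 𝓐 u a b + joints pairsOf 𝓐 ≡ ∑[ i < m ] pairs (𝓐 i)
  total-meetings {zero}  𝓐 u = trans (ℕₚ.+-identityʳ _) (sum-zero {n} (λ a → sum-zero {n} (λ b → refl)))
  total-meetings {suc m} 𝓐 u = begin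
    ∑[ a < n ] ∑[ b < n ] meetings 𝓐 u a b + (S₀ + joints pairsOf 𝓑)
      ≡⟨ cong (_+ (S₀ + joints pairsOf 𝓑))
        (∑∑-distrib-+ (λ a b → 𝟙 (event? 𝓐 (v ⟨$⟩ʳ a) (v ⟨$⟩ʳ b))) (meetings 𝓑 (u ∘ suc))) ⟩
    ∑[ a < n ] ∑[ b < n ] 𝟙 (event? 𝓐 (v ⟨$⟩ʳ a) (v ⟨$⟩ʳ b)) + E + (S₀ + joints pairsOf 𝓑)
      ≡⟨ cong (λ x → x + E + (S₀ + joints pairsOf 𝓑)) (∑∑-permute (λ k k′ → 𝟙 (event? 𝓐 k k′)) v) ⟨
    ∑[ k < n ] ∑[ k′ < n ] 𝟙 (event? 𝓐 k k′) + E + (S₀ + joints pairsOf 𝓑)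
      ≡⟨ regroup (∑[ k < n ] ∑[ k′ < n ] 𝟙 (event? 𝓐 k k′)) E S₀ (joints pairsOf 𝓑) ⟩
    (∑[ k < n ] ∑[ k′ < n ] 𝟙 (event? 𝓐 k k′) + S₀) + (E + joints pairsOf 𝓑)
      ≡⟨ cong₂ _+_ (head-meetings 𝓐) (total-meetings 𝓑 (u ∘ suc)) ⟩
    pairs (𝓐 zero) + ∑[ i < m ] pairs (𝓑 i) ∎
    where
    open ≡-Reasoning
    𝓑 = 𝓐 ∘ suc
    v = prod (u ∘ suc)
    S₀ = ∑[ j < m ] pairsOf (joint 𝓐 j)
    E = ∑[ a < n ] ∑[ b < n ] meetings 𝓑 (u ∘ suc) a b
    regroup : ∀ x y z t → x + y + (z + t) ≡ x + z + (y + t)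
    regroup = ℕ-Solver.solve-∀

  -- Sharing a block is either a new event or, when the two wires have the same owner, evidence of
  -- an earlier one.
  meet⇒meetings : ∀ {m} (𝓐 : Fin m → Interval n) u → Factors 𝓐 u → ∀ {a b} → a ≢ b → Meet 𝓐 u a b →
    1 ≤ meetings 𝓐 u a b
  meet⇒meetings {suc m} 𝓐 u u∈ a≢b (inj₁ t) =
    ℕₚ.≤-trans (meet⇒meetings (𝓐 ∘ suc) (u ∘ suc) (u∈ ∘ suc) a≢b t) (ℕₚ.m≤n+m _ _)
  meet⇒meetings {suc m} 𝓐 u u∈ {a} {b} a≢b (inj₂ xy∈) =
    go (sameOwner? (𝓐 ∘ suc) (prod (u ∘ suc) ⟨$⟩ʳ a) (prod (u ∘ suc) ⟨$⟩ʳ b))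
    where
    go : Dec (SameOwner (𝓐 ∘ suc) (prod (u ∘ suc) ⟨$⟩ʳ a) (prod (u ∘ suc) ⟨$⟩ʳ b)) → 1 ≤ meetings 𝓐 u a b
    go (yes s) = ℕₚ.≤-trans (meet⇒meetings (𝓐 ∘ suc) (u ∘ suc) (u∈ ∘ suc) a≢b
      (owner-meet (𝓐 ∘ suc) (u ∘ suc) (u∈ ∘ suc) s)) (ℕₚ.m≤n+m _ _)
    go (no ¬s) = ℕₚ.≤-trans (ℕₚ.≤-reflexive
      (sym (𝟙-yes (event? 𝓐 (prod (u ∘ suc) ⟨$⟩ʳ a) (prod (u ∘ suc) ⟨$⟩ʳ b))
      ((a≢b ∘ perm-injective (prod (u ∘ suc)) , xy∈) , ¬s)))) (ℕₚ.m≤m+n _ _)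

  double-ℓ : ∀ (w : 𝔖 n) → 2 * ℓ w ≡ ∑[ a < n ] ∑[ b < n ] (𝟙 (inversion? w a b) + 𝟙 (inversion? w b a))
  double-ℓ w = trans (twice (ℓ w)) (trans
    (cong₂ _+_ (ℓ≡∑∑ w) (trans (ℓ≡∑∑ w) (∑-comm (λ a b → 𝟙 (inversion? w a b)))))
    (sym (∑∑-distrib-+ (λ a b → 𝟙 (inversion? w a b)) (λ a b → 𝟙 (inversion? w b a)))))
    where
    twice : ∀ x → 2 * x ≡ x + x
    twice = ℕ-Solver.solve-∀

  -- When the lengths add up, the inverted pairs use up all the meetings.
  noninversion-no-meet : ∀ {m} (𝓐 : Fin m → Interval n) u → Factors 𝓐 u →
    ∑[ i < m ] pairs (𝓐 i) ≡ 2 * ℓ (prod u) + joints pairsOf 𝓐 →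
    ∀ {a b} → a Fin.< b → (prod u ⟨$⟩ʳ a) Fin.< (prod u ⟨$⟩ʳ b) → ¬ Meet 𝓐 u a b
  noninversion-no-meet {m} 𝓐 u u∈ eq {a} {b} a<b wa<wb meet = ℕₚ.<⇒≱
    (meet⇒meetings 𝓐 u u∈ (<⇒≢ {n} {a} {b} a<b) meet)
    (ℕₚ.≤-reflexive (trans (sym (∑∑-pinch inv≤ total≤ a b)) (cong₂ _+_
      (𝟙-no (inversion? w a b) (λ (_ , gt) → ℕₚ.<-asym wa<wb gt))
      (𝟙-no (inversion? w b a) (λ (b<a , _) → ℕₚ.<-asym a<b b<a)))))
    where
    w = prod u
    inv≤ : ∀ a b → 𝟙 (inversion? w a b) + 𝟙 (inversion? w b a) ≤ meetings 𝓐 u a b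
    inv≤ a b = go (inversion? w a b) (inversion? w b a)
      where
      go : (d : Dec (Inversion w a b)) (d′ : Dec (Inversion w b a)) → 𝟙 d + 𝟙 d′ ≤ meetings 𝓐 u a b
      go (yes (a<b , _)) (yes (b<a , _)) = contradiction b<a (ℕₚ.<-asym a<b)
      go (yes inv) (no _)  = meet⇒meetings 𝓐 u u∈ (<⇒≢ {n} {a} {b} (proj₁ inv))
        (inversion-meet 𝓐 u u∈ inv)
      go (no _)  (yes inv) = meet⇒meetings 𝓐 u u∈ (<⇒≢ {n} {b} {a} (proj₁ inv) ∘ sym)
        (meet-sym 𝓐 u (inversion-meet 𝓐 u u∈ inv))
      go (no _)  (no _)    = z≤n
    total≤ : ∑[ a < n ] ∑[ b < n ] meetings 𝓐 u a b ≤ ∑[ a < n ] ∑[ b < n ]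
      (𝟙 (inversion? w a b) + 𝟙 (inversion? w b a))
    total≤ = ℕₚ.≤-reflexive (trans (ℕₚ.+-cancelʳ-≡ (joints pairsOf 𝓐) _ _
      (trans (total-meetings 𝓐 u) eq)) (double-ℓ w))

  -- The reversal of an interval

  reflect-inside : ∀ (I : Interval n) {k} → k ∈ᴵ I → toℕ (reflect I k) ≡ toℕ (lo I) + toℕ (hi I) ∸ toℕ k
  reflect-inside I {k} k∈ with k ∈ᴵ? I
  ... | yes (l≤k , _) = Finₚ.toℕ-fromℕ< _
  ... | no k∉         = contradiction k∈ k∉

  within-reversal : ∀ (I : Interval n) → Within I (reversal I)
  within-reversal I k k∉ with k ∈ᴵ? I
  ... | yes k∈ = contradiction k∈ k∉
  ... | no _   = refl

  reversal-inverts : ∀ (I : Interval n) {a b} → a Fin.< b → a ∈ᴵ I → b ∈ᴵ I → Inversion (reversal I) a b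
  reversal-inverts I {a} {b} a<b a∈ b∈ = a<b , subst₂ _<_ (sym (reflect-inside I b∈))
    (sym (reflect-inside I a∈))
    (ℕₚ.∸-monoʳ-< a<b (ℕₚ.≤-trans (proj₂ b∈) (ℕₚ.m≤n+m _ _)))

  pairs≡2ℓ : ∀ (I : Interval n) → pairs I ≡ 2 * ℓ (reversal I)
  pairs≡2ℓ I = trans (∑∑-cong pointwise) (sym (double-ℓ (reversal I)))
    where
    r = reversal I
    split : ∀ {a b} → a Fin.< b → 𝟙 (pair? I a b) ≡ 𝟙 (inversion? r a b) × 0 ≡ 𝟙 (inversion? r b a)
    split {a} {b} a<b =
        𝟙-cong (λ (_ , a∈ , b∈) → reversal-inverts I a<b a∈ b∈)
          (λ inv → <⇒≢ {n} {a} {b} a<b , within-inversion I r (within-reversal I) inv)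
          (pair? I a b) (inversion? r a b)
      , sym (𝟙-no (inversion? r b a) (λ (b<a , _) → ℕₚ.<-asym a<b b<a))
    pointwise : ∀ a b → 𝟙 (pair? I a b) ≡ 𝟙 (inversion? r a b) + 𝟙 (inversion? r b a)
    pointwise a b with Finₚ.<-cmp a b
    ... | tri< a<b _ _ = trans (sym (ℕₚ.+-identityʳ _))
          (cong₂ _+_ (proj₁ (split a<b)) (proj₂ (split a<b)))
    ... | tri> _ _ b<a = trans (𝟙-cong (λ (≢ , a∈ , b∈) → ≢ ∘ sym , b∈ , a∈)
          (λ (≢ , b∈ , a∈) → ≢ ∘ sym , a∈ , b∈)
            (pair? I a b) (pair? I b a)) (cong₂ _+_ (proj₂ (split b<a)) (proj₁ (split b<a)))
    ... | tri≈ _ refl _ = trans (𝟙-no (pair? I a a) (λ (≢ , _) → ≢ refl))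
            (sym (cong₂ _+_ (𝟙-no (inversion? r a a) (ℕₚ.<-irrefl refl ∘ proj₁))
              (𝟙-no (inversion? r a a) (ℕₚ.<-irrefl refl ∘ proj₁))))

-- Sizes of the sets I_{i,j}

∣∣≡∑ : ∀ {n} (p : Subset n) → ∣ p ∣ ≡ ∑[ k < n ] 𝟙 (k Subsetₚ.∈? p)
∣∣≡∑ []            = refl
∣∣≡∑ (inside ∷ p)  = cong suc (∣∣≡∑ p)
∣∣≡∑ (outside ∷ p) = ∣∣≡∑ p

x∈p─q⇒x∉q : ∀ {n} (p q : Subset n) {x} → x ∈ˢ p ─ q → x ∉ˢ q
x∈p─q⇒x∉q (_ ∷ p)       (_ ∷ q)       (there x∈) (there x∈q) = x∈p─q⇒x∉q p q x∈ x∈q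
x∈p─q⇒x∉q (inside ∷ p)  (inside ∷ q)  ()         here
x∈p─q⇒x∉q (outside ∷ p) (inside ∷ q)  ()         here

x∈⋃⁺ : ∀ {n} {ps : List (Subset n)} {p x} → p ∈ ps → x ∈ˢ p → x ∈ˢ ⋃ ps
x∈⋃⁺ {ps = p ∷ ps} (here refl)  x∈p = Subsetₚ.x∈p∪q⁺ {p = p} {q = ⋃ ps} (inj₁ x∈p)
x∈⋃⁺ {ps = q ∷ ps} (there p∈ps) x∈p = Subsetₚ.x∈p∪q⁺ {p = q} {q = ⋃ ps} (inj₂ (x∈⋃⁺ p∈ps x∈p))

x∈⋃⁻ : ∀ {n} (ps : List (Subset n)) {x} → x ∈ˢ ⋃ ps → ∃[ p ] (p ∈ ps × x ∈ˢ p)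
x∈⋃⁻ []       x∈ = contradiction x∈ Subsetₚ.∉⊥
x∈⋃⁻ (p ∷ ps) x∈ with Subsetₚ.x∈p∪q⁻ p (⋃ ps) x∈
... | inj₁ x∈p = p , here refl , x∈p
... | inj₂ x∈⋃ with x∈⋃⁻ ps x∈⋃
...   | q , q∈ps , x∈q = q , there q∈ps , x∈q

module _ {n : ℕ} where

  ∈toSubset⁺ : ∀ {I : Interval n} {k} → k ∈ᴵ I → k ∈ˢ toSubset I
  ∈toSubset⁺ {I} {k} k∈ = Vecₚ.lookup⇒[]= k (toSubset I)
    (trans (Vecₚ.lookup∘tabulate _ k) (dec-true (k ∈ᴵ? I) k∈))

  ∈toSubset⁻ : ∀ {I : Interval n} {k} → k ∈ˢ toSubset I → k ∈ᴵ I
  ∈toSubset⁻ {I} {k} k∈ = go (k ∈ᴵ? I)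
    (trans (sym (Vecₚ.lookup∘tabulate (λ k → does (k ∈ᴵ? I)) k)) (Vecₚ.[]=⇒lookup k∈))
    where
    go : (d : Dec (k ∈ᴵ I)) → does d ≡ true → k ∈ᴵ I
    go (yes k∈) _ = k∈

  Shared : ∀ {m} → (Fin m → Interval n) → Fin m → Fin m → Fin n → Set
  Shared 𝓐 i j k = (k ∈ᴵ 𝓐 i × k ∈ᴵ 𝓐 j) × (∀ l → i Fin.< l → l Fin.< j → ¬ (k ∈ᴵ 𝓐 l))

  module _ {m} (𝓐 : Fin m → Interval n) (i j : Fin m) where

    private
      Between : Fin m → Set
      Between l = i Fin.< l × l Fin.< j

      between? : Decidable Between
      between? l = (i Finₚ.<? l) ×-dec (l Finₚ.<? j)

      others = List.map (toSubset ∘ 𝓐) (filter between? (allFin m))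

    ∈common⇒shared : ∀ {k} → k ∈ˢ common 𝓐 i j → Shared 𝓐 i j k
    ∈common⇒shared {k} k∈ =
        (∈toSubset⁻ {𝓐 i} (proj₁ ij) , ∈toSubset⁻ {𝓐 j} (proj₂ ij))
      , λ l i<l l<j k∈l → x∈p─q⇒x∉q (toSubset (𝓐 i) ∩ toSubset (𝓐 j)) (⋃ others) k∈
          (x∈⋃⁺ (∈-map⁺ (toSubset ∘ 𝓐) (∈-filter⁺ between? (∈-allFin l) (i<l , l<j)))
            (∈toSubset⁺ {𝓐 l} k∈l))
      where
      ij = Subsetₚ.x∈p∩q⁻ (toSubset (𝓐 i)) (toSubset (𝓐 j)) (Subsetₚ.p─q⊆p _ (⋃ others) k∈)

    shared⇒∈common : ∀ {k} → Shared 𝓐 i j k → k ∈ˢ common 𝓐 i j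
    shared⇒∈common {k} ((k∈i , k∈j) , k∉) = Subsetₚ.x∈p∧x∉q⇒x∈p─q
      (Subsetₚ.x∈p∩q⁺ {p = toSubset (𝓐 i)} {q = toSubset (𝓐 j)}
        (∈toSubset⁺ {𝓐 i} k∈i , ∈toSubset⁺ {𝓐 j} k∈j)) k∉⋃
      where
      k∉⋃ : k ∉ˢ ⋃ others
      k∉⋃ k∈⋃ with x∈⋃⁻ others k∈⋃
      ... | p , p∈ , k∈p with ∈-map⁻ (toSubset ∘ 𝓐) p∈
      ...   | l , l∈ , refl with ∈-filter⁻ between? {xs = allFin m} l∈
      ...     | _ , i<l , l<j = k∉ l i<l l<j (∈toSubset⁻ {𝓐 l} k∈p)

  owned⇒ : ∀ {m} (𝓐 : Fin m → Interval n) j {k} → Owned 𝓐 j k → ∀ l → l Fin.< j → ¬ (k ∈ᴵ 𝓐 l)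
  owned⇒ 𝓐 (suc j) (k∉ , o) zero    _         = k∉
  owned⇒ 𝓐 (suc j) (k∉ , o) (suc l) (s≤s l<j) = owned⇒ (𝓐 ∘ suc) j o l l<j

  owned⇐ : ∀ {m} (𝓐 : Fin m → Interval n) j {k} → k ∈ᴵ 𝓐 j → (∀ l → l Fin.< j → ¬ (k ∈ᴵ 𝓐 l)) →
    Owned 𝓐 j k
  owned⇐ 𝓐 zero    k∈ _  = k∈
  owned⇐ 𝓐 (suc j) k∈ k∉ = k∉ zero (s≤s z≤n) , owned⇐ (𝓐 ∘ suc) j k∈ (λ l l<j → k∉ (suc l) (s≤s l<j))

  common-head : ∀ {m} (𝓐 : Fin (suc m) → Interval n) j → ∣ common 𝓐 zero (suc j) ∣ ≡ joint 𝓐 j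
  common-head 𝓐 j = trans (∣∣≡∑ (common 𝓐 zero (suc j))) (sum-cong-≗ (λ k → 𝟙-cong
    (λ k∈ → let (k∈0 , k∈j) , k∉ = ∈common⇒shared 𝓐 zero (suc j) k∈ in
      k∈0 , owned⇐ (𝓐 ∘ suc) j k∈j (λ l l<j → k∉ (suc l) (s≤s z≤n) (s≤s l<j)))
    (λ (k∈0 , o) → shared⇒∈common 𝓐 zero (suc j) ((k∈0 , owned⇒∈ (𝓐 ∘ suc) j o)
      , λ { (suc l) _ (s≤s l<j) → owned⇒ (𝓐 ∘ suc) j o l l<j }))
    (k Subsetₚ.∈? common 𝓐 zero (suc j)) ((k ∈ᴵ? 𝓐 zero) ×-dec owned? (𝓐 ∘ suc) j k)))

  common-tail : ∀ {m} (𝓐 : Fin (suc m) → Interval n) i j → ∣ common 𝓐 (suc i) (suc j) ∣ ≡ ∣ common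
    (𝓐 ∘ suc) i j ∣
  common-tail 𝓐 i j = trans (∣∣≡∑ (common 𝓐 (suc i) (suc j))) (trans (sum-cong-≗ (λ k → 𝟙-cong
    (λ k∈ → let ij , k∉ = ∈common⇒shared 𝓐 (suc i) (suc j) k∈ in
      shared⇒∈common (𝓐 ∘ suc) i j (ij , λ l i<l l<j → k∉ (suc l) (s≤s i<l) (s≤s l<j)))
    (λ k∈ → let ij , k∉ = ∈common⇒shared (𝓐 ∘ suc) i j k∈ in
      shared⇒∈common 𝓐 (suc i) (suc j) (ij , λ { (suc l) (s≤s i<l) (s≤s l<j) → k∉ l i<l l<j }))
    (k Subsetₚ.∈? common 𝓐 (suc i) (suc j)) (k Subsetₚ.∈? common (𝓐 ∘ suc) i j)))
    (sym (∣∣≡∑ (common (𝓐 ∘ suc) i j))))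

  ∑∑-common : ∀ (h : ℕ → ℕ) {m} (𝓐 : Fin m → Interval n) →
    ∑[ i < m ] ∑[ j < m ] (𝟙 (i Finₚ.<? j) * h ∣ common 𝓐 i j ∣) ≡ joints h 𝓐
  ∑∑-common h {zero}  𝓐 = refl
  ∑∑-common h {suc m} 𝓐 = cong₂ _+_
    (sum-cong-≗ (λ j → trans (ℕₚ.*-identityˡ _) (cong h (common-head 𝓐 j))))
    (trans (sum-cong-≗ (λ i → sum-cong-≗ (λ j → cong (λ x → 𝟙 (i Finₚ.<? j) * h x) (common-tail 𝓐 i j))))
      (∑∑-common h (𝓐 ∘ suc)))

-- Patterns

quad : ∀ {n} → Fin n → Fin n → Fin n → Fin n → Fin 4 → Fin n
quad a b c d 0F = a
quad a b c d 1F = b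
quad a b c d 2F = c
quad a b c d 3F = d

quad-mono : ∀ {n} {a b c d : Fin n} → a Fin.< b → b Fin.< c → c Fin.< d →
  ∀ {i j} → i Fin.< j → quad a b c d i Fin.< quad a b c d j
quad-mono a<b b<c c<d {0F} {1F} _ = a<b
quad-mono a<b b<c c<d {0F} {2F} _ = ℕₚ.<-trans a<b b<c
quad-mono a<b b<c c<d {0F} {3F} _ = ℕₚ.<-trans a<b (ℕₚ.<-trans b<c c<d)
quad-mono a<b b<c c<d {1F} {2F} _ = b<c
quad-mono a<b b<c c<d {1F} {3F} _ = ℕₚ.<-trans b<c c<d
quad-mono a<b b<c c<d {2F} {3F} _ = c<d
quad-mono a<b b<c c<d {1F} {1F} (s≤s ())
quad-mono a<b b<c c<d {2F} {1F} (s≤s ())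
quad-mono a<b b<c c<d {2F} {2F} (s≤s (s≤s ()))
quad-mono a<b b<c c<d {3F} {1F} (s≤s ())
quad-mono a<b b<c c<d {3F} {2F} (s≤s (s≤s ()))
quad-mono a<b b<c c<d {3F} {3F} (s≤s (s≤s (s≤s ())))

module _ {n : ℕ} (w : 𝔖 n) where

  private
    W : Fin n → Fin n
    W = w ⟨$⟩ʳ_

  -- s < t < x < y are the letters in increasing order; the i-th entry of u
  -- is the rank i-th smallest, counting from 0.
  occurrence : (u : Vec ℕ 4) (rank : Fin 4 → Fin 4) →
    (∀ i j → Vec.lookup u i < Vec.lookup u j → rank i Fin.< rank j) →
    (∀ i j → ¬ (Vec.lookup u i < Vec.lookup u j) → rank j Fin.≤ rank i) →
    ∀ {a b c d} → a Fin.< b → b Fin.< c → c Fin.< d →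
    ∀ {s t x y} → s Fin.< t → t Fin.< x → x Fin.< y →
    (∀ i → W (quad a b c d i) ≡ quad s t x y (rank i)) → Occurrence u w
  occurrence u rank up down {a} {b} {c} {d} a<b b<c c<d {s} {t} {x} {y} s<t t<x x<y eq = record
    { pos        = quad a b c d
    ; increasing = λ {i} {j} → quad-mono a<b b<c c<d {i} {j}
    ; matches    = λ i j → mk⇔
        (λ lt → subst₂ Fin._<_ (sym (eq i)) (sym (eq j))
          (quad-mono s<t t<x x<y {rank i} {rank j} (up i j lt)))
        (λ lt → decidable-stable (Vec.lookup u i ℕₚ.<? Vec.lookup u j)
          (λ ≮ → ℕₚ.<⇒≱ (subst₂ Fin._<_ (eq i) (eq j) lt) (mono≤ (down i j ≮))))
    }
    where
    mono≤ : ∀ {i j} → i Fin.≤ j → quad s t x y i Fin.≤ quad s t x y j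
    mono≤ {i} {j} i≤j with ℕₚ.m≤n⇒m<n∨m≡n i≤j
    ... | inj₁ i<j = ℕₚ.<⇒≤ (quad-mono s<t t<x x<y {i} {j} i<j)
    ... | inj₂ i≡j = ℕₚ.≤-reflexive (cong (toℕ ∘ quad s t x y) (Finₚ.toℕ-injective i≡j))

  private
    ranks-up : ∀ (u : Vec ℕ 4) (rank : Fin 4 → Fin 4) → Dec
      (∀ i j → Vec.lookup u i < Vec.lookup u j → rank i Fin.< rank j)
    ranks-up u rank = Finₚ.all? (λ i → Finₚ.all?
      (λ j → (Vec.lookup u i ℕₚ.<? Vec.lookup u j) →-dec (rank i Finₚ.<? rank j)))

    ranks-down : ∀ (u : Vec ℕ 4) (rank : Fin 4 → Fin 4) → Dec
      (∀ i j → ¬ (Vec.lookup u i < Vec.lookup u j) → rank j Fin.≤ rank i)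
    ranks-down u rank = Finₚ.all? (λ i → Finₚ.all?
      (λ j → ¬? (Vec.lookup u i ℕₚ.<? Vec.lookup u j) →-dec (rank j Finₚ.≤? rank i)))

  occurrence-4231 : ∀ {a b c d} → a Fin.< b → b Fin.< c → c Fin.< d →
    W d Fin.< W b → W b Fin.< W c → W c Fin.< W a → Occurrence 4231ₚ w
  occurrence-4231 a<b b<c c<d d<b b<c′ c<a = occurrence 4231ₚ (quad 3F 1F 2F 0F)
    (from-yes (ranks-up 4231ₚ (quad 3F 1F 2F 0F))) (from-yes (ranks-down 4231ₚ (quad 3F 1F 2F 0F)))
    a<b b<c c<d d<b b<c′ c<a λ { 0F → refl ; 1F → refl ; 2F → refl ; 3F → refl }

  occurrence-3412 : ∀ {a b c d} → a Fin.< b → b Fin.< c → c Fin.< d →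
    W c Fin.< W d → W d Fin.< W a → W a Fin.< W b → Occurrence 3412ₚ w
  occurrence-3412 a<b b<c c<d c<d′ d<a a<b′ = occurrence 3412ₚ (quad 2F 3F 0F 1F)
    (from-yes (ranks-up 3412ₚ (quad 2F 3F 0F 1F))) (from-yes (ranks-down 3412ₚ (quad 2F 3F 0F 1F)))
    a<b b<c c<d c<d′ d<a a<b′ λ { 0F → refl ; 1F → refl ; 2F → refl ; 3F → refl }

  module _ {g : ℕ} (gap : ∀ o → g ≤ drop₁₄ {w = w} o) (1<g : 1 < g) where

    private
      W⁻¹ : Fin n → Fin n
      W⁻¹ = w ⟨$⟩ˡ_

    -- Among the values from W x to W p, all of which sit at positions
    -- ≤ p or ≥ x, two consecutive ones v and v + 1 sit on opposite sides.
    no-empty-3412 : ∀ {p i j x} → p Fin.< i → i Fin.< j → j Fin.< x →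
      W j Fin.< W x → W x Fin.< W p → W p Fin.< W i →
      (∀ k → p Fin.< k → k Fin.< x → ¬ (W x Fin.< W k × W k Fin.< W p)) → ⊥
    no-empty-3412 {p} {i} {j} {x} p<i i<j j<x Wj<Wx Wx<Wp Wp<Wi empty =
      go (toℕ (W p) ∸ suc (toℕ (W x))) (W x) (trans (sym (ℕₚ.+-suc _ _)) (ℕₚ.m∸n+n≡m Wx<Wp))
        ℕₚ.≤-refl (ℕₚ.≤-reflexive (cong toℕ (sym (inverseˡ w))))
      where
      finish : ∀ {v v′} → toℕ v′ ≡ suc (toℕ v) → W x Fin.≤ v → v′ Fin.≤ W p → x Fin.≤ W⁻¹ v → W⁻¹ v′
        Fin.≤ p → ⊥
      finish {v} {v′} v′≡ Wx≤v v′≤Wp x≤ ≤p = ℕₚ.<⇒≱ 1<g (ℕₚ.≤-trans (gap occ) (ℕₚ.≤-reflexive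
        (trans (cong₂ _∸_ (trans (cong toℕ (inverseʳ w)) v′≡) (cong toℕ (inverseʳ w)))
          (ℕₚ.m+n∸n≡m 1 (toℕ v)))))
        where
        occ : Occurrence 3412ₚ w
        -- The letters `v′`, `W i`, `W j`, `v` form a 3412 whose outer letters differ by 1.
        occ = occurrence-3412 {W⁻¹ v′} {i} {j} {W⁻¹ v} (ℕₚ.≤-<-trans ≤p p<i) i<j (ℕₚ.<-≤-trans j<x x≤)
          (subst (W j Fin.<_) (sym (inverseʳ w)) (ℕₚ.<-≤-trans Wj<Wx Wx≤v))
          (subst₂ Fin._<_ (sym (inverseʳ w)) (sym (inverseʳ w)) (ℕₚ.≤-reflexive (sym v′≡)))
          (subst (Fin._< W i) (sym (inverseʳ w)) (ℕₚ.≤-<-trans v′≤Wp Wp<Wi))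
      go : ∀ d v → suc (d + toℕ v) ≡ toℕ (W p) → W x Fin.≤ v → x Fin.≤ W⁻¹ v → ⊥
      go d v eq Wx≤v x≤ = next d eq
        where
        v<n : suc (toℕ v) < n
        v<n = ℕₚ.≤-<-trans (ℕₚ.≤-trans (s≤s (ℕₚ.m≤n+m (toℕ v) d)) (ℕₚ.≤-reflexive eq)) (Finₚ.toℕ<n (W p))
        v′ = fromℕ< v<n
        v′≡ : toℕ v′ ≡ suc (toℕ v)
        v′≡ = Finₚ.toℕ-fromℕ< v<n
        next : ∀ d → suc (d + toℕ v) ≡ toℕ (W p) → ⊥
        next zero eq = finish v′≡ Wx≤v (ℕₚ.≤-reflexive v′≡Wp) x≤
          (ℕₚ.≤-reflexive (cong toℕ (trans (cong W⁻¹ (Finₚ.toℕ-injective v′≡Wp)) (inverseˡ w))))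
          where
          v′≡Wp : toℕ v′ ≡ toℕ (W p)
          v′≡Wp = trans v′≡ eq
        next (suc d) eq with W⁻¹ v′ Finₚ.≤? p
        ... | yes ≤p = finish v′≡ Wx≤v (ℕₚ.<⇒≤ v′<Wp) x≤ ≤p
          where
          v′<Wp : v′ Fin.< W p
          v′<Wp = subst₂ _<_ (sym v′≡) eq (s≤s (s≤s (ℕₚ.m≤n+m (toℕ v) d)))
        ... | no ≰p with W⁻¹ v′ Finₚ.<? x
        ...   | yes <x = empty (W⁻¹ v′) (ℕₚ.≰⇒> ≰p) <x
                  ( subst (W x Fin.<_) (sym (inverseʳ w)) (ℕₚ.≤-<-trans Wx≤v (ℕₚ.≤-reflexive (sym v′≡)))
                  , subst (Fin._< W p) (sym (inverseʳ w))
                    (subst₂ _<_ (sym v′≡) eq (s≤s (s≤s (ℕₚ.m≤n+m (toℕ v) d)))))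
        ...   | no ≮x = go d v′ (trans (cong suc (trans (cong (_+_ d) v′≡) (ℕₚ.+-suc d (toℕ v)))) eq)
                  (ℕₚ.≤-trans Wx≤v (ℕₚ.≤-trans (ℕₚ.n≤1+n _) (ℕₚ.≤-reflexive (sym v′≡)))) (ℕₚ.≮⇒≥ ≮x)

-- Acyclic graphs

module _ {n : ℕ} where

  Respects : ∀ {A : Set} → (Fin n → A) → List (Fin n × Fin n) → Set
  Respects f = All (λ (i , j) → f i ≡ f j)

  -- The colourings χ witness that no edge closes a cycle with the later ones.
  Acyclic : List (Fin n × Fin n) → Set
  Acyclic []             = ⊤
  Acyclic ((y , p) ∷ es) = Acyclic es × Σ[ χ ∈ (Fin n → Bool) ] (χ y ≢ χ p × Respects χ es)

  -- For an idempotent labelling this is the number of classes.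
  roots : (Fin n → Fin n) → ℕ
  roots lab = ∑[ z < n ] 𝟙 (lab z Finₚ.≟ z)

  ∑1≡n : ∀ n → ∑[ z < n ] 1 ≡ n
  ∑1≡n zero    = refl
  ∑1≡n (suc n) = cong suc (∑1≡n n)

  -- Removing the first edge splits one of the classes of lab.
  module Split (lab : Fin n → Fin n) (idem : ∀ z → lab (lab z) ≡ lab z)
               (χ : Fin n → Bool) {z₀ : Fin n} (split : χ z₀ ≢ χ (lab z₀)) where

    moved? : ∀ z → Dec (lab z ≡ lab z₀ × χ z ≢ χ (lab z₀))
    moved? z = (lab z Finₚ.≟ lab z₀) ×-dec ¬? (χ z Boolₚ.≟ χ (lab z₀))

    -- Two colours divide a class into the part coloured like its representative, which keeps it,
    -- and the rest, which is represented by `z₀`.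
    lab′ : Fin n → Fin n
    lab′ z = if does (moved? z) then z₀ else lab z

    lab′-moved : ∀ {z} → lab z ≡ lab z₀ × χ z ≢ χ (lab z₀) → lab′ z ≡ z₀
    lab′-moved {z} m = cong (λ b → if b then z₀ else lab z) (dec-true (moved? z) m)

    lab′-fixed : ∀ {z} → ¬ (lab z ≡ lab z₀ × χ z ≢ χ (lab z₀)) → lab′ z ≡ lab z
    lab′-fixed {z} ¬m = cong (λ b → if b then z₀ else lab z) (dec-false (moved? z) ¬m)

    lab′-idem : ∀ z → lab′ (lab′ z) ≡ lab′ z
    lab′-idem z = go (moved? z)
      where
      go : Dec _ → lab′ (lab′ z) ≡ lab′ z
      go (yes m) = trans (cong lab′ (lab′-moved m))
        (trans (lab′-moved (refl , split)) (sym (lab′-moved m)))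
      go (no ¬m) = trans (cong lab′ (lab′-fixed ¬m)) (trans (lab′-fixed
        (λ (eq , ≢) → ≢ (cong χ (trans (sym (idem z)) eq)))) (trans (idem z) (sym (lab′-fixed ¬m))))

    lab′-respects : ∀ {i j} → lab i ≡ lab j → χ i ≡ χ j → lab′ i ≡ lab′ j
    lab′-respects {i} {j} li≡lj χi≡χj = go (moved? i)
      where
      go : Dec _ → lab′ i ≡ lab′ j
      go (yes m@(eq , ≢)) = trans (lab′-moved m)
        (sym (lab′-moved (trans (sym li≡lj) eq , subst (_≢ χ (lab z₀)) χi≡χj ≢)))
      go (no ¬m) = trans (lab′-fixed ¬m) (trans li≡lj (sym (lab′-fixed
        (λ (eq , ≢) → ¬m (trans li≡lj eq , subst (_≢ χ (lab z₀)) (sym χi≡χj) ≢)))))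

    roots-lab′ : suc (roots lab) ≤ roots lab′
    roots-lab′ = ℕₚ.≤-trans (ℕₚ.≤-reflexive
      (sym (trans (∑-distrib-+ (λ z → 𝟙 (z Finₚ.≟ z₀)) (λ z → 𝟙 (lab z Finₚ.≟ z)))
      (cong (_+ roots lab) (trans (sum-supported (λ z → 𝟙 (z Finₚ.≟ z₀)) z₀
        (λ z z≢ → 𝟙-no (z Finₚ.≟ z₀) z≢)) (𝟙-yes (z₀ Finₚ.≟ z₀) refl))))))
      (sum-mono pointwise)
      where
      pointwise : ∀ z → 𝟙 (z Finₚ.≟ z₀) + 𝟙 (lab z Finₚ.≟ z) ≤ 𝟙 (lab′ z Finₚ.≟ z)
      pointwise z = go (z Finₚ.≟ z₀) (lab z Finₚ.≟ z)
        where
        go : (d : Dec (z ≡ z₀)) (d′ : Dec (lab z ≡ z)) → 𝟙 d + 𝟙 d′ ≤ 𝟙 (lab′ z Finₚ.≟ z)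
        go (yes refl) (yes lz≡z) = contradiction (cong χ (sym lz≡z)) split
        go (yes refl) (no _)  = ℕₚ.≤-reflexive
          (sym (𝟙-yes (lab′ z Finₚ.≟ z) (lab′-moved (refl , split))))
        go (no _) (yes lz≡z)  = ℕₚ.≤-reflexive (sym (𝟙-yes (lab′ z Finₚ.≟ z)
          (trans (lab′-fixed (λ (eq , ≢) → ≢ (cong χ (trans (sym lz≡z) eq)))) lz≡z)))
        go (no _) (no _)      = z≤n

  -- The ends `y` and `p` of the first edge share a representative but differ in colour, so one of
  -- them differs in colour from it. That end is the representative of a new class, and each removed
  -- edge is paid for by one class.
  acyclic-bound : ∀ es → Acyclic es → ∀ lab → (∀ z → lab (lab z) ≡ lab z) → Respects lab es →
    length es + roots lab ≤ n
  acyclic-bound [] _ lab _ _ = ℕₚ.≤-trans (sum-mono (λ z → 𝟙≤1 (lab z Finₚ.≟ z)))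
    (ℕₚ.≤-reflexive (∑1≡n n))
  acyclic-bound ((y , p) ∷ es) (acyclic , χ , χy≢χp , χ-resp) lab idem (ly≡lp ∷ resp) with χ y
    Boolₚ.≟ χ (lab y)
  ... | no ≢ = ℕₚ.≤-trans (ℕₚ.≤-reflexive (sym (ℕₚ.+-suc (length es) (roots lab))))
        (ℕₚ.≤-trans (ℕₚ.+-monoʳ-≤ (length es) roots-lab′) (acyclic-bound es acyclic lab′ lab′-idem
          (All.map (λ (l≡ , χ≡) → lab′-respects l≡ χ≡) (All.zip (resp , χ-resp)))))
    where open Split lab idem χ {y} ≢
  ... | yes χy≡ = ℕₚ.≤-trans (ℕₚ.≤-reflexive (sym (ℕₚ.+-suc (length es) (roots lab))))
        (ℕₚ.≤-trans (ℕₚ.+-monoʳ-≤ (length es) roots-lab′) (acyclic-bound es acyclic lab′ lab′-idem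
          (All.map (λ (l≡ , χ≡) → lab′-respects l≡ χ≡) (All.zip (resp , χ-resp)))))
    where open Split lab idem χ {p} (λ χp≡ → χy≢χp (trans χy≡ (trans (cong χ ly≡lp) (sym χp≡))))

  -- For a cover (p , y), let x be the next position after y such that
  -- (p , x) is a cover.  The vertices z between p and x with w z < w x are
  -- joined only to each other by the later covers: otherwise there is a
  -- 4231, or a 3412 on p and x with nothing between its outer letters.
  module _ (w : 𝔖 n) (no4231 : Avoids 4231ₚ w) {g : ℕ}
           (gap : ∀ o → g ≤ drop₁₄ {w = w} o) (1<g : 1 < g) where

    private
      W : Fin n → Fin n
      W = w ⟨$⟩ʳ_

      module _ {p y : Fin n} (py : Cover w p y) where

        p<y = proj₁ (proj₁ py)

        Next : Fin n → Set
        Next x = y Fin.< x × Cover w p x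

        next? : Decidable Next
        next? x = (y Finₚ.<? x) ×-dec cover? w (p , x)

        Separator : Set
        Separator = Σ[ χ ∈ (Fin n → Bool) ]
          (χ p ≢ χ y × (∀ {e} → IsCover w e → Lex (p , y) e → χ (proj₁ e) ≡ χ (proj₂ e)))

        -- With no further cover at `p`, all later edges lie strictly to the right of `p`, so one
        -- cut there suffices.
        last-cover : ¬ ∃ Next → Separator
        last-cover ∄next = (λ z → does (p Finₚ.<? z))
          , subst₂ _≢_ (sym (dec-false (p Finₚ.<? p) (ℕₚ.<-irrefl refl)))
            (sym (dec-true (p Finₚ.<? y) p<y)) (λ ())
          , later
          where
          later : ∀ {e} → IsCover w e → Lex (p , y) e → does (p Finₚ.<? proj₁ e) ≡ does
            (p Finₚ.<? proj₂ e)
          later {i , j} ((i<j , _) , _) (inj₁ p<i) =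
            trans (dec-true (p Finₚ.<? i) p<i) (sym (dec-true (p Finₚ.<? j) (ℕₚ.<-trans p<i i<j)))
          later {_ , j} pj (inj₂ (refl , y<j)) = contradiction (j , y<j , pj) ∄next

        next-cover : ∀ {x} → Next x → (∀ z → z Fin.< x → ¬ Next z) → Separator
        next-cover {x} (y<x , px) least = (λ z → does (in? z))
          , subst₂ _≢_ (sym (dec-false (in? p) (λ (p<p , _) → ℕₚ.<-irrefl refl p<p)))
            (sym (dec-true (in? y) y-in)) (λ ())
          , later
          where
          In : Fin n → Set
          In z = p Fin.< z × (z Fin.< x × W z Fin.< W x)
          in? : Decidable In
          in? z = (p Finₚ.<? z) ×-dec ((z Finₚ.<? x) ×-dec (W z Finₚ.<? W x))
          p<x = proj₁ (proj₁ px)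
          Wx<Wp = proj₂ (proj₁ px)
          y-in : In y
          y-in with perm-<-or-> w (<⇒≢ {n} {y} {x} y<x)
          ... | inj₁ Wy<Wx = p<y , y<x , Wy<Wx
          ... | inj₂ Wx<Wy = contradiction (Wx<Wy , proj₂ (proj₁ py)) (proj₂ px y p<y y<x)
          forward : ∀ {i j} → Cover w i j → p Fin.< i → In i → In j
          forward {i} {j} ((i<j , Wj<Wi) , _) p<i (_ , i<x , Wi<Wx) with Finₚ.<-cmp j x
          ... | tri< j<x _ _  = ℕₚ.<-trans p<i i<j , j<x , ℕₚ.<-trans Wj<Wi Wi<Wx
          ... | tri≈ _ refl _ = contradiction Wj<Wi (ℕₚ.<-asym Wi<Wx)
          -- The positions p < i < x < j carry the pattern 4231.
          ... | tri> _ _ x<j  = contradiction (occurrence-4231 w p<i i<x x<j Wj<Wi Wi<Wx Wx<Wp) no4231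
          backward : ∀ {i j} → Cover w i j → p Fin.< i → In j → In i
          backward {i} {j} ((i<j , Wj<Wi) , _) p<i (_ , j<x , Wj<Wx)
            with perm-<-or-> w (<⇒≢ {n} {i} {x} (ℕₚ.<-trans i<j j<x)) | perm-<-or-> w
              (<⇒≢ {n} {p} {i} p<i)
          ... | inj₁ Wi<Wx | _ = p<i , ℕₚ.<-trans i<j j<x , Wi<Wx
          ... | inj₂ Wx<Wi | inj₂ Wi<Wp = contradiction (Wx<Wi , Wi<Wp)
                (proj₂ px i p<i (ℕₚ.<-trans i<j j<x))
          -- The positions p < i < j < x carry 3412, and since (p , x) is a cover no letter between
          -- these positions has a value between those of `x` and `p`.
          ... | inj₂ Wx<Wi | inj₁ Wp<Wi = ⊥-elim
                (no-empty-3412 w gap 1<g p<i i<j j<x Wj<Wx Wx<Wp Wp<Wi (proj₂ px))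
          later : ∀ {e} → IsCover w e → Lex (p , y) e → does (in? (proj₁ e)) ≡ does (in? (proj₂ e))
          later {i , j} ij (inj₁ p<i) = go (in? i)
            where
            go : Dec (In i) → does (in? i) ≡ does (in? j)
            go (yes i-in) = trans (dec-true (in? i) i-in) (sym (dec-true (in? j) (forward ij p<i i-in)))
            go (no ¬i-in) = trans (dec-false (in? i) ¬i-in)
              (sym (dec-false (in? j) (¬i-in ∘ backward ij p<i)))
          later {_ , j} pj (inj₂ (refl , y<j)) =
            trans (dec-false (in? p) (λ (p<p , _) → ℕₚ.<-irrefl refl p<p))
              (sym (dec-false (in? j) (λ (_ , j<x , _) → least j j<x (y<j , pj))))

        separator : Separator
        separator with Finₚ.any? next?
        ... | no ∄next = last-cover ∄next
        ... | yes (x , nx) with Finₚ.¬∀⟶∃¬-smallest n (¬_ ∘ Next) (λ z → ¬? (next? z)) (λ ∄ → ∄ x nx)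
        ...   | x₀ , ¬¬next , least = next-cover (decidable-stable (next? x₀) ¬¬next)
                (λ z z<x₀ → subst (¬_ ∘ Next) (Finₚ.toℕ-injective
                  (trans (Finₚ.toℕ-inject (fromℕ< z<x₀)) (Finₚ.toℕ-fromℕ< z<x₀)))
                  (least (fromℕ< z<x₀)))

      acyclic : ∀ es → All (IsCover w) es → AllPairs Lex es → Acyclic es
      acyclic [] [] [] = tt
      acyclic ((p , y) ∷ es) (py ∷ cov) (lex ∷ lexs) with separator py
      ... | χ , χ≢ , later = acyclic es cov lexs , χ , χ≢ , All.map (λ (c , l) → later c l)
            (All.zip (cov , lex))

    covers-acyclic : Acyclic (covers w)
    covers-acyclic = acyclic (covers w) (covers-cover w) (covers-lex w)

  -- The classes of levels linked by bonds, each labelled by its first level.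
  module _ {m} (𝓐 : Fin m → Interval n) where

    private
      Root : Fin n → Set
      Root x = ∃[ r ] (r Fin.≤ x × ¬ Bonded 𝓐 r × (∀ k → r Fin.< k → k Fin.≤ x → Bonded 𝓐 k))

      root : ∀ N x → toℕ x ≡ N → Root x
      root N x eq with bonded? 𝓐 x
      ... | no ¬b = x , ℕₚ.≤-refl , ¬b , λ k x<k k≤x → contradiction k≤x (ℕₚ.<⇒≱ x<k)
      root zero x eq | yes (j , lo<x , _) = contradiction (subst (toℕ (lo (𝓐 j)) <_) eq lo<x) λ ()
      root (suc N) x eq | yes b with root N x′ x′≡
        where
        N<n : N < n
        N<n = ℕₚ.<-trans (ℕₚ.≤-reflexive (sym eq)) (Finₚ.toℕ<n x)
        x′ = fromℕ< N<n
        x′≡ = Finₚ.toℕ-fromℕ< N<n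
      ... | r , r≤x′ , ¬b , bonded = r
        , ℕₚ.≤-trans r≤x′ (ℕₚ.≤-trans (ℕₚ.≤-reflexive x′≡)
          (ℕₚ.≤-trans (ℕₚ.n≤1+n N) (ℕₚ.≤-reflexive (sym eq))))
        , ¬b , all
        where
        x′≡ = Finₚ.toℕ-fromℕ< (ℕₚ.<-trans (ℕₚ.≤-reflexive (sym eq)) (Finₚ.toℕ<n x))
        all : ∀ k → r Fin.< k → k Fin.≤ x → Bonded 𝓐 k
        all k r<k k≤x with ℕₚ.m≤n⇒m<n∨m≡n k≤x
        ... | inj₂ k≡x = subst (Bonded 𝓐) (Finₚ.toℕ-injective (sym k≡x)) b
        ... | inj₁ k<x = bonded k r<k (subst (toℕ k ≤_) (sym x′≡) (ℕₚ.≤-pred (subst (toℕ k <_) eq k<x)))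

      lab : Fin n → Fin n
      lab x = proj₁ (root (toℕ x) x refl)

      lab-≤ : ∀ x → lab x Fin.≤ x
      lab-≤ x = proj₁ (proj₂ (root (toℕ x) x refl))

      lab-unbonded : ∀ x → ¬ Bonded 𝓐 (lab x)
      lab-unbonded x = proj₁ (proj₂ (proj₂ (root (toℕ x) x refl)))

      lab-bonded : ∀ x k → lab x Fin.< k → k Fin.≤ x → Bonded 𝓐 k
      lab-bonded x = proj₂ (proj₂ (proj₂ (root (toℕ x) x refl)))

      lab-connected : ∀ {x y} → Connected 𝓐 x y → lab x ≡ lab y
      lab-connected {x} {y} c with Finₚ.<-cmp (lab x) (lab y)
      ... | tri≈ _ eq _ = eq
      ... | tri< lt _ _ = contradiction (bond (lab y Finₚ.≤? x)) (lab-unbonded y)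
        where
        bond : Dec (lab y Fin.≤ x) → Bonded 𝓐 (lab y)
        bond (yes ≤x) = lab-bonded x (lab y) lt ≤x
        bond (no ≰x)  = c (lab y) (inj₁ (ℕₚ.≰⇒> ≰x , lab-≤ y))
      ... | tri> _ _ gt = contradiction (bond (lab x Finₚ.≤? y)) (lab-unbonded x)
        where
        bond : Dec (lab x Fin.≤ y) → Bonded 𝓐 (lab x)
        bond (yes ≤y) = lab-bonded y (lab x) gt ≤y
        bond (no ≰y)  = c (lab x) (inj₂ (ℕₚ.≰⇒> ≰y , lab-≤ x))

      lab-root : ∀ {z} → ¬ Bonded 𝓐 z → lab z ≡ z
      lab-root {z} ¬b with Finₚ.<-cmp (lab z) z
      ... | tri< lt _ _ = contradiction (lab-bonded z z lt ℕₚ.≤-refl) ¬b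
      ... | tri≈ _ eq _ = eq
      ... | tri> _ _ gt = contradiction (lab-≤ z) (ℕₚ.<⇒≱ gt)

    -- An unbonded level represents its own class, so bonds and classes together account for all n
    -- levels. The forest bound on edges then cancels against the number of classes.
    acyclic-bonds : ∀ es → Acyclic es → All (λ (i , j) → Connected 𝓐 i j) es → length es ≤ bonds 𝓐
    acyclic-bonds es acyclic conn = ℕₚ.+-cancelʳ-≤ (roots lab) _ _ (ℕₚ.≤-trans
      (acyclic-bound es acyclic lab (λ z → lab-root (lab-unbonded z)) (All.map lab-connected conn)) n≤)
      where
      n≤ : n ≤ bonds 𝓐 + roots lab
      n≤ = ℕₚ.≤-trans (ℕₚ.≤-reflexive (sym (∑1≡n n))) (ℕₚ.≤-trans (sum-mono pointwise)
        (ℕₚ.≤-reflexive (∑-distrib-+ (λ z → 𝟙 (bonded? 𝓐 z)) (λ z → 𝟙 (lab z Finₚ.≟ z)))))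
        where
        pointwise : ∀ z → 1 ≤ 𝟙 (bonded? 𝓐 z) + 𝟙 (lab z Finₚ.≟ z)
        pointwise z = go (bonded? 𝓐 z)
          where
          go : (b : Dec (Bonded 𝓐 z)) → 1 ≤ 𝟙 b + 𝟙 (lab z Finₚ.≟ z)
          go (yes _) = s≤s z≤n
          go (no ¬b) = ℕₚ.≤-reflexive (sym (𝟙-yes (lab z Finₚ.≟ z) (lab-root ¬b)))

-- Comparison of the two sides of a parabolic factorization

Top-product : ∀ {a} {A : Set a} (F : A → Laurent) (D b : A → ℕ) → (∀ x → Top (F x) (+ D x) (+ b x)) →
  ∀ xs → Top (List.foldr _*ᴸ_ 1ᴸ (List.map F xs)) (+ sumᴸ (List.map D xs)) (+ sumᴸ (List.map b xs))
Top-product F D b tops []       = Top-q½^ 0ℤ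
Top-product F D b tops (x ∷ xs) = Top-* (tops x) (Top-product F D b tops xs)

Top-f-factor : ∀ {n m} (𝓐 : Fin m → Interval n) →
  Top (f-factor 𝓐) (+ joints pairsOf 𝓐) (+ joints (_∸ 1) 𝓐)
Top-f-factor {n} {m} 𝓐 = subst₂ (λ D b → Top (f-factor 𝓐) (+ D) (+ b)) (total pairsOf) (total (_∸ 1))
  (Top-product (λ x → [ size x ]q!) (pairsOf ∘ size) (λ x → size x ∸ 1)
    (Top-[]q! ∘ size) (filter ordered? (cartesianProduct (allFin m) (allFin m))))
  where
  size : Fin m × Fin m → ℕ
  size (i , j) = ∣ common 𝓐 i j ∣
  Ordered : Fin m × Fin m → Set
  Ordered (i , j) = i Fin.< j
  ordered? : Decidable Ordered
  ordered? (i , j) = i Finₚ.<? j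
  total : ∀ h → sumᴸ (List.map (h ∘ size)
    (filter ordered? (cartesianProduct (allFin m) (allFin m)))) ≡ joints h 𝓐
  total h = trans (sumᴸ-filter-× ordered? (h ∘ size)) (∑∑-common h 𝓐)

module _ {n : ℕ} where

  Reachable : ∀ {m} → (Fin m → Interval n) → 𝔖 n → Set
  Reachable {m} 𝓐 w = Σ[ u ∈ (Fin m → 𝔖 n) ] (Factors 𝓐 u × w ≈ₚ prod u)

  within? : ∀ (I : Interval n) → Decidable (Within I)
  within? I v = Finₚ.all? (λ k → ¬? (k ∈ᴵ? I) →-dec ((v ⟨$⟩ʳ k) Finₚ.≟ k))

  -- `Fin.pred` is truncated at zero; a bond excludes that case.
  pred-adjacent : ∀ (I : Interval n) {k} → Bond I k → Adjacent (Fin.pred k) k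
  pred-adjacent I {zero}  (() , _)
  pred-adjacent I {suc k} _        = cong suc (sym (Finₚ.toℕ-inject₁ k))

  reversal-descent : ∀ (I : Interval n) {k} → Bond I k →
    ℓ (reversal I) ≡ suc (ℓ (transpose (Fin.pred k) k ⊙ reversal I))
  reversal-descent I {k} b@(lo<k , k≤hi) = ℓ-adjacentˡ-down {n} {Fin.pred k} {k} adj (reversal I)
    (proj₂ (reversal-inverts I {Fin.pred k} {k} pred<k
      (Finₚ.<⇒≤pred lo<k , ℕₚ.≤-trans (ℕₚ.<⇒≤ pred<k) k≤hi) (ℕₚ.<⇒≤ lo<k , k≤hi)))
    where
    adj = pred-adjacent I {k} b
    pred<k = adjacent⇒< {n} {Fin.pred k} {k} adj

  -- Every adjacent transposition inside `I` is a left descent of the reversal, which yields |I| - 1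
  -- elements of length one less.
  reversalCoatoms : Interval n → List (𝔖 n)
  reversalCoatoms I = List.map (λ k → transpose (Fin.pred k) k ⊙ reversal I)
    (filter (bond? I) (allFin n))

  length-reversalCoatoms : ∀ I → length (reversalCoatoms I) ≡ width I
  length-reversalCoatoms I = trans (Listₚ.length-map _ (filter (bond? I) (allFin n)))
    (length-filter-allFin (bond? I))

  reversalCoatoms-distinct : ∀ I → AllPairs (λ u v → ¬ (u ≈ₚ v)) (reversalCoatoms I)
  reversalCoatoms-distinct I = AllPairsₚ.map⁺ (AllPairs-refine {P = Bond I} distinct
    (Allₚ.all-filter (bond? I) (allFin n)) (AllPairsₚ.filter⁺ (bond? I) allFin-<))
    where
    r = reversal I
    distinct : ∀ {k l} → Bond I k → Bond I l → k Fin.< l →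
      ¬ (transpose (Fin.pred k) k ⊙ r ≈ₚ transpose (Fin.pred l) l ⊙ r)
    distinct {k} {l} bk bl k<l eq = <⇒≢ {n} {k} {l} k<l (cong proj₂ (transpose-injective
      {i = Fin.pred k} {j = k} {k = Fin.pred l} {l = l}
      (adjacent⇒< {n} {Fin.pred k} {k} (pred-adjacent I {k} bk))
        (adjacent⇒< {n} {Fin.pred l} {l} (pred-adjacent I {l} bl))
      (λ a → subst (λ a → transpose (Fin.pred k) k ⟨$⟩ʳ a ≡ transpose (Fin.pred l) l ⟨$⟩ʳ a)
        (inverseʳ r) (eq (r ⟨$⟩ˡ a)))))

  -- The combinatorial core. The Hecke algebra contributes just three facts: `w` factors through the
  -- blocks, the top degrees agree, and the second coefficients satisfy an inequality.
  no-3412 : ∀ {m} (𝓐 : Fin m → Interval n) {w} → Reachable 𝓐 w →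
    ∑[ i < m ] pairs (𝓐 i) ≡ 2 * ℓ w + joints pairsOf 𝓐 →
    ∑[ i < m ] width (𝓐 i) ≤ joints (_∸ 1) 𝓐 + length (covers w) →
    Avoids 4231ₚ w → ∀ {g} → (∀ o → g ≤ drop₁₄ {w = w} o) → 1 < g → ¬ Occurrence 3412ₚ w
  no-3412 𝓐 {w} (u , u∈ , w≈) lengths widths no4231 gap 1<g o = no-square 𝓐 u u∈ tree
      (distinct (increasing {0F} {2F} (s≤s z≤n))) (distinct (increasing {0F} {3F} (s≤s z≤n)))
      (distinct (increasing {1F} {2F} (s≤s (s≤s z≤n)))) (distinct (increasing {1F} {3F} (s≤s (s≤s z≤n))))
      (apart {0F} {1F} (s≤s z≤n) (s≤s (s≤s (s≤s (s≤s z≤n)))))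
      (apart {2F} {3F} (s≤s (s≤s (s≤s z≤n))) (s≤s (s≤s z≤n)))
      (crossing {0F} {2F} (s≤s z≤n) (s≤s (s≤s z≤n)))
      (crossing {0F} {3F} (s≤s z≤n) (s≤s (s≤s (s≤s z≤n))))
      (crossing {1F} {2F} (s≤s (s≤s z≤n)) (s≤s (s≤s z≤n)))
      (crossing {1F} {3F} (s≤s (s≤s z≤n)) (s≤s (s≤s (s≤s z≤n))))
    where
    open Occurrence o
    distinct : ∀ {a b : Fin n} → a Fin.< b → a ≢ b
    distinct {a} {b} = <⇒≢ {n} {a} {b}
    transfer : ∀ {a b} → (w ⟨$⟩ʳ a) Fin.< (w ⟨$⟩ʳ b) → (prod u ⟨$⟩ʳ a) Fin.< (prod u ⟨$⟩ʳ b)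
    transfer {a} {b} = subst₂ Fin._<_ (w≈ a) (w≈ b)
    meets : ∀ {a b} → Inversion w a b → Meet 𝓐 u a b
    meets {a} {b} (a<b , gt) = inversion-meet 𝓐 u u∈ {a} {b} (a<b , transfer {b} {a} gt)
    tree : Tree 𝓐
    -- Each cover is an inversion, so its ends are connected through the blocks. Being acyclic, the
    -- covers number at most `bonds 𝓐`, which makes the Euler characteristic bound tight.
    tree = tight⇒tree 𝓐 (ℕₚ.≤-trans widths (ℕₚ.+-monoʳ-≤ (joints (_∸ 1) 𝓐)
      (acyclic-bonds 𝓐 (covers w) (covers-acyclic w no4231 gap 1<g)
        (All.map (λ {(i , j)} cov → meet-connected 𝓐 u u∈ {i} {j} (meets {i} {j} (proj₁ cov)))
          (covers-cover w)))))
    crossing : ∀ {i j} → i Fin.< j → Vec.lookup 3412ₚ j < Vec.lookup 3412ₚ i → Meet 𝓐 u (pos i) (pos j)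
    crossing {i} {j} i<j lt = meets {pos i} {pos j} (increasing i<j , Equivalence.to (matches j i) lt)
    apart : ∀ {i j} → i Fin.< j → Vec.lookup 3412ₚ i < Vec.lookup 3412ₚ j → ¬ Meet 𝓐 u (pos i) (pos j)
    apart {i} {j} i<j lt = noninversion-no-meet 𝓐 u u∈
      (trans lengths (cong (λ m → 2 * m + joints pairsOf 𝓐) (ℓ-cong {n} {w} {prod u} w≈)))
      {pos i} {pos j} (increasing i<j) (transfer {pos i} {pos j} (Equivalence.to (matches i j) lt))

-- From a factorization in the Hecke algebra to combinatorial data

module Factorization {n : ℕ} {H : HeckeAlgebra n} {B : BarInvolution H}
  (K : KazhdanLusztigBasis H B) where

  open HeckeAlgebra H
  open Hecke H
  open KazhdanLusztigBasis K
  open KL K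
  open Leading K

  width≤next : ∀ I → + width I ℤ.≤ next (reversal I)
  width≤next I = subst (λ m → + m ℤ.≤ next (reversal I)) (length-reversalCoatoms I)
    (next-lower (reversal I) (reversalCoatoms I) (reversalCoatoms-distinct I)
      (Allₚ.map⁺ (All.map (λ {k} b → sym (reversal-descent I {k} b)
        , C̃-descent {reversal I} {Fin.pred k} {k} (pred-adjacent I {k} b) (reversal-descent I {k} b))
        (Allₚ.all-filter (bond? I) (allFin n)))))

  C̃-reversal-span : ∀ I → Span (Within I) (C̃ (reversal I))
  C̃-reversal-span I = Span-support (within? I) (λ {u} {v} u≈v u∈ k k∉ → trans (sym (u≈v k)) (u∈ k k∉))
    (C̃ (reversal I)) (λ {v} v∉ → C̃-support {v} {reversal I}
      (λ v≤ → v∉ (within-≤ᴮ I v≤ (within-reversal I))))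

  product : ∀ {m} → (Fin m → 𝓗 n) → 𝓗 n
  product x = List.foldr _∙_ (T e) (List.tabulate x)

  product-span : ∀ {m} (𝓐 : Fin m → Interval n) (x : Fin m → 𝓗 n) → (∀ i → Span (Within (𝓐 i)) (x i)) →
    Span (Reachable 𝓐) (product x)
  product-span {zero}  𝓐 x _  = Span-T {n} {Reachable 𝓐} {e} ((λ ()) , (λ ()) , λ _ → refl)
  product-span {suc m} 𝓐 x x∈ with Span-∙ (𝓐 zero) {Reachable (𝓐 ∘ suc)} (x zero) (product (x ∘ suc))
                                      (x∈ zero) (product-span (𝓐 ∘ suc) (x ∘ suc) (x∈ ∘ suc))
  ... | y , y∈ , x≈y = y , All.map (λ {(_ , v)} → extend-path {v}) y∈ , x≈y
    where
    extend-path : ∀ {v} → Coset (𝓐 zero) (Reachable (𝓐 ∘ suc)) v → Reachable 𝓐 v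
    extend-path {v} (u₀ , v′ , u₀∈ , (u , u∈ , v′≈) , v≈) = u′ , u′∈
      , ≈ₚ-trans {n} {v} {u₀ ⊙ v′} {u₀ ⊙ prod u} v≈ (⊙-congˡ u₀ {v′} {prod u} v′≈)
      where
      u′ : Fin (suc m) → 𝔖 n
      u′ zero    = u₀
      u′ (suc i) = u i
      u′∈ : Factors 𝓐 u′
      u′∈ zero    = u₀∈
      u′∈ (suc i) = u∈ i

  -- The second coefficient is left existential, as for the reversals it is only bounded from below.
  Top-product-C̃ : ∀ {m} (𝓐 : Fin m → Interval n) → ∃[ b ]
    (Top (ε (product (λ i → C̃ (reversal (𝓐 i))))) (+ ∑[ i < m ] (2 * ℓ (reversal (𝓐 i)))) b
    × + ∑[ i < m ] width (𝓐 i) ℤ.≤ b)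
  Top-product-C̃ {zero} 𝓐 = 0ℤ , Top-cong (λ k → sym (trans (ε-T {n} e k)
    (cong (λ m → coeffᴸ (q½^ (+ (2 * m))) k) (ℓ-e {n})))) (Top-q½^ 0ℤ) , ℤₚ.≤-refl
  Top-product-C̃ {suc m} 𝓐 with Top-product-C̃ (𝓐 ∘ suc)
  ... | b , t , ≤b = next (reversal (𝓐 zero)) +ᶻ b
    , Top-cong (λ k → sym (ε-∙ (C̃ (reversal (𝓐 zero))) (product (λ i → C̃ (reversal (𝓐 (suc i))))) k))
        (Top-* (Top-C̃ (reversal (𝓐 zero))) t)
    , ℤₚ.+-mono-≤ (width≤next (𝓐 zero)) ≤b

  module _ {w : 𝔖 n} {m} (𝓐 : Fin m → Interval n)
           (factorization : f-factor 𝓐 · C̃ w ≈ product (λ i → C̃ (reversal (𝓐 i)))) where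

    private
      X = product (λ i → C̃ (reversal (𝓐 i)))
      D = joints pairsOf 𝓐

      leading-coefficients : + D +ᶻ + (2 * ℓ w) ≡ + ∑[ i < m ] (2 * ℓ (reversal (𝓐 i))) ×
        + joints (_∸ 1) 𝓐 +ᶻ next w ≡ proj₁ (Top-product-C̃ 𝓐)
      leading-coefficients = Top-unique
        (λ k → trans (sym (ε-· (f-factor 𝓐) (C̃ w) k))
          (ε-cong {n} {f-factor 𝓐 · C̃ w} {X} factorization k))
        (Top-* (Top-f-factor 𝓐) (Top-C̃ w)) (proj₁ (proj₂ (Top-product-C̃ 𝓐)))

    lengths-add : ∑[ i < m ] pairs (𝓐 i) ≡ 2 * ℓ w + joints pairsOf 𝓐
    lengths-add = trans (sum-cong-≗ (λ i → pairs≡2ℓ (𝓐 i)))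
      (trans (sym (ℤₚ.+-injective (proj₁ leading-coefficients))) (ℕₚ.+-comm D (2 * ℓ w)))

    widths-bound : ∑[ i < m ] width (𝓐 i) ≤ joints (_∸ 1) 𝓐 + length (covers w)
    widths-bound = ℤₚ.drop‿+≤+ (ℤₚ.≤-trans (proj₂ (proj₂ (Top-product-C̃ 𝓐)))
      (ℤₚ.≤-trans (ℤₚ.≤-reflexive (sym (proj₂ leading-coefficients)))
        (ℤₚ.+-monoʳ-≤ (+ joints (_∸ 1) 𝓐) (next-upper w))))

    reachable : Reachable 𝓐 w
    reachable with Span-coeff X (product-span 𝓐 (λ i → C̃ (reversal (𝓐 i)))
      (λ i → C̃-reversal-span (𝓐 i))) {w} (+ D) nonzero
      where
      -- Since P_{w,w} = 1, the coefficient of T_w is `f-factor 𝓐`, whose leading coefficient, at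
      -- exponent `D`, is 1.
      nonzero : ⟨ X ⟩ w (+ D) ≢ 0ℤ
      nonzero eq = contradiction (trans (sym (Top-lead (Top-f-factor 𝓐)))
        (trans (sym coefficient) eq)) λ ()
        where
        coefficient : ⟨ X ⟩ w (+ D) ≡ coeffᴸ (f-factor 𝓐) (+ D)
        coefficient = trans (sym (factorization w (+ D))) (trans (⟨⟩-· (f-factor 𝓐) (C̃ w) w (+ D))
          (trans (act-cong (f-factor 𝓐) (C̃-diag {w} {w} (λ _ → refl)) (+ D))
            (act-1 (f-factor 𝓐) (+ D))))
    ... | v , (u , u∈ , v≈) , v≈w = u , u∈ , ≈ₚ-trans {n} {w} {v} {prod u} (≈ₚ-sym {n} {v} {w} v≈w) v≈

theorem5p2 : (n : ℕ) → 1 ≤ n →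
    (H : HeckeAlgebra n) (B : BarInvolution H) (K : KazhdanLusztigBasis H B) →
    (w : 𝔖 n) → Avoids 4231ₚ w → ¬ Avoids 3412ₚ w →
    (g : ℕ) → IsGap₃₄₁₂ w g → 1 < g →
    ¬ HasParabolicFactorization K w
theorem5p2 n _ H B K w no4231 _ g ((o , _) , gap) 1<g (m , 𝓐 , factorization) =
  let open Factorization K in
  no-3412 𝓐 {w} (reachable {w} 𝓐 factorization) (lengths-add {w} 𝓐 factorization)
    (widths-bound {w} 𝓐 factorization) no4231 gap 1<g o
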